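{- Let $P$ be an $R$-labeled poset of rank $n$ with fixed $R$-labeling $\lambda$. For all $T\subseteq\{0,\dots,n-1\}$ and $\ell\ge 0$, \[ [y^\ell\cdot\mathsf{u}_T]\ {\text{ex}}\Psi(P;y,\mathbf{a},\mathbf{b})=\#\mathsf{B}_\ell(T), \] where $\mathsf{u}_T=w_0\cdots w_{n-1}$ with $w_i=\mathbf{b}$ if $i\in T$ and $w_i=\mathbf{a}$ if $i\notin T$.
   Context: A graded poset $P$ of rank $n$ is a finite poset with unique minimum $\hat 0$ (rank $0$) and unique maximum $\hat 1$ (rank $n$) such that ${\sf rank}(X)$ equals the length of every maximal chain from $\hat 0$ to $X$. A chain is a (possibly empty) totally ordered subset; ${\sf Rank}(\mathcal{C})=\{{\sf rank}(\mathcal{C}_i)\}$. For a graded poset $Q$ with minimum $\hat 0_Q$ and Möbius function $\mu$, $\mathrm{Poin}(Q;y)=\sum_{X\in Q}|\mu(\hat 0_Q,X)|\,y^{{\sf rank}_Q(X)}$; for a chain $\mathcal{C}=\{\mathcal{C}_1<\dots<\mathcal{C}_k\}$, $\mathrm{Poin}_{\mathcal{C}}(P;y)=\prod_{i=1}^k\mathrm{Poin}([\mathcal{C}_i,\mathcal{C}_{i+1}];y)$ with $\mathcal{C}_{k+1}=\hat 1$. The extended $\mathbf{a}\mathbf{b}$-index is ${\text{ex}}\Psi(P;y,\mathbf{a},\mathbf{b})=\sum_{\mathcal{C}}\mathrm{Poin}_{\mathcal{C}}(P;y){\sf wt}_{\mathcal{C}}(\mathbf{a},\mathbf{b})$ over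 chains $\mathcal{C}$ in $P\setminus\{\hat 1\}$, with noncommuting $\mathbf{a},\mathbf{b}$ and ${\sf wt}_{\mathcal{C}}=w_0\cdots w_{n-1}$, $w_i=\mathbf{b}$ if $i\in{\sf Rank}(\mathcal{C})$, else $\mathbf{a}-\mathbf{b}$. An $R$-labeling is a map $\lambda$ from cover relations to positive integers such that every interval has a unique maximal chain with weakly increasing labels; $P$ is $R$-labeled if finite, graded and admitting one. A multichain $\mathcal{D}=\{\{\mathcal{D}_1\le\dots\le\mathcal{D}_k\}\}$ interlaces $\mathcal{C}$ if $\mathcal{C}_1\le\mathcal{D}_1\le\mathcal{C}_2\le\dots\le\mathcal{C}_k\le\mathcal{D}_k$; $\mathsf{irank}(\mathcal{C},\mathcal{D})=\sum_i{\sf rank}(\mathcal{D}_i)-\sum_i{\sf rank}(\mathcal{C}_i)$. A maximal chain $\mathcal{M}=\{\mathcal{M}_0\lessdot\dots\lessdot\mathcal{M}_n\}$ decreases along $[\mathcal{M}_i,\mathcal{M}_j]$ if $\lambda(\mathcal{M}_i,\mathcal{M}_{i+1})>\dots>\lambda(\mathcal{M}_{j-1},\mathcal{M}_j)$, and weakly increases along it if these are weakly increasing. $\mathsf{IncDec}(\mathcal{C},\mathcal{D})$: maximal chains containing all $\mathcal{C}_i,\mathcal{D}_i$, decreasing along each $[\mathcal{C}_i,\mathcal{D}_i]$ and weakly increasing along $[\hat 0,\mathcal{C}_1]$, each $[\mathcal{D}_i,\mathcal{C}_{i+1}]$ and $[\mathcal{D}_k,\hat 1]$. For $S\subseteq\{0,\dots,n-1\}$,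 $\mathsf{A}_\ell(S)$ is the set of triples $(\mathcal{C},\mathcal{D},\mathcal{M})$ with $\mathcal{D}$ interlacing $\mathcal{C}$, ${\sf Rank}(\mathcal{C})=S$, $\mathsf{irank}(\mathcal{C},\mathcal{D})=\ell$, $\mathcal{M}\in\mathsf{IncDec}(\mathcal{C},\mathcal{D})$. For $S\subseteq T$, $\varphi_{S,T}(\mathcal{C},\mathcal{D},\mathcal{M})=(\mathcal{C}\cup\{\mathcal{M}_r:r\in T\setminus S\},\mathcal{D}\sqcup\{\{\mathcal{M}_r:r\in T\setminus S\}\},\mathcal{M})$, an injection $\mathsf{A}_\ell(S)\to\mathsf{A}_\ell(T)$. $\mathsf{B}_\ell(T)=\mathsf{A}_\ell(T)\setminus\bigcup_{S\subsetneq T}\varphi_{S,T}(\mathsf{A}_\ell(S))$. -}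

module Defs where

open import Data.Bool using (Bool; true; false; _∧_; _∨_; not; if_then_else_; T)
open import Data.Nat using (ℕ; zero; suc; _+_; _*_; _∸_; _≡ᵇ_; _≤_)
  renaming (_≤ᵇ_ to _≤ℕᵇ_; _<ᵇ_ to _<ℕᵇ_)
open import Data.Integer using (ℤ; +_; -_; ∣_∣) renaming (_+_ to _+ℤ_; _*_ to _*ℤ_)
open import Data.Fin using (Fin; zero; suc; toℕ; inject₁; _≟_)
open import Data.Fin.Subset using (Subset)
open import Data.List using (List; []; _∷_; _++_; length; map; concatMap; foldr;
  upTo; allFin; take; drop)
open import Data.Vec using (Vec; []; _∷_; toList; lookup; tabulate)
open import Data.Product using (Σ; _×_; _,_)
open import Relation.Binary.PropositionalEquality using (_≡_)
open import Relation.Nullary.Decidable using (⌊_⌋)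

anyᵇ : {A : Set} → (A → Bool) → List A → Bool
anyᵇ p [] = false
anyᵇ p (x ∷ xs) = p x ∨ anyᵇ p xs

allᵇ : {A : Set} → (A → Bool) → List A → Bool
allᵇ p [] = true
allᵇ p (x ∷ xs) = p x ∧ allᵇ p xs

filterᵇ : {A : Set} → (A → Bool) → List A → List A
filterᵇ p [] = []
filterᵇ p (x ∷ xs) = if p x then x ∷ filterᵇ p xs else filterᵇ p xs

count : {A : Set} → (A → Bool) → List A → ℕ
count p xs = length (filterᵇ p xs)

sumℕ : List ℕ → ℕ
sumℕ = foldr _+_ 0

sumℤ : List ℤ → ℤ
sumℤ = foldr _+ℤ_ (+ 0)

prodℤ : List ℤ → ℤ
prodℤ = foldr _*ℤ_ (+ 1)

weakInc : List ℕ → Bool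
weakInc (a ∷ b ∷ r) = (a ≤ℕᵇ b) ∧ weakInc (b ∷ r)
weakInc _ = true

strictDec : List ℕ → Bool
strictDec (a ∷ b ∷ r) = (b <ℕᵇ a) ∧ strictDec (b ∷ r)
strictDec _ = true

_==F_ : {m : ℕ} → Fin m → Fin m → Bool
x ==F y = ⌊ x ≟ y ⌋

eqListF : {m : ℕ} → List (Fin m) → List (Fin m) → Bool
eqListF [] [] = true
eqListF (x ∷ xs) (y ∷ ys) = (x ==F y) ∧ eqListF xs ys
eqListF _ _ = false

eqVecF : {m k : ℕ} → Vec (Fin m) k → Vec (Fin m) k → Bool
eqVecF [] [] = true
eqVecF (x ∷ xs) (y ∷ ys) = (x ==F y) ∧ eqVecF xs ys

eqBool : Bool → Bool → Bool
eqBool true b = b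
eqBool false b = not b

eqVecB : {k : ℕ} → Vec Bool k → Vec Bool k → Bool
eqVecB [] [] = true
eqVecB (x ∷ xs) (y ∷ ys) = eqBool x y ∧ eqVecB xs ys

listsOfLen : (m k : ℕ) → List (List (Fin m))
listsOfLen m zero = [] ∷ []
listsOfLen m (suc k) = concatMap (λ x → map (x ∷_) (listsOfLen m k)) (allFin m)

listsUpTo : (m k : ℕ) → List (List (Fin m))
listsUpTo m k = concatMap (listsOfLen m) (upTo (suc k))

allVecs : (m k : ℕ) → List (Vec (Fin m) k)
allVecs m zero = [] ∷ []
allVecs m (suc k) = concatMap (λ x → map (x ∷_) (allVecs m k)) (allFin m)

allSubsets : (k : ℕ) → List (Subset k)
allSubsets zero = [] ∷ []
allSubsets (suc k) = concatMap (λ b → map (b ∷_) (allSubsets k)) (true ∷ false ∷ [])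

-- Polynomials in y with coefficients in ℕ: coefficient lists, constant first

addP : List ℕ → List ℕ → List ℕ
addP [] q = q
addP (a ∷ p) [] = a ∷ p
addP (a ∷ p) (b ∷ q) = (a + b) ∷ addP p q

mulP : List ℕ → List ℕ → List ℕ
mulP [] q = []
mulP (a ∷ p) q = addP (map (a *_) q) (0 ∷ mulP p q)

monoP : ℕ → ℕ → List ℕ
monoP zero c = c ∷ []
monoP (suc k) c = 0 ∷ monoP k c

coeffP : ℕ → List ℕ → ℕ
coeffP _ [] = 0
coeffP zero (a ∷ _) = a
coeffP (suc k) (_ ∷ p) = coeffP k p

-- Homogeneous degree-n noncommutative polynomials in a, b are represented
-- by their coefficient function on words Vec Bool n (true = b, false = a).
-- The weight w_0 ⋯ w_{n-1} with w_i = b (i ∈ S) and w_i = a - b (i ∉ S):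
-- coefficient of the letter u_i in w_i:
letterCoeff : Bool → Bool → ℤ
letterCoeff true  true  = + 1      -- w_i = b, letter b
letterCoeff true  false = + 0      -- w_i = b, letter a
letterCoeff false true  = - (+ 1)  -- w_i = a - b, letter b
letterCoeff false false = + 1      -- w_i = a - b, letter a

wtCoeff : {n : ℕ} → Subset n → Vec Bool n → ℤ
wtCoeff [] [] = + 1
wtCoeff (s ∷ S) (x ∷ u) = letterCoeff s x *ℤ wtCoeff S u

uWord : {n : ℕ} → Subset n → Vec Bool n
uWord T = T

module Order {m : ℕ} (_≼_ : Fin m → Fin m → Bool) where

  _≺_ : Fin m → Fin m → Bool
  x ≺ y = (x ≼ y) ∧ not (x ==F y)

  _⋖_ : Fin m → Fin m → Bool
  x ⋖ y = (x ≺ y) ∧ not (anyᵇ (λ z → (x ≺ z) ∧ (z ≺ y)) (allFin m))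

  coversTo : Fin m → Fin m → List (Fin m) → Bool
  coversTo y z [] = z ==F y
  coversTo y z (w ∷ ws) = (z ⋖ w) ∧ coversTo y w ws

  satFromTo : Fin m → Fin m → List (Fin m) → Bool
  satFromTo x y [] = false
  satFromTo x y (z ∷ zs) = (x ==F z) ∧ coversTo y z zs

  labelsOf : (Fin m → Fin m → ℕ) → List (Fin m) → List ℕ
  labelsOf λ' (x ∷ y ∷ r) = λ' x y ∷ labelsOf λ' (y ∷ r)
  labelsOf λ' _ = []

record RLabeledPoset (m n : ℕ) : Set where
  field
    _≼_       : Fin m → Fin m → Bool
    ≼-refl    : ∀ x → T (x ≼ x)
    ≼-antisym : ∀ x y → T (x ≼ y) → T (y ≼ x) → x ≡ y
    ≼-trans   : ∀ x y z → T (x ≼ y) → T (y ≼ z) → T (x ≼ z)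
    bot top   : Fin m
    bot-min   : ∀ x → T (bot ≼ x)
    top-max   : ∀ x → T (x ≼ top)
    rank      : Fin m → ℕ
    rank-max  : ∀ x (c : List (Fin m)) → T (Order.satFromTo _≼_ bot x c) →
                length c ≡ suc (rank x)
    rank-top  : rank top ≡ n
    lab       : Fin m → Fin m → ℕ
    lab-pos   : ∀ x y → T (Order._⋖_ _≼_ x y) → 1 ≤ lab x y
    lab-R     : ∀ x y → T (x ≼ y) →
                Σ (List (Fin m)) λ c →
                  T (Order.satFromTo _≼_ x y c ∧ weakInc (Order.labelsOf _≼_ lab c)) ×
                  (∀ c' → T (Order.satFromTo _≼_ x y c' ∧ weakInc (Order.labelsOf _≼_ lab c')) →
                          c' ≡ c)

module _ {m n : ℕ} (P : RLabeledPoset m n) where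
  open RLabeledPoset P
  open Order _≼_

  -- Möbius function, by the recursion μ(x,x)=1, μ(x,z) = -Σ_{x≤y<z} μ(x,y),
  -- with fuel (m suffices: every strict chain has at most m elements)
  mobF : ℕ → Fin m → Fin m → ℤ
  mobF zero x z = + 0
  mobF (suc k) x z =
    if x ==F z then + 1
    else (if x ≺ z
          then - sumℤ (map (mobF k x) (filterᵇ (λ y → (x ≼ y) ∧ (y ≺ z)) (allFin m)))
          else + 0)

  μ : Fin m → Fin m → ℤ
  μ = mobF m

  poinInt : Fin m → Fin m → List ℕ
  poinInt X Y = foldr addP []
    (map (λ Z → monoP (rank Z ∸ rank X) ∣ μ X Z ∣)
         (filterᵇ (λ Z → (X ≼ Z) ∧ (Z ≼ Y)) (allFin m)))

  nextOrTop : List (Fin m) → Fin m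
  nextOrTop [] = top
  nextOrTop (y ∷ _) = y

  poinChain : List (Fin m) → List ℕ
  poinChain [] = 1 ∷ []
  poinChain (x ∷ xs) = mulP (poinInt x (nextOrTop xs)) (poinChain xs)

  strictlyInc : List (Fin m) → Bool
  strictlyInc (x ∷ y ∷ r) = (x ≺ y) ∧ strictlyInc (y ∷ r)
  strictlyInc _ = true

  isChain : List (Fin m) → Bool
  isChain C = strictlyInc C ∧ allᵇ (λ c → not (c ==F top)) C

  rankSet : List (Fin m) → Subset n
  rankSet C = tabulate (λ i → anyᵇ (λ c → rank c ≡ᵇ toℕ i) C)

  rankSetIs : List (Fin m) → Subset n → Bool
  rankSetIs C S = allᵇ (λ c → rank c <ℕᵇ n) C ∧ eqVecB (rankSet C) S

  -- [y^ℓ · u_T] exΨ(P; y, a, b), the sum over all chains C of P ∖ {1̂}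
  -- (every chain has at most m elements)
  exPsiCoeff : ℕ → Subset n → ℤ
  exPsiCoeff ℓ T' = sumℤ (map term (listsUpTo m m))
    where
      term : List (Fin m) → ℤ
      term C = if isChain C
               then (+ coeffP ℓ (poinChain C)) *ℤ wtCoeff (rankSet C) (uWord T')
               else + 0

  Triple : Set
  Triple = List (Fin m) × List (Fin m) × Vec (Fin m) (suc n)

  triples : List Triple
  triples = concatMap (λ k → concatMap (λ C → concatMap (λ D →
              map (λ M → C , D , M) (allVecs m (suc n)))
              (listsOfLen m k)) (listsOfLen m k)) (upTo (suc m))

  nextLe : Fin m → List (Fin m) → Bool
  nextLe d [] = true
  nextLe d (c ∷ _) = d ≼ c

  interlaces : List (Fin m) → List (Fin m) → Bool
  interlaces [] [] = true
  interlaces (c ∷ cs) (d ∷ ds) = (c ≼ d) ∧ nextLe d cs ∧ interlaces cs ds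
  interlaces _ _ = false

  irankIs : List (Fin m) → List (Fin m) → ℕ → Bool
  irankIs C D ℓ = sumℕ (map rank D) ≡ᵇ (ℓ + sumℕ (map rank C))

  isMaxChain : Vec (Fin m) (suc n) → Bool
  isMaxChain M = satFromTo bot top (toList M)

  interleave : List (Fin m) → List (Fin m) → List (Fin m)
  interleave (c ∷ cs) (d ∷ ds) = c ∷ d ∷ interleave cs ds
  interleave _ _ = []

  -- condition on the segment [X, Y] = [M_{rank X}, M_{rank Y}] of M:
  -- weakly increasing (true) or decreasing (false) labels
  segOK : Vec (Fin m) (suc n) → Bool → Fin m → Fin m → Bool
  segOK M inc X Y =
    let L = take (rank Y ∸ rank X) (drop (rank X) (labelsOf lab (toList M)))
    in if inc then weakInc L else strictDec L

  segsOK : Vec (Fin m) (suc n) → Bool → List (Fin m) → Bool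
  segsOK M inc (x ∷ y ∷ r) = segOK M inc x y ∧ segsOK M (not inc) (y ∷ r)
  segsOK M inc _ = true

  incDec : List (Fin m) → List (Fin m) → Vec (Fin m) (suc n) → Bool
  incDec C D M =
    isMaxChain M ∧
    allᵇ (λ x → anyᵇ (x ==F_) (toList M)) (C ++ D) ∧
    segsOK M true (bot ∷ (interleave C D ++ (top ∷ [])))

  inA : ℕ → Subset n → Triple → Bool
  inA ℓ S (C , D , M) =
    isChain C ∧ rankSetIs C S ∧ interlaces C D ∧ irankIs C D ℓ ∧ incDec C D M

  -- φ_{S,T}: add the elements M_r, r ∈ T ∖ S, to C and (as a multiset) to D;
  -- chains / multichains are kept listed in increasing order (insertion by rank)
  insR : Fin m → List (Fin m) → List (Fin m)
  insR x [] = x ∷ []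
  insR x (y ∷ ys) = if rank x ≤ℕᵇ rank y then x ∷ y ∷ ys else y ∷ insR x ys

  newElems : Subset n → Subset n → Vec (Fin m) (suc n) → List (Fin m)
  newElems S T' M = map (λ r → lookup M (inject₁ r))
                        (filterᵇ (λ r → lookup T' r ∧ not (lookup S r)) (allFin n))

  φ : Subset n → Subset n → Triple → Triple
  φ S T' (C , D , M) = foldr insR C (newElems S T' M) ,
                       foldr insR D (newElems S T' M) , M

  eqTriple : Triple → Triple → Bool
  eqTriple (C , D , M) (C' , D' , M') = eqListF C C' ∧ eqListF D D' ∧ eqVecF M M'

  properSubset : Subset n → Subset n → Bool
  properSubset S T' = allᵇ (λ i → not (lookup S i) ∨ lookup T' i) (allFin n)
                      ∧ not (eqVecB S T')

  inImage : ℕ → Subset n → Triple → Bool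
  inImage ℓ T' t = anyᵇ (λ S → properSubset S T' ∧
                     anyᵇ (λ x → inA ℓ S x ∧ eqTriple (φ S T' x) t) triples)
                   (allSubsets n)

  inB : ℕ → Subset n → Triple → Bool
  inB ℓ T' t = inA ℓ T' t ∧ not (inImage ℓ T' t)

  numB : ℕ → Subset n → ℕ
  numB ℓ T' = count (inB ℓ T') triples

{-# OPTIONS --safe #-}

-- A triple (C, D, M) in A_ℓ(S) is determined by S, the maximal chain M and the set of
-- edges of M lying inside some interval [C_i, D_i]; ℓ is the number of these edges.
-- Read M as a word of labels λ with a bit b for each edge (true: inside).  Then
-- (C, D, M) ∈ A_ℓ(S) says that every position of M outside S is good, where a position
-- between edges (b, λ) and (b′, λ′) is good if
--   b = b′ = true and λ′ < λ,  or  b = b′ = false and λ ≤ λ′,  or  b = true, b′ = false.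
-- Goodness does not involve S and φ does not change the word, so B_ℓ(T) consists of the
-- words whose set of bad positions is exactly T.  On the other side, the number of
-- decreasing saturated chains from X to Z is |μ(X, Z)|, and there is exactly one
-- increasing chain, so that the chains C with rank set S contribute the number of words
-- all of whose bad positions lie in S.  The coefficients of wt_C carry out the
-- inclusion-exclusion over S ⊆ T.

module Submission where

open import Defs
open import Data.Nat using (ℕ; zero; suc; _+_; _*_; _∸_; _≤_; _<_; z≤n; s≤s; _<ᵇ_; _≤ᵇ_; _≡ᵇ_)
open import Data.Integer using (ℤ; +_; -_; ∣_∣) renaming (_+_ to _+ℤ_; _*_ to _*ℤ_)
open import Data.Fin.Subset using (Subset)
open import Relation.Binary.PropositionalEquality using (_≡_; refl; sym; trans; cong; cong₂; subst; subst₂; module ≡-Reasoning)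
open import Data.Bool using (Bool; true; false; _∧_; _∨_; not; if_then_else_; T)
import Data.Bool.Properties as Boolₚ
open import Data.Empty using (⊥; ⊥-elim)
open import Data.Fin using (Fin; zero; suc; _≟_; toℕ; fromℕ<; inject₁)
import Data.Fin.Properties as Finₚ
import Data.Integer.Properties as ℤₚ
open import Data.Integer.Solver using (module +-*-Solver)
open import Data.List using (List; []; _∷_; _++_; length; map; concatMap; upTo; allFin; take; drop; foldr)
import Data.List as List
open import Data.List.Membership.Propositional using (_∈_)
open import Data.List.Membership.Propositional.Properties using (∈-concatMap⁺; ∈-allFin; ∈-upTo⁺; ∈-map⁺)
open import Data.List.Properties using (length-++; length-replicate; ++-assoc; ++-identityʳ; map-upTo; drop-drop; map-tabulate; map-∘)
open import Data.List.Relation.Unary.All using (All; []; _∷_)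
import Data.List.Relation.Unary.All as All
import Data.List.Relation.Unary.All.Properties as Allₚ
open import Data.List.Relation.Unary.Any using (here; there)
import Data.List.Relation.Unary.Any as Any
import Data.Nat.Properties as ℕₚ
import Data.Nat.Solver
open import Data.Product using (_×_; _,_; proj₁; proj₂; ∃; ∃₂; Σ)
open import Data.Sum using (inj₁; inj₂)
open import Data.Unit using (⊤; tt)
open import Data.Vec using (Vec; []; _∷_; toList; fromList; replicate; lookup; tabulate)
import Data.Vec as Vec
open import Data.Vec.Properties using (toList∘fromList; tabulate-cong)
open import Function using (_∘_; id)
open import Relation.Nullary using (¬_; yes; no)

open ≡-Reasoning

-- The value of |μ(X, Z)| comes from the same words. A word on an interval [X, Y] all of whose inner
-- positions are good splits, where its true bits stop, into a decreasing chain up to some Z and an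
-- increasing chain above it. Hence a weighted count of such words is a sum over Z in [X, Y] of the
-- number of decreasing chains from X to Z times the weight. With sign (-1) to the number of true
-- bits, the words cancel in pairs, so the signed numbers of decreasing chains obey the recursion
-- that defines μ. With a power of y as weight, the same identity gives the Poincaré polynomial of
-- [X, Y]. Chains, triples and words are listed in enumerations of quite different shapes, so no
-- bijection between lists is built. Both sides of the theorem are written as integer sums of
-- guarded terms and brought to one common sum over `walks n bot top`; reindexing consists of
-- exchanging sums and of removing sums by deltas.

T-∧ : ∀ {a b} → T a → T b → T (a ∧ b)
T-∧ {true} _ q = q

T-∧₁ : ∀ {a b} → T (a ∧ b) → T a
T-∧₁ {true} _ = tt

T-∧₂ : ∀ {a b} → T (a ∧ b) → T b
T-∧₂ {true} q = q

T-true : ∀ {a} → T a → a ≡ true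
T-true {true} _ = refl

T-false : ∀ {a} → ¬ T a → a ≡ false
T-false {true} p = ⊥-elim (p tt)
T-false {false} _ = refl

true-T : ∀ {a} → a ≡ true → T a
true-T refl = tt

T-not : ∀ {a} → ¬ T a → T (not a)
T-not {true} p = p tt
T-not {false} p = tt

not-T : ∀ {a} → T (not a) → ¬ T a
not-T {false} _ ()

T-ext : ∀ {a b} → (T a → T b) → (T b → T a) → a ≡ b
T-ext {true} {true} f g = refl
T-ext {true} {false} f g = ⊥-elim (f tt)
T-ext {false} {true} f g = ⊥-elim (g tt)
T-ext {false} {false} f g = refl

==F⇒≡ : ∀ {m} {x y : Fin m} → T (x ==F y) → x ≡ y
==F⇒≡ {x = x} {y} p with x ≟ y
... | yes q = q

==F-refl : ∀ {m} (x : Fin m) → T (x ==F x)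
==F-refl x with x ≟ x
... | yes q = tt
... | no q = q refl

≡⇒==F : ∀ {m} {x y : Fin m} → x ≡ y → T (x ==F y)
≡⇒==F {x = x} refl = ==F-refl x

eqListF⇒≡ : ∀ {m} {xs ys : List (Fin m)} → T (eqListF xs ys) → xs ≡ ys
eqListF⇒≡ {xs = []} {[]} _ = refl
eqListF⇒≡ {xs = x ∷ xs} {y ∷ ys} p =
  cong₂ _∷_ (==F⇒≡ (T-∧₁ p)) (eqListF⇒≡ (T-∧₂ {x ==F y} p))

eqListF-refl : ∀ {m} (xs : List (Fin m)) → T (eqListF xs xs)
eqListF-refl [] = tt
eqListF-refl (x ∷ xs) = T-∧ (==F-refl x) (eqListF-refl xs)

eqVecF⇒≡ : ∀ {m k} {xs ys : Vec (Fin m) k} → T (eqVecF xs ys) → xs ≡ ys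
eqVecF⇒≡ {xs = []} {[]} _ = refl
eqVecF⇒≡ {xs = x ∷ xs} {y ∷ ys} p =
  cong₂ _∷_ (==F⇒≡ (T-∧₁ p)) (eqVecF⇒≡ (T-∧₂ {x ==F y} p))

eqVecF-refl : ∀ {m k} (xs : Vec (Fin m) k) → T (eqVecF xs xs)
eqVecF-refl [] = tt
eqVecF-refl (x ∷ xs) = T-∧ (==F-refl x) (eqVecF-refl xs)

eqBool⇒≡ : ∀ {a b} → T (eqBool a b) → a ≡ b
eqBool⇒≡ {true} {true} _ = refl
eqBool⇒≡ {false} {false} _ = refl

eqBool-refl : ∀ a → T (eqBool a a)
eqBool-refl true = tt
eqBool-refl false = tt

eqVecB⇒≡ : ∀ {k} {xs ys : Vec Bool k} → T (eqVecB xs ys) → xs ≡ ys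
eqVecB⇒≡ {xs = []} {[]} _ = refl
eqVecB⇒≡ {xs = x ∷ xs} {y ∷ ys} p =
  cong₂ _∷_ (eqBool⇒≡ (T-∧₁ p)) (eqVecB⇒≡ (T-∧₂ {eqBool x y} p))

eqVecB-refl : ∀ {k} (xs : Vec Bool k) → T (eqVecB xs xs)
eqVecB-refl [] = tt
eqVecB-refl (x ∷ xs) = T-∧ (eqBool-refl x) (eqVecB-refl xs)

-- Guarded integers and finite sums

when : Bool → ℤ → ℤ
when b z = if b then z else + 0

when-T : ∀ {b} z → T b → when b z ≡ z
when-T {true} z _ = refl

when-¬T : ∀ {b} z → ¬ T b → when b z ≡ + 0
when-¬T z p rewrite T-false p = refl

when-zero : ∀ b → when b (+ 0) ≡ + 0
when-zero true = refl
when-zero false = refl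

when-∧ : ∀ a b z → when (a ∧ b) z ≡ when a (when b z)
when-∧ true b z = refl
when-∧ false b z = refl

when-+ : ∀ b y z → when b (y +ℤ z) ≡ when b y +ℤ when b z
when-+ true y z = refl
when-+ false y z = refl

when-*ˡ : ∀ b y z → y *ℤ when b z ≡ when b (y *ℤ z)
when-*ˡ true y z = refl
when-*ˡ false y z = ℤₚ.*-zeroʳ y

when-*ʳ : ∀ b y z → when b y *ℤ z ≡ when b (y *ℤ z)
when-*ʳ true y z = refl
when-*ʳ false y z = refl

when-neg : ∀ b z → when b (- z) ≡ - when b z
when-neg true z = refl
when-neg false z = refl

when-comm : ∀ a b z → when a (when b z) ≡ when b (when a z)
when-comm true b z = refl
when-comm false b z = sym (when-zero b)

when-cong : ∀ b {y z} → (T b → y ≡ z) → when b y ≡ when b z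
when-cong true p = p tt
when-cong false p = refl

∑ : {A : Set} → List A → (A → ℤ) → ℤ
∑ [] f = + 0
∑ (x ∷ xs) f = f x +ℤ ∑ xs f

sumℤ-map : ∀ {A : Set} (f : A → ℤ) xs → sumℤ (map f xs) ≡ ∑ xs f
sumℤ-map f [] = refl
sumℤ-map f (x ∷ xs) = cong (f x +ℤ_) (sumℤ-map f xs)

module _ {A : Set} where

  ∑-cong : ∀ (xs : List A) {f g : A → ℤ} → (∀ x → f x ≡ g x) → ∑ xs f ≡ ∑ xs g
  ∑-cong [] p = refl
  ∑-cong (x ∷ xs) p = cong₂ _+ℤ_ (p x) (∑-cong xs p)

  ∑-zero : ∀ (xs : List A) → ∑ xs (λ _ → + 0) ≡ + 0
  ∑-zero [] = refl
  ∑-zero (x ∷ xs) = trans (ℤₚ.+-identityˡ _) (∑-zero xs)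

  ∑-≡0 : ∀ (xs : List A) {f : A → ℤ} → (∀ x → f x ≡ + 0) → ∑ xs f ≡ + 0
  ∑-≡0 xs p = trans (∑-cong xs p) (∑-zero xs)

  ∑-+ : ∀ (xs : List A) (f g : A → ℤ) → ∑ xs (λ x → f x +ℤ g x) ≡ ∑ xs f +ℤ ∑ xs g
  ∑-+ [] f g = refl
  ∑-+ (x ∷ xs) f g = trans (cong ((f x +ℤ g x) +ℤ_) (∑-+ xs f g))
    (solve 4 (λ a b c d → (a :+ b) :+ (c :+ d) := (a :+ c) :+ (b :+ d)) refl
      (f x) (g x) (∑ xs f) (∑ xs g))
    where open +-*-Solver

  ∑-*ˡ : ∀ (xs : List A) a (f : A → ℤ) → ∑ xs (λ x → a *ℤ f x) ≡ a *ℤ ∑ xs f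
  ∑-*ˡ [] a f = sym (ℤₚ.*-zeroʳ a)
  ∑-*ˡ (x ∷ xs) a f =
    trans (cong (a *ℤ f x +ℤ_) (∑-*ˡ xs a f)) (sym (ℤₚ.*-distribˡ-+ a (f x) (∑ xs f)))

  ∑-*ʳ : ∀ (xs : List A) a (f : A → ℤ) → ∑ xs (λ x → f x *ℤ a) ≡ ∑ xs f *ℤ a
  ∑-*ʳ xs a f = trans (∑-cong xs (λ x → ℤₚ.*-comm (f x) a))
    (trans (∑-*ˡ xs a f) (ℤₚ.*-comm a (∑ xs f)))

  ∑-neg : ∀ (xs : List A) (f : A → ℤ) → ∑ xs (λ x → - f x) ≡ - ∑ xs f
  ∑-neg [] f = refl
  ∑-neg (x ∷ xs) f = trans (cong (- f x +ℤ_) (∑-neg xs f)) (sym (ℤₚ.neg-distrib-+ (f x) (∑ xs f)))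

  ∑-when : ∀ (xs : List A) b (f : A → ℤ) → ∑ xs (λ x → when b (f x)) ≡ when b (∑ xs f)
  ∑-when xs true f = refl
  ∑-when xs false f = ∑-zero xs

  ∑-++ : ∀ (xs ys : List A) (f : A → ℤ) → ∑ (xs ++ ys) f ≡ ∑ xs f +ℤ ∑ ys f
  ∑-++ [] ys f = sym (ℤₚ.+-identityˡ _)
  ∑-++ (x ∷ xs) ys f =
    trans (cong (f x +ℤ_) (∑-++ xs ys f)) (sym (ℤₚ.+-assoc (f x) (∑ xs f) (∑ ys f)))

  ∑-filter : ∀ p (xs : List A) (f : A → ℤ) → ∑ (filterᵇ p xs) f ≡ ∑ xs (λ x → when (p x) (f x))
  ∑-filter p [] f = refl
  ∑-filter p (x ∷ xs) f with p x
  ... | true = cong (f x +ℤ_) (∑-filter p xs f)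
  ... | false = trans (∑-filter p xs f) (sym (ℤₚ.+-identityˡ _))

  count-∑ : ∀ p (xs : List A) → + count p xs ≡ ∑ xs (λ x → when (p x) (+ 1))
  count-∑ p [] = refl
  count-∑ p (x ∷ xs) with p x
  ... | true = cong (+ 1 +ℤ_) (count-∑ p xs)
  ... | false = trans (count-∑ p xs) (sym (ℤₚ.+-identityˡ _))

module _ {A B : Set} where

  ∑-swap : ∀ (xs : List A) (ys : List B) (f : A → B → ℤ) →
    ∑ xs (λ x → ∑ ys (f x)) ≡ ∑ ys (λ y → ∑ xs (λ x → f x y))
  ∑-swap [] ys f = sym (∑-zero ys)
  ∑-swap (x ∷ xs) ys f =
    trans (cong (∑ ys (f x) +ℤ_) (∑-swap xs ys f)) (sym (∑-+ ys (f x) _))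

  ∑-map : ∀ (g : A → B) xs (f : B → ℤ) → ∑ (map g xs) f ≡ ∑ xs (f ∘ g)
  ∑-map g [] f = refl
  ∑-map g (x ∷ xs) f = cong (f (g x) +ℤ_) (∑-map g xs f)

  ∑-concatMap : ∀ (g : A → List B) xs (f : B → ℤ) → ∑ (concatMap g xs) f ≡ ∑ xs (λ x → ∑ (g x) f)
  ∑-concatMap g [] f = refl
  ∑-concatMap g (x ∷ xs) f =
    trans (∑-++ (g x) (concatMap g xs) f) (cong (∑ (g x) f +ℤ_) (∑-concatMap g xs f))

-- Sums over the enumerations of elements, vectors, lists and subsets

∑-tabulate : ∀ {A : Set} {k} (g : Fin k → A) (f : A → ℤ) → ∑ (List.tabulate g) f ≡ ∑ (allFin k) (f ∘ g)
∑-tabulate {k = k} g f =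
  trans (cong (λ xs → ∑ xs f) (sym (map-tabulate id g))) (∑-map g (allFin k) f)

∑-allFin-suc : ∀ k (f : Fin (suc k) → ℤ) → ∑ (allFin (suc k)) f ≡ f zero +ℤ ∑ (allFin k) (f ∘ suc)
∑-allFin-suc k f = cong (f zero +ℤ_) (∑-tabulate suc f)

==F-suc : ∀ {k} (x y : Fin k) → (suc x ==F suc y) ≡ (x ==F y)
==F-suc x y = T-ext (λ p → ≡⇒==F (Finₚ.suc-injective (==F⇒≡ p))) (λ p → ≡⇒==F (cong suc (==F⇒≡ p)))

∑-δ : ∀ {k} (x : Fin k) (f : Fin k → ℤ) → ∑ (allFin k) (λ z → when (x ==F z) (f z)) ≡ f x
∑-δ {suc k} zero f = begin
  ∑ (allFin (suc k)) (λ z → when (zero ==F z) (f z)) ≡⟨ ∑-allFin-suc k (λ z → when (zero ==F z) (f z)) ⟩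
  f zero +ℤ ∑ (allFin k) (λ _ → + 0)                 ≡⟨ cong (f zero +ℤ_) (∑-zero (allFin k)) ⟩
  f zero +ℤ + 0                                      ≡⟨ ℤₚ.+-identityʳ _ ⟩
  f zero                                             ∎
∑-δ {suc k} (suc x) f = begin
  ∑ (allFin (suc k)) (λ z → when (suc x ==F z) (f z))
    ≡⟨ ∑-allFin-suc k (λ z → when (suc x ==F z) (f z)) ⟩
  + 0 +ℤ ∑ (allFin k) (λ z → when (suc x ==F suc z) (f (suc z)))
    ≡⟨ ℤₚ.+-identityˡ _ ⟩
  ∑ (allFin k) (λ z → when (suc x ==F suc z) (f (suc z)))
    ≡⟨ ∑-cong (allFin k) (λ z → cong (λ b → when b (f (suc z))) (==F-suc x z)) ⟩
  ∑ (allFin k) (λ z → when (x ==F z) (f (suc z)))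
    ≡⟨ ∑-δ x (f ∘ suc) ⟩
  f (suc x) ∎

∑-allVecs-suc : ∀ m k (f : Vec (Fin m) (suc k) → ℤ) →
  ∑ (allVecs m (suc k)) f ≡ ∑ (allFin m) (λ x → ∑ (allVecs m k) (λ v → f (x ∷ v)))
∑-allVecs-suc m k f = trans (∑-concatMap _ (allFin m) f)
  (∑-cong (allFin m) (λ x → ∑-map (x ∷_) (allVecs m k) f))

∑-listsOfLen-suc : ∀ m k (f : List (Fin m) → ℤ) →
  ∑ (listsOfLen m (suc k)) f ≡ ∑ (allFin m) (λ x → ∑ (listsOfLen m k) (λ v → f (x ∷ v)))
∑-listsOfLen-suc m k f = trans (∑-concatMap _ (allFin m) f)
  (∑-cong (allFin m) (λ x → ∑-map (x ∷_) (listsOfLen m k) f))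

∑-allSubsets-suc : ∀ k (f : Vec Bool (suc k) → ℤ) →
  ∑ (allSubsets (suc k)) f ≡
  ∑ (allSubsets k) (λ S → f (true ∷ S)) +ℤ ∑ (allSubsets k) (λ S → f (false ∷ S))
∑-allSubsets-suc k f = trans (∑-concatMap (λ b → map (b ∷_) (allSubsets k)) (true ∷ false ∷ []) f)
  (cong₂ _+ℤ_ (∑-map (true ∷_) (allSubsets k) f)
    (trans (ℤₚ.+-identityʳ _) (∑-map (false ∷_) (allSubsets k) f)))

-- That an enumeration has no repetitions and no gaps is used only through such delta sums, here and
-- for lists and subsets below.
∑-allVecs-δ : ∀ {m k} (v : Vec (Fin m) k) (f : Vec (Fin m) k → ℤ) →
  ∑ (allVecs m k) (λ u → when (eqVecF v u) (f u)) ≡ f v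
∑-allVecs-δ [] f = ℤₚ.+-identityʳ _
∑-allVecs-δ {m} {suc k} (x ∷ v) f = begin
  ∑ (allVecs m (suc k)) (λ u → when (eqVecF (x ∷ v) u) (f u))
    ≡⟨ ∑-allVecs-suc m k _ ⟩
  ∑ (allFin m) (λ z → ∑ (allVecs m k) (λ u → when ((x ==F z) ∧ eqVecF v u) (f (z ∷ u))))
    ≡⟨ ∑-cong (allFin m) (λ z → trans (∑-cong (allVecs m k) (λ u → when-∧ (x ==F z) _ _))
         (∑-when (allVecs m k) (x ==F z) _)) ⟩
  ∑ (allFin m) (λ z → when (x ==F z) (∑ (allVecs m k) (λ u → when (eqVecF v u) (f (z ∷ u)))))
    ≡⟨ ∑-δ x _ ⟩
  ∑ (allVecs m k) (λ u → when (eqVecF v u) (f (x ∷ u)))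
    ≡⟨ ∑-allVecs-δ v (f ∘ (x ∷_)) ⟩
  f (x ∷ v) ∎

∑-listsOfLen-δ : ∀ {m} (v : List (Fin m)) (f : List (Fin m) → ℤ) →
  ∑ (listsOfLen m (length v)) (λ u → when (eqListF v u) (f u)) ≡ f v
∑-listsOfLen-δ [] f = ℤₚ.+-identityʳ _
∑-listsOfLen-δ {m} (x ∷ v) f = begin
  ∑ (listsOfLen m (suc (length v))) (λ u → when (eqListF (x ∷ v) u) (f u))
    ≡⟨ ∑-listsOfLen-suc m (length v) _ ⟩
  ∑ (allFin m) (λ z → ∑ vs (λ u → when ((x ==F z) ∧ eqListF v u) (f (z ∷ u))))
    ≡⟨ ∑-cong (allFin m) (λ z → trans (∑-cong vs (λ u → when-∧ (x ==F z) _ _))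
         (∑-when vs (x ==F z) _)) ⟩
  ∑ (allFin m) (λ z → when (x ==F z) (∑ vs (λ u → when (eqListF v u) (f (z ∷ u)))))
    ≡⟨ ∑-δ x _ ⟩
  ∑ vs (λ u → when (eqListF v u) (f (x ∷ u)))
    ≡⟨ ∑-listsOfLen-δ v (f ∘ (x ∷_)) ⟩
  f (x ∷ v) ∎
  where vs = listsOfLen m (length v)

∑-listsOfLen-δ′ : ∀ {m} k (v : List (Fin m)) (f : List (Fin m) → ℤ) → ¬ length v ≡ k →
  ∑ (listsOfLen m k) (λ u → when (eqListF v u) (f u)) ≡ + 0
∑-listsOfLen-δ′ zero [] f p = ⊥-elim (p refl)
∑-listsOfLen-δ′ zero (x ∷ v) f p = refl
∑-listsOfLen-δ′ {m} (suc k) [] f p = trans (∑-listsOfLen-suc m k _)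
  (∑-≡0 (allFin m) (λ x → ∑-zero (listsOfLen m k)))
∑-listsOfLen-δ′ {m} (suc k) (x ∷ v) f p = trans (∑-listsOfLen-suc m k _)
  (∑-≡0 (allFin m) (λ z → trans (∑-cong vs (λ u → when-∧ (x ==F z) _ _))
    (trans (∑-when vs (x ==F z) _)
      (trans (cong (when (x ==F z)) (∑-listsOfLen-δ′ k v _ (p ∘ cong suc))) (when-zero (x ==F z))))))
  where vs = listsOfLen m k

∑-allSubsets-δ : ∀ {k} (S : Vec Bool k) (f : Vec Bool k → ℤ) →
  ∑ (allSubsets k) (λ U → when (eqVecB S U) (f U)) ≡ f S
∑-allSubsets-δ [] f = ℤₚ.+-identityʳ _
∑-allSubsets-δ {suc k} (true ∷ S) f = trans (∑-allSubsets-suc k _)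
  (trans (cong₂ _+ℤ_ (∑-allSubsets-δ S (f ∘ (true ∷_))) (∑-zero (allSubsets k))) (ℤₚ.+-identityʳ _))
∑-allSubsets-δ {suc k} (false ∷ S) f = trans (∑-allSubsets-suc k _)
  (trans (cong₂ _+ℤ_ (∑-zero (allSubsets k)) (∑-allSubsets-δ S (f ∘ (false ∷_)))) (ℤₚ.+-identityˡ _))

-- Saturated walks whose steps carry a label and a bit

Word : Set
Word = List (ℕ × Bool)

-- A change from false to true opens an interval [C_i, D_i], which can happen only at an element of
-- C. A change from true to false closes one, and no condition compares the labels on the two sides
-- of D_i.
good : Bool → ℕ → Bool → ℕ → Bool
good true l true l′ = l′ <ᵇ l
good true l false l′ = true
good false l true l′ = false
good false l false l′ = l ≤ᵇ l′

allGood : Bool → ℕ → Word → Bool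
allGood b l [] = true
allGood b l ((l′ , e) ∷ w) = good b l e l′ ∧ allGood e l′ w

-- The first edge is compared with nothing. This is the situation just above an element of the
-- chain, where either bit and any label may follow.
allGoodFree : Word → Bool
allGoodFree [] = true
allGoodFree ((l , e) ∷ w) = allGood e l w

decFrom : ℕ → Word → Bool
decFrom l [] = true
decFrom l ((l′ , e) ∷ w) = e ∧ (l′ <ᵇ l) ∧ decFrom l′ w

isDec : Word → Bool
isDec [] = true
isDec ((l , e) ∷ w) = e ∧ decFrom l w

-- The virtual previous step (false , 0) only forces the first bit to be false.
isInc : Word → Bool
isInc = allGood false 0

exc : Word → ℕ
exc [] = 0
exc ((_ , true) ∷ w) = suc (exc w)
exc ((_ , false) ∷ w) = exc w

-- After a false bit, a good position forces the next bit to be false as well.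
exc-allGood : ∀ l w → T (allGood false l w) → exc w ≡ 0
exc-allGood l [] _ = refl
exc-allGood l ((l′ , false) ∷ w) p = exc-allGood l′ w (T-∧₂ {l ≤ᵇ l′} p)

exc-++ : ∀ u w → exc (u ++ w) ≡ exc u + exc w
exc-++ [] w = refl
exc-++ ((_ , true) ∷ u) w = cong suc (exc-++ u w)
exc-++ ((_ , false) ∷ u) w = exc-++ u w

-- A good word splits into a decreasing run of true bits and an increasing run of false
-- bits at exactly one position, the number of its true bits.
allGood-cut : ∀ l w (G : ℕ → ℤ) →
  when (allGood true l w) (G (exc w)) ≡
  ∑ (allFin (suc (length w)))
    (λ i → when (decFrom l (take (toℕ i) w)) (when (isInc (drop (toℕ i) w)) (G (toℕ i))))
allGood-cut l [] G = sym (ℤₚ.+-identityʳ _)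
allGood-cut l ((l′ , true) ∷ w) G = begin
  when ((l′ <ᵇ l) ∧ allGood true l′ w) (G (suc (exc w)))
    ≡⟨ when-∧ (l′ <ᵇ l) _ _ ⟩
  when (l′ <ᵇ l) (when (allGood true l′ w) (G (suc (exc w))))
    ≡⟨ cong (when (l′ <ᵇ l)) (allGood-cut l′ w (G ∘ suc)) ⟩
  when (l′ <ᵇ l) (∑ (allFin (suc (length w))) h)
    ≡⟨ ∑-when (allFin (suc (length w))) (l′ <ᵇ l) h ⟨
  ∑ (allFin (suc (length w))) (λ i → when (l′ <ᵇ l) (h i))
    ≡⟨ ∑-cong (allFin (suc (length w))) (λ i → when-∧ (l′ <ᵇ l) _ _) ⟨
  ∑ (allFin (suc (length w))) (g ∘ suc)
    ≡⟨ ℤₚ.+-identityˡ _ ⟨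
  g zero +ℤ ∑ (allFin (suc (length w))) (g ∘ suc)
    ≡⟨ ∑-allFin-suc (suc (length w)) g ⟨
  ∑ (allFin (suc (suc (length w)))) g ∎
  where
  g : Fin (suc (suc (length w))) → ℤ
  g i = when (decFrom l (take (toℕ i) ((l′ , true) ∷ w)))
          (when (isInc (drop (toℕ i) ((l′ , true) ∷ w))) (G (toℕ i)))
  h : Fin (suc (length w)) → ℤ
  h i = when (decFrom l′ (take (toℕ i) w)) (when (isInc (drop (toℕ i) w)) (G (suc (toℕ i))))
allGood-cut l ((l′ , false) ∷ w) G = begin
  when (allGood false l′ w) (G (exc w))
    ≡⟨ when-cong (allGood false l′ w) (λ p → cong G (exc-allGood l′ w p)) ⟩
  g zero
    ≡⟨ ℤₚ.+-identityʳ _ ⟨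
  g zero +ℤ + 0
    ≡⟨ cong (g zero +ℤ_) (∑-zero (allFin (suc (length w)))) ⟨
  g zero +ℤ ∑ (allFin (suc (length w))) (g ∘ suc)
    ≡⟨ ∑-allFin-suc (suc (length w)) g ⟨
  ∑ (allFin (suc (suc (length w)))) g ∎
  where
  g : Fin (suc (suc (length w))) → ℤ
  g i = when (decFrom l (take (toℕ i) ((l′ , false) ∷ w)))
          (when (isInc (drop (toℕ i) ((l′ , false) ∷ w))) (G (toℕ i)))

allGoodFree-cut : ∀ w (G : ℕ → ℤ) →
  when (allGoodFree w) (G (exc w)) ≡
  ∑ (allFin (suc (length w)))
    (λ i → when (isDec (take (toℕ i) w)) (when (isInc (drop (toℕ i) w)) (G (toℕ i))))
allGoodFree-cut [] G = sym (ℤₚ.+-identityʳ _)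
allGoodFree-cut ((l , true) ∷ w) G = trans (allGood-cut l w (G ∘ suc))
  (trans (sym (ℤₚ.+-identityˡ _)) (sym (∑-allFin-suc (suc (length w)) g)))
  where
  g : Fin (suc (suc (length w))) → ℤ
  g i = when (isDec (take (toℕ i) ((l , true) ∷ w)))
          (when (isInc (drop (toℕ i) ((l , true) ∷ w))) (G (toℕ i)))
allGoodFree-cut ((l , false) ∷ w) G =
  trans (when-cong (allGood false l w) (λ p → cong G (exc-allGood l w p)))
    (trans (sym (ℤₚ.+-identityʳ _))
      (trans (cong (g zero +ℤ_) (sym (∑-zero (allFin (suc (length w))))))
        (sym (∑-allFin-suc (suc (length w)) g))))
  where
  g : Fin (suc (suc (length w))) → ℤ
  g i = when (isDec (take (toℕ i) ((l , false) ∷ w)))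
          (when (isInc (drop (toℕ i) ((l , false) ∷ w))) (G (toℕ i)))

take-length-++ : ∀ {A : Set} {i} (u w : List A) → length u ≡ i → take i (u ++ w) ≡ u
take-length-++ [] w refl = refl
take-length-++ (x ∷ u) w refl = cong (x ∷_) (take-length-++ u w refl)

drop-length-++ : ∀ {A : Set} {i} (u w : List A) → length u ≡ i → drop i (u ++ w) ≡ w
drop-length-++ [] w refl = refl
drop-length-++ (x ∷ u) w refl = drop-length-++ u w refl

sgn : ℕ → ℤ
sgn zero = + 1
sgn (suc k) = - sgn k

∣sgn*∣ : ∀ k a → ∣ sgn k *ℤ (+ a) ∣ ≡ a
∣sgn*∣ zero a = cong ∣_∣ (ℤₚ.*-identityˡ (+ a))
∣sgn*∣ (suc k) a = trans (cong ∣_∣ (sym (ℤₚ.neg-distribˡ-* (sgn k) (+ a))))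
  (trans (ℤₚ.∣-i∣≡∣i∣ (sgn k *ℤ (+ a))) (∣sgn*∣ k a))

∑-nat : ∀ {A : Set} (xs : List A) {f : A → ℤ} → (∀ x → ∃ λ a → f x ≡ + a) → ∃ λ a → ∑ xs f ≡ + a
∑-nat [] p = 0 , refl
∑-nat (x ∷ xs) p with p x | ∑-nat xs p
... | a , eq | b , eq′ = a + b , cong₂ _+ℤ_ eq eq′

m≢m+1+n : ∀ m k → ¬ m ≡ m + suc k
m≢m+1+n m k eq = ℕₚ.m≢1+m+n m (trans eq (ℕₚ.+-suc m k))

-- Ranks and saturated walks in an R-labeled poset

module Walks {m n : ℕ} (P : RLabeledPoset m n) where
  open RLabeledPoset P
  open Order _≼_

  ≺⇒≼ : ∀ {x y} → T (x ≺ y) → T (x ≼ y)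
  ≺⇒≼ = T-∧₁

  ≺⇒≢ : ∀ {x y} → T (x ≺ y) → ¬ x ≡ y
  ≺⇒≢ {x} {y} p eq = not-T (T-∧₂ {x ≼ y} p) (≡⇒==F eq)

  ≼∧≢⇒≺ : ∀ {x y} → T (x ≼ y) → ¬ x ≡ y → T (x ≺ y)
  ≼∧≢⇒≺ p q = T-∧ p (T-not (q ∘ ==F⇒≡))

  ⋖⇒≼ : ∀ {x y} → T (x ⋖ y) → T (x ≼ y)
  ⋖⇒≼ p = ≺⇒≼ (T-∧₁ p)

  coversTo-++ : ∀ {x y} z us vs → T (coversTo x z us) → T (coversTo y x vs) → T (coversTo y z (us ++ vs))
  coversTo-++ z [] vs p q = subst (λ z → T (coversTo _ z vs)) (sym (==F⇒≡ p)) q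
  coversTo-++ z (u ∷ us) vs p q = T-∧ (T-∧₁ p) (coversTo-++ u us vs (T-∧₂ {z ⋖ u} p) q)

  coversTo⇒≼ : ∀ {y} x us → T (coversTo y x us) → T (x ≼ y)
  coversTo⇒≼ x [] p = subst (λ z → T (x ≼ z)) (==F⇒≡ p) (≼-refl x)
  coversTo⇒≼ x (u ∷ us) p =
    ≼-trans _ _ _ (⋖⇒≼ (T-∧₁ p)) (coversTo⇒≼ u us (T-∧₂ {x ⋖ u} p))

  ∃-coversTo : ∀ {x y} → T (x ≼ y) →
    Σ (List (Fin m)) λ us → T (coversTo y x us) × T (weakInc (labelsOf lab (x ∷ us))) ×
      (∀ vs → T (coversTo y x vs) → T (weakInc (labelsOf lab (x ∷ vs))) → vs ≡ us)
  ∃-coversTo {x} {y} p with lab-R x y p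
  ... | z ∷ us , q , uniq with ==F⇒≡ {x = x} {z} (T-∧₁ (T-∧₁ q))
  ... | refl = us , T-∧₂ {x ==F x} (T-∧₁ q) , T-∧₂ {satFromTo x y (x ∷ us)} q ,
        λ vs c i → cong (drop 1) (uniq (x ∷ vs) (T-∧ (T-∧ (==F-refl x) c) i))

  -- `rank-max` speaks only of chains that start at `bot`. A chain from `bot` to `x`, which the
  -- R-labeling supplies, is put in front of the given one.
  coversTo⇒rank : ∀ {x y} us → T (coversTo y x us) → rank y ≡ rank x + length us
  coversTo⇒rank {x} {y} us p with ∃-coversTo (bot-min x)
  ... | ts , q , _ = ℕₚ.suc-injective (begin
    suc (rank y)              ≡⟨ rank-max y (bot ∷ ts ++ us) (T-∧ (==F-refl bot) (coversTo-++ bot ts us q p)) ⟨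
    suc (length (ts ++ us))   ≡⟨ cong suc (length-++ ts) ⟩
    suc (length ts + length us)
      ≡⟨ cong (_+ length us) (rank-max x (bot ∷ ts) (T-∧ (==F-refl bot) q)) ⟩
    suc (rank x + length us) ∎)

  ⋖⇒rank : ∀ {x y} → T (x ⋖ y) → rank y ≡ suc (rank x)
  ⋖⇒rank {x} {y} p = trans (coversTo⇒rank (y ∷ []) (T-∧ p (==F-refl y))) (ℕₚ.+-comm (rank x) 1)

  ≼⇒rank≤ : ∀ {x y} → T (x ≼ y) → rank x ≤ rank y
  ≼⇒rank≤ p with ∃-coversTo p
  ... | us , q , _ = ℕₚ.≤-trans (ℕₚ.m≤m+n _ (length us)) (ℕₚ.≤-reflexive (sym (coversTo⇒rank us q)))

  ≼∧rank≡⇒≡ : ∀ {x y} → T (x ≼ y) → rank x ≡ rank y → x ≡ y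
  ≼∧rank≡⇒≡ {x} p eq with ∃-coversTo p
  ... | [] , q , _ = ==F⇒≡ q
  ... | u ∷ us , q , _ = ⊥-elim (m≢m+1+n (rank x) (length us) (trans eq (coversTo⇒rank (u ∷ us) q)))

  ≺⇒rank< : ∀ {x y} → T (x ≺ y) → rank x < rank y
  ≺⇒rank< p = ℕₚ.≤∧≢⇒< (≼⇒rank≤ (≺⇒≼ p)) (≺⇒≢ p ∘ ≼∧rank≡⇒≡ (≺⇒≼ p))

  rank-bot : rank bot ≡ 0
  rank-bot = sym (ℕₚ.suc-injective (rank-max bot (bot ∷ []) (T-∧ (==F-refl bot) (==F-refl bot))))

  rank≤n : ∀ x → rank x ≤ n
  rank≤n x = subst (rank x ≤_) rank-top (≼⇒rank≤ (top-max x))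

  -- Vertices are not recorded, so a word occurs once for every saturated chain that carries its
  -- labels. The list serves as a multiset and is only ever summed over.
  walks : ℕ → Fin m → Fin m → List Word
  walks zero x y = if x ==F y then [] ∷ [] else []
  walks (suc k) x y =
    concatMap (λ z → concatMap (λ b → map ((lab x z , b) ∷_) (walks k z y)) (true ∷ false ∷ []))
      (filterᵇ (x ⋖_) (allFin m))

  ∑-walks-zero : ∀ x y (f : Word → ℤ) → ∑ (walks 0 x y) f ≡ when (x ==F y) (f [])
  ∑-walks-zero x y f with x ==F y
  ... | true = ℤₚ.+-identityʳ _
  ... | false = refl

  ∑-walks-suc : ∀ k x y (f : Word → ℤ) →
    ∑ (walks (suc k) x y) f ≡
    ∑ (allFin m) (λ z → when (x ⋖ z)
      (∑ (walks k z y) (λ w → f ((lab x z , true) ∷ w)) +ℤ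
       ∑ (walks k z y) (λ w → f ((lab x z , false) ∷ w))))
  ∑-walks-suc k x y f = begin
    ∑ (walks (suc k) x y) f
      ≡⟨ ∑-concatMap _ (filterᵇ (x ⋖_) (allFin m)) f ⟩
    ∑ (filterᵇ (x ⋖_) (allFin m)) (λ z → ∑ (ext z) f)
      ≡⟨ ∑-filter (x ⋖_) (allFin m) _ ⟩
    ∑ (allFin m) (λ z → when (x ⋖ z) (∑ (ext z) f))
      ≡⟨ ∑-cong (allFin m) (λ z → cong (when (x ⋖ z)) (trans
           (∑-concatMap (λ b → map ((lab x z , b) ∷_) (walks k z y)) (true ∷ false ∷ []) f)
           (cong₂ _+ℤ_ (∑-map _ (walks k z y) f)
             (trans (ℤₚ.+-identityʳ _) (∑-map _ (walks k z y) f))))) ⟩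
    _ ∎
    where
    ext : Fin m → List Word
    ext z = concatMap (λ b → map ((lab x z , b) ∷_) (walks k z y)) (true ∷ false ∷ [])

  ∑-walks-cong : ∀ k x y {f g : Word → ℤ} → (∀ w → length w ≡ k → f w ≡ g w) →
    ∑ (walks k x y) f ≡ ∑ (walks k x y) g
  ∑-walks-cong zero x y {f} {g} p = trans (∑-walks-zero x y f)
    (trans (cong (when (x ==F y)) (p [] refl)) (sym (∑-walks-zero x y g)))
  ∑-walks-cong (suc k) x y {f} {g} p = trans (∑-walks-suc k x y f)
    (trans (∑-cong (allFin m) (λ z → cong (when (x ⋖ z))
      (cong₂ _+ℤ_ (∑-walks-cong k z y (λ w q → p _ (cong suc q)))
                  (∑-walks-cong k z y (λ w q → p _ (cong suc q))))))
      (sym (∑-walks-suc k x y g)))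

  -- Each cover raises the rank by one. The lemma discards terms in sums that run over all elements
  -- although only those at the right height can contribute.
  ∑-walks-empty : ∀ k x y (f : Word → ℤ) → (T (x ≼ y) → rank y ≡ rank x + k → ⊥) →
    ∑ (walks k x y) f ≡ + 0
  ∑-walks-empty zero x y f p = trans (∑-walks-zero x y f)
    (when-¬T _ (λ q → lem (==F⇒≡ q)))
    where
    lem : x ≡ y → ⊥
    lem refl = p (≼-refl x) (sym (ℕₚ.+-identityʳ _))
  ∑-walks-empty (suc k) x y f p = trans (∑-walks-suc k x y f)
    (∑-≡0 (allFin m) (λ z → trans (when-cong (x ⋖ z) (λ c →
      cong₂ _+ℤ_ (∑-walks-empty k z y _ (λ q r → p (≼-trans _ _ _ (⋖⇒≼ c) q) (lem c r)))
                 (∑-walks-empty k z y _ (λ q r → p (≼-trans _ _ _ (⋖⇒≼ c) q) (lem c r)))))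
      (when-zero (x ⋖ z))))
    where
    lem : ∀ {z} → T (x ⋖ z) → rank y ≡ rank z + k → rank y ≡ rank x + suc k
    lem c r = trans r (trans (cong (_+ k) (⋖⇒rank c)) (sym (ℕₚ.+-suc (rank x) k)))

  -- The intermediate vertex `z` is where the walk stands after `i` steps. It is summed over all
  -- elements, since those that no such walk meets contribute empty sums.
  ∑-walks-split : ∀ {i k} → i ≤ k → ∀ x y (f : Word → ℤ) →
    ∑ (walks k x y) f ≡
    ∑ (allFin m) (λ z → ∑ (walks i x z) (λ u → ∑ (walks (k ∸ i) z y) (λ w → f (u ++ w))))
  ∑-walks-split {k = k} z≤n x y f = sym (trans
    (∑-cong (allFin m) (λ z → ∑-walks-zero x z _))
    (∑-δ x (λ z → ∑ (walks k z y) f)))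
  ∑-walks-split {suc i} {suc k} (s≤s i≤k) x y f = begin
    ∑ (walks (suc k) x y) f
      ≡⟨ ∑-walks-suc k x y f ⟩
    ∑ (allFin m) (λ z′ → when (x ⋖ z′)
      (∑ (walks k z′ y) (λ w → f ((lab x z′ , true) ∷ w)) +ℤ
       ∑ (walks k z′ y) (λ w → f ((lab x z′ , false) ∷ w))))
      ≡⟨ ∑-cong (allFin m) (λ z′ → trans (cong (when (x ⋖ z′))
           (trans (cong₂ _+ℤ_ (∑-walks-split i≤k z′ y _) (∑-walks-split i≤k z′ y _))
             (sym (∑-+ (allFin m) (B true z′) (B false z′)))))
           (sym (∑-when (allFin m) (x ⋖ z′) _))) ⟩
    ∑ (allFin m) (λ z′ → ∑ (allFin m) (λ z → when (x ⋖ z′) (B true z′ z +ℤ B false z′ z)))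
      ≡⟨ ∑-swap (allFin m) (allFin m) _ ⟩
    ∑ (allFin m) (λ z → ∑ (allFin m) (λ z′ → when (x ⋖ z′) (B true z′ z +ℤ B false z′ z)))
      ≡⟨ ∑-cong (allFin m) (λ z → sym (∑-walks-suc i x z _)) ⟩
    _ ∎
    where
    B : Bool → Fin m → Fin m → ℤ
    B b z′ z = ∑ (walks i z′ z) (λ u → ∑ (walks (k ∸ i) z y) (λ w → f ((lab x z′ , b) ∷ u ++ w)))

  steps : ∀ {k} → Fin m → Vec (Fin m) k → Vec Bool k → Word
  steps x [] [] = []
  steps x (z ∷ v) (e ∷ E) = (lab x z , e) ∷ steps z v E

  -- Triples mention vertices and words do not. This identity restores the vertices `v` and the bits
  -- `E` behind each word, and so links the count of triples to `walks`.
  ∑-walks-vecs : ∀ k x y (f : Word → ℤ) →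
    ∑ (walks k x y) f ≡
    ∑ (allVecs m k) (λ v → ∑ (allSubsets k) (λ E → when (coversTo y x (toList v)) (f (steps x v E))))
  ∑-walks-vecs zero x y f = trans (∑-walks-zero x y f)
    (sym (trans (ℤₚ.+-identityʳ _) (ℤₚ.+-identityʳ _)))
  ∑-walks-vecs (suc k) x y f = begin
    ∑ (walks (suc k) x y) f
      ≡⟨ ∑-walks-suc k x y f ⟩
    ∑ (allFin m) (λ z → when (x ⋖ z)
      (∑ (walks k z y) (λ w → f ((lab x z , true) ∷ w)) +ℤ
       ∑ (walks k z y) (λ w → f ((lab x z , false) ∷ w))))
      ≡⟨ ∑-cong (allFin m) (λ z → trans (cong (when (x ⋖ z))
           (trans (cong₂ _+ℤ_ (∑-walks-vecs k z y _) (∑-walks-vecs k z y _))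
             (sym (∑-+ (allVecs m k) (λ v → ∑ (allSubsets k) (A z v true))
                                     (λ v → ∑ (allSubsets k) (A z v false))))))
           (sym (∑-when (allVecs m k) (x ⋖ z) _))) ⟩
    ∑ (allFin m) (λ z → ∑ (allVecs m k) (λ v → when (x ⋖ z)
      (∑ (allSubsets k) (A z v true) +ℤ ∑ (allSubsets k) (A z v false))))
      ≡⟨ ∑-cong (allFin m) (λ z → ∑-cong (allVecs m k) (λ v → trans
           (when-+ (x ⋖ z) _ _)
           (cong₂ _+ℤ_ (inside z v true) (inside z v false)))) ⟩
    ∑ (allFin m) (λ z → ∑ (allVecs m k) (λ v →
      ∑ (allSubsets k) (λ E → A′ (z ∷ v) (true ∷ E)) +ℤ ∑ (allSubsets k) (λ E → A′ (z ∷ v) (false ∷ E))))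
      ≡⟨ ∑-cong (allFin m) (λ z → ∑-cong (allVecs m k) (λ v → ∑-allSubsets-suc k (A′ (z ∷ v)))) ⟨
    ∑ (allFin m) (λ z → ∑ (allVecs m k) (λ v → ∑ (allSubsets (suc k)) (A′ (z ∷ v))))
      ≡⟨ ∑-allVecs-suc m k (λ v → ∑ (allSubsets (suc k)) (A′ v)) ⟨
    ∑ (allVecs m (suc k)) (λ v → ∑ (allSubsets (suc k)) (A′ v)) ∎
    where
    A : Fin m → Vec (Fin m) k → Bool → Vec Bool k → ℤ
    A z v b E = when (coversTo y z (toList v)) (f ((lab x z , b) ∷ steps z v E))
    A′ : Vec (Fin m) (suc k) → Vec Bool (suc k) → ℤ
    A′ v E = when (coversTo y x (toList v)) (f (steps x v E))
    inside : ∀ z v b → when (x ⋖ z) (∑ (allSubsets k) (A z v b)) ≡ ∑ (allSubsets k) (λ E → A′ (z ∷ v) (b ∷ E))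
    inside z v b = trans (sym (∑-when (allSubsets k) (x ⋖ z) (A z v b)))
      (∑-cong (allSubsets k) (λ E → sym (when-∧ (x ⋖ z) _ _)))

  allGood-false : ∀ {k} l x (v : Vec (Fin m) k) E →
    allGood false l (steps x v E) ≡
    eqVecB (replicate k false) E ∧ weakInc (l ∷ labelsOf lab (x ∷ toList v))
  allGood-false l x [] [] = refl
  allGood-false l x (z ∷ v) (true ∷ E) = refl
  allGood-false l x (z ∷ v) (false ∷ E) = trans
    (cong ((l ≤ᵇ lab x z) ∧_) (allGood-false (lab x z) z v E))
    (∧-swap (l ≤ᵇ lab x z) (eqVecB (replicate _ false) E) _)
    where
    ∧-swap : ∀ a b c → a ∧ (b ∧ c) ≡ b ∧ (a ∧ c)
    ∧-swap true b c = refl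
    ∧-swap false true c = refl
    ∧-swap false false c = refl

  weakInc-0∷ : ∀ L → weakInc (0 ∷ L) ≡ weakInc L
  weakInc-0∷ [] = refl
  weakInc-0∷ (x ∷ L) = refl

  -- The uniqueness part of the R-labeling enters here. An increasing word has only false bits, so
  -- it comes from a maximal chain of [x, y] with weakly increasing labels, and there is exactly
  -- one.
  ∑-walks-inc : ∀ k x y a → T (x ≼ y) → rank y ≡ rank x + k →
    ∑ (walks k x y) (λ w → when (isInc w) a) ≡ a
  ∑-walks-inc k x y a p r with ∃-coversTo p
  ... | us , c , i , uniq with ℕₚ.+-cancelˡ-≡ (rank x) _ _ (trans (sym r) (coversTo⇒rank us c))
  ... | refl = begin
    ∑ (walks k x y) (λ w → when (isInc w) a)
      ≡⟨ ∑-walks-vecs k x y _ ⟩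
    ∑ (allVecs m k) (λ v → ∑ (allSubsets k) (λ E →
      when (coversTo y x (toList v)) (when (isInc (steps x v E)) a)))
      ≡⟨ ∑-cong (allVecs m k) (λ v → trans (∑-cong (allSubsets k) (λ E →
           trans (sym (when-∧ (coversTo y x (toList v)) _ a))
             (trans (cong (λ b → when b a) (char v E)) (when-∧ (eqVecF v₀ v) _ a))))
           (∑-when (allSubsets k) (eqVecF v₀ v) _)) ⟩
    ∑ (allVecs m k) (λ v → when (eqVecF v₀ v)
      (∑ (allSubsets k) (λ E → when (eqVecB (replicate k false) E) a)))
      ≡⟨ ∑-allVecs-δ v₀ _ ⟩
    ∑ (allSubsets k) (λ E → when (eqVecB (replicate k false) E) a)
      ≡⟨ ∑-allSubsets-δ (replicate k false) (λ _ → a) ⟩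
    a ∎
    where
    v₀ : Vec (Fin m) k
    v₀ = fromList us
    toList-inj : ∀ {j} (v u : Vec (Fin m) j) → toList v ≡ toList u → v ≡ u
    toList-inj [] [] _ = refl
    toList-inj (x ∷ v) (y ∷ u) eq with cong (take 1) eq | toList-inj v u (cong (drop 1) eq)
    ... | refl | refl = refl
    char : ∀ v E → coversTo y x (toList v) ∧ isInc (steps x v E) ≡
                   eqVecF v₀ v ∧ eqVecB (replicate k false) E
    char v E = T-ext
      (λ q → let g = subst T (allGood-false 0 x v E) (T-∧₂ {coversTo y x (toList v)} q)
                 inc = subst T (weakInc-0∷ (labelsOf lab (x ∷ toList v)))
                         (T-∧₂ {eqVecB (replicate k false) E} g)
             in T-∧ (subst (λ u → T (eqVecF v₀ u))
                  (sym (toList-inj v v₀ (trans (uniq (toList v) (T-∧₁ q) inc) (sym (toList∘fromList us)))))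
                  (eqVecF-refl v₀))
                (T-∧₁ g))
      (λ q → let eq = trans (cong toList (sym (eqVecF⇒≡ {xs = v₀} {v} (T-∧₁ q)))) (toList∘fromList us)
             in T-∧ (subst (λ z → T (coversTo y x z)) (sym eq) c)
                (subst T (sym (allGood-false 0 x v E))
                  (T-∧ (T-∧₂ {eqVecF v₀ v} q)
                    (subst T (sym (weakInc-0∷ (labelsOf lab (x ∷ toList v))))
                      (subst (λ z → T (weakInc (labelsOf lab (x ∷ z)))) (sym eq) i)))))

  -- The Möbius function as a signed count of decreasing walks

  decNum : Fin m → Fin m → ℤ
  decNum x z = ∑ (walks (rank z ∸ rank x) x z) (λ w → when (isDec w) (+ 1))

  decNum-nat : ∀ x z → ∃ λ a → decNum x z ≡ + a
  decNum-nat x z = ∑-nat (walks (rank z ∸ rank x) x z) lem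
    where
    lem : ∀ w → ∃ λ a → when (isDec w) (+ 1) ≡ + a
    lem w with isDec w
    ... | true = 1 , refl
    ... | false = 0 , refl

  -- Each good word is cut at the vertex `z` where its true bits stop; above `z` only the unique
  -- increasing walk remains, which leaves the factor `decNum x z`. The weight `G` stays arbitrary
  -- because `sgn` will give the Möbius recursion and a general function the Poincaré polynomial.
  ∑-walks-allGoodFree : ∀ k x y (G : ℕ → ℤ) → T (x ≼ y) → rank y ≡ rank x + k →
    ∑ (walks k x y) (λ w → when (allGoodFree w) (G (exc w))) ≡
    ∑ (allFin m) (λ z → when ((x ≼ z) ∧ (z ≼ y)) (decNum x z *ℤ G (rank z ∸ rank x)))
  ∑-walks-allGoodFree k x y G x≼y r = begin
    ∑ (walks k x y) (λ w → when (allGoodFree w) (G (exc w)))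
      ≡⟨ ∑-walks-cong k x y (λ { w refl → allGoodFree-cut w G }) ⟩
    ∑ (walks k x y) (λ w → ∑ (allFin (suc k)) (λ i →
      when (isDec (take (toℕ i) w)) (when (isInc (drop (toℕ i) w)) (G (toℕ i)))))
      ≡⟨ ∑-swap (walks k x y) (allFin (suc k)) _ ⟩
    ∑ (allFin (suc k)) (λ i → ∑ (walks k x y) (λ w →
      when (isDec (take (toℕ i) w)) (when (isInc (drop (toℕ i) w)) (G (toℕ i)))))
      ≡⟨ ∑-cong (allFin (suc k)) (λ i → trans (∑-walks-split (Finₚ.toℕ≤pred[n] i) x y _)
           (∑-cong (allFin m) (λ z → ∑-walks-cong (toℕ i) x z (λ u q →
             ∑-cong (walks (k ∸ toℕ i) z y) (λ w → cong₂ (λ s t → when (isDec s) (when (isInc t) (G (toℕ i))))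
               (take-length-++ u w q) (drop-length-++ u w q)))))) ⟩
    ∑ (allFin (suc k)) (λ i → ∑ (allFin m) (λ z → W i z))
      ≡⟨ ∑-swap (allFin (suc k)) (allFin m) _ ⟩
    ∑ (allFin m) (λ z → ∑ (allFin (suc k)) (λ i → W i z))
      ≡⟨ ∑-cong (allFin m) collapse ⟩
    ∑ (allFin m) (λ z → when ((x ≼ z) ∧ (z ≼ y)) (decNum x z *ℤ G (rank z ∸ rank x))) ∎
    where
    W : Fin (suc k) → Fin m → ℤ
    W i z = ∑ (walks (toℕ i) x z) (λ u → ∑ (walks (k ∸ toℕ i) z y) (λ w →
              when (isDec u) (when (isInc w) (G (toℕ i)))))
    W-¬x≼z : ∀ i z → (T (x ≼ z) → rank z ≡ rank x + toℕ i → ⊥) → W i z ≡ + 0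
    W-¬x≼z i z p = ∑-walks-empty (toℕ i) x z _ p
    W-¬z≼y : ∀ i z → ¬ T (z ≼ y) → W i z ≡ + 0
    W-¬z≼y i z p = ∑-≡0 (walks (toℕ i) x z) (λ u → ∑-walks-empty (k ∸ toℕ i) z y _ (λ q _ → p q))
    collapse : ∀ z → ∑ (allFin (suc k)) (λ i → W i z) ≡
                     when ((x ≼ z) ∧ (z ≼ y)) (decNum x z *ℤ G (rank z ∸ rank x))
    collapse z with x ≼ z in p | z ≼ y in q
    ... | false | _ = ∑-≡0 (allFin (suc k)) (λ i → W-¬x≼z i z (λ t _ → subst T p t))
    ... | true | false = ∑-≡0 (allFin (suc k)) (λ i → W-¬z≼y i z (λ t → subst T q t))
    ... | true | true = begin
      ∑ (allFin (suc k)) (λ i → W i z)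
        -- A walk from `x` meets `z` only after `rank z ∸ rank x` steps, so all other cut positions
        -- contribute nothing.
        ≡⟨ ∑-cong (allFin (suc k)) (λ i → only i) ⟩
      ∑ (allFin (suc k)) (λ i → when (i₀ ==F i) (W i z))
        ≡⟨ ∑-δ i₀ (λ i → W i z) ⟩
      W i₀ z
        ≡⟨ ∑-cong (walks (toℕ i₀) x z) (λ u → trans (∑-when (walks (k ∸ toℕ i₀) z y) (isDec u) _)
             (cong (when (isDec u)) (∑-walks-inc (k ∸ toℕ i₀) z y _ (true-T q) r₂))) ⟩
      ∑ (walks (toℕ i₀) x z) (λ u → when (isDec u) (G (toℕ i₀)))
        ≡⟨ cong (λ j → ∑ (walks j x z) (λ u → when (isDec u) (G j))) i₀≡ ⟩
      ∑ (walks d x z) (λ u → when (isDec u) (G d))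
        ≡⟨ ∑-cong (walks d x z) (λ u → trans (when-*ʳ (isDec u) (+ 1) (G d))
             (cong (when (isDec u)) (ℤₚ.*-identityˡ (G d)))) ⟨
      ∑ (walks d x z) (λ u → when (isDec u) (+ 1) *ℤ G d)
        ≡⟨ ∑-*ʳ (walks d x z) (G d) _ ⟩
      decNum x z *ℤ G d ∎
      where
      d = rank z ∸ rank x
      rz : rank z ≡ rank x + d
      rz = sym (ℕₚ.m+[n∸m]≡n (≼⇒rank≤ (true-T p)))
      d≤k : d ≤ k
      d≤k = ℕₚ.+-cancelˡ-≤ (rank x) d k
        (subst₂ _≤_ rz r (≼⇒rank≤ (true-T q)))
      i₀ : Fin (suc k)
      i₀ = fromℕ< (s≤s d≤k)
      i₀≡ : toℕ i₀ ≡ d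
      i₀≡ = Finₚ.toℕ-fromℕ< (s≤s d≤k)
      r₂ : rank y ≡ rank z + (k ∸ toℕ i₀)
      r₂ = begin
        rank y                            ≡⟨ r ⟩
        rank x + k                        ≡⟨ cong (λ j → rank x + j) (ℕₚ.m+[n∸m]≡n d≤k) ⟨
        rank x + (d + (k ∸ d))            ≡⟨ ℕₚ.+-assoc (rank x) d (k ∸ d) ⟨
        rank x + d + (k ∸ d)              ≡⟨ cong₂ (λ a b → a + (k ∸ b)) rz i₀≡ ⟨
        rank z + (k ∸ toℕ i₀)             ∎
      only : ∀ i → W i z ≡ when (i₀ ==F i) (W i z)
      only i with i₀ ≟ i
      ... | yes _ = refl
      ... | no i₀≢i = W-¬x≼z i z (λ _ r′ → i₀≢i (Finₚ.toℕ-injective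
              (trans i₀≡ (ℕₚ.+-cancelˡ-≡ (rank x) _ _ (trans (sym rz) r′)))))

  sgn-cancel : ∀ ws l →
    ∑ ws (λ w → when (allGood true l w) (sgn (exc w))) ≡
    ∑ ws (λ w → when (allGood false l w) (sgn (exc w))) →
    ∑ ws (λ w → when (allGood true l w) (- sgn (exc w))) +ℤ
    ∑ ws (λ w → when (allGood false l w) (sgn (exc w))) ≡ + 0
  sgn-cancel ws l eq = begin
    ∑ ws (λ w → when (allGood true l w) (- sgn (exc w))) +ℤ B
      ≡⟨ cong (_+ℤ B) (trans (∑-cong ws (λ w → when-neg (allGood true l w) _)) (∑-neg ws _)) ⟩
    - ∑ ws (λ w → when (allGood true l w) (sgn (exc w))) +ℤ B
      ≡⟨ cong (λ a → - a +ℤ B) eq ⟩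
    - B +ℤ B
      ≡⟨ ℤₚ.+-inverseˡ B ⟩
    + 0 ∎
    where
    B = ∑ ws (λ w → when (allGood false l w) (sgn (exc w)))

  -- Compare the next edge, with label `l′`. If `l′` is below `l`, then after a false bit no
  -- continuation is good, while after a true bit both bits are allowed and their contributions
  -- cancel by induction. If `l ≤ l′`, both sides allow exactly the false bit.
  ∑-walks-sgn : ∀ k x y l →
    ∑ (walks k x y) (λ w → when (allGood true l w) (sgn (exc w))) ≡
    ∑ (walks k x y) (λ w → when (allGood false l w) (sgn (exc w)))
  ∑-walks-sgn zero x y l = trans (∑-walks-zero x y _) (sym (∑-walks-zero x y _))
  ∑-walks-sgn (suc k) x y l = trans (∑-walks-suc k x y _)
    (trans (∑-cong (allFin m) (λ z → cong (when (x ⋖ z)) (step z (lab x z)))) (sym (∑-walks-suc k x y _)))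
    where
    A : Bool → Fin m → ℕ → ℤ
    A b z l′ = ∑ (walks k z y) (λ w → when (allGood b l′ w) (sgn (exc w)))
    step : ∀ z l′ →
      ∑ (walks k z y) (λ w → when ((l′ <ᵇ l) ∧ allGood true l′ w) (- sgn (exc w))) +ℤ A false z l′ ≡
      ∑ (walks k z y) (λ w → + 0) +ℤ
      ∑ (walks k z y) (λ w → when ((l ≤ᵇ l′) ∧ allGood false l′ w) (sgn (exc w)))
    step z l′ with l′ <ᵇ l in p | l ≤ᵇ l′ in q
    ... | true | true = ⊥-elim (ℕₚ.<⇒≱ (ℕₚ.<ᵇ⇒< l′ l (true-T p)) (ℕₚ.≤ᵇ⇒≤ l l′ (true-T q)))
    ... | false | false =
      ⊥-elim (subst T q (ℕₚ.≤⇒≤ᵇ {l} {l′} (ℕₚ.≮⇒≥ (λ r → subst T p (ℕₚ.<⇒<ᵇ {l′} {l} r)))))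
    ... | false | true = refl
    ... | true | false = trans (sgn-cancel (walks k z y) l′ (∑-walks-sgn k z y l′))
      (sym (cong₂ _+ℤ_ (∑-zero (walks k z y)) (∑-zero (walks k z y))))

  -- A nonempty sequence of labels admits no or exactly two good choices of bits, and
  -- the two have opposite signs.
  ∑-walks-sgn-free : ∀ k x y →
    ∑ (walks (suc k) x y) (λ w → when (allGoodFree w) (sgn (exc w))) ≡ + 0
  ∑-walks-sgn-free k x y = trans (∑-walks-suc k x y _)
    (∑-≡0 (allFin m) (λ z → trans
      (cong (when (x ⋖ z)) (sgn-cancel (walks k z y) (lab x z) (∑-walks-sgn k z y (lab x z))))
      (when-zero (x ⋖ z))))

  decNum-refl : ∀ x → decNum x x ≡ + 1
  decNum-refl x = trans (cong (λ d → ∑ (walks d x x) (λ w → when (isDec w) (+ 1))) (ℕₚ.n∸n≡0 (rank x)))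
    (trans (∑-walks-zero x x _) (when-T _ (==F-refl x)))

  -- For `z` different from `x` the signed count of good words from `x` to `z` vanishes. Cut at the
  -- end of the true bits, it is the sum of the products `sgn (rank y ∸ rank x) *ℤ decNum x y` over
  -- [x, z], so these products satisfy the recursion of the Möbius function. The fuel only has to
  -- exceed the rank difference, which drops strictly from `z` to each `y` below it.
  mobF-decNum : ∀ f x z → T (x ≼ z) → rank z ∸ rank x < f →
    mobF P f x z ≡ sgn (rank z ∸ rank x) *ℤ decNum x z
  mobF-decNum (suc f) x z x≼z (s≤s d≤f) with x ≟ z
  ... | yes refl = sym (cong₂ _*ℤ_ (cong sgn (ℕₚ.n∸n≡0 (rank x))) (decNum-refl x))
  ... | no x≢z = begin
    (if (x ≼ z) ∧ true then - S₁ else + 0)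
      ≡⟨ when-T {(x ≼ z) ∧ true} (- S₁) (T-∧ x≼z tt) ⟩
    - S₁
      ≡⟨ cong -_ (trans (sumℤ-map (mobF P f x) (filterᵇ (λ y → (x ≼ y) ∧ (y ≺ z)) (allFin m))) (∑-filter _ (allFin m) (mobF P f x))) ⟩
    - ∑ (allFin m) (λ y → when ((x ≼ y) ∧ (y ≺ z)) (mobF P f x y))
      ≡⟨ cong -_ (∑-cong (allFin m) (λ y → when-cong ((x ≼ y) ∧ (y ≺ z)) (λ q →
           mobF-decNum f x y (T-∧₁ q) (ℕₚ.<-≤-trans
             (ℕₚ.∸-monoˡ-< (≺⇒rank< (T-∧₂ {x ≼ y} q)) (≼⇒rank≤ (T-∧₁ q))) d≤f)))) ⟩
    - ∑ (allFin m) (λ y → when ((x ≼ y) ∧ (y ≺ z)) (h y))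
      ≡⟨ a+b≡0⇒-a≡b _ (h z) total ⟩
    h z ∎
    where
    S₁ = sumℤ (map (mobF P f x) (filterᵇ (λ y → (x ≼ y) ∧ (y ≺ z)) (allFin m)))
    h : Fin m → ℤ
    h y = sgn (rank y ∸ rank x) *ℤ decNum x y
    a+b≡0⇒-a≡b : ∀ a b → a +ℤ b ≡ + 0 → - a ≡ b
    a+b≡0⇒-a≡b a b eq = begin
      - a              ≡⟨ ℤₚ.+-identityʳ _ ⟨
      - a +ℤ + 0       ≡⟨ cong (- a +ℤ_) eq ⟨
      - a +ℤ (a +ℤ b)  ≡⟨ solve 2 (λ a b → :- a :+ (a :+ b) := b) refl a b ⟩
      b ∎
      where open +-*-Solver
    split : ∀ y → when ((x ≼ y) ∧ (y ≺ z)) (h y) +ℤ when (z ==F y) (h y) ≡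
                  when ((x ≼ y) ∧ (y ≼ z)) (decNum x y *ℤ sgn (rank y ∸ rank x))
    split y with z ≟ y
    ... | yes refl = trans (cong₂ _+ℤ_ (when-¬T {(x ≼ z) ∧ (z ≺ z)} _ (λ q → ≺⇒≢ {z} {z} (T-∧₂ {x ≼ z} q) refl)) refl)
          (trans (ℤₚ.+-identityˡ _) (trans (ℤₚ.*-comm _ (decNum x z))
            (sym (when-T {(x ≼ z) ∧ (z ≼ z)} _ (T-∧ x≼z (≼-refl z))))))
    ... | no z≢y = trans (ℤₚ.+-identityʳ _) (trans
          (cong (λ b → when b (h y)) (T-ext {(x ≼ y) ∧ (y ≺ z)} {(x ≼ y) ∧ (y ≼ z)}
            (λ q → T-∧ (T-∧₁ {x ≼ y} q) (≺⇒≼ {y} {z} (T-∧₂ {x ≼ y} q)))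
            (λ q → T-∧ (T-∧₁ {x ≼ y} q) (≼∧≢⇒≺ (T-∧₂ {x ≼ y} q) (z≢y ∘ sym)))))
          (cong (when ((x ≼ y) ∧ (y ≼ z))) (ℤₚ.*-comm _ (decNum x y))))
    d>0 : ∃ λ k → rank z ≡ rank x + suc k
    d>0 with ∃-coversTo x≼z
    ... | [] , c , _ = ⊥-elim (x≢z (==F⇒≡ c))
    ... | u ∷ us , c , _ = length us , coversTo⇒rank (u ∷ us) c
    total : ∑ (allFin m) (λ y → when ((x ≼ y) ∧ (y ≺ z)) (h y)) +ℤ h z ≡ + 0
    total = begin
      ∑ (allFin m) (λ y → when ((x ≼ y) ∧ (y ≺ z)) (h y)) +ℤ h z
        ≡⟨ cong (∑ (allFin m) (λ y → when ((x ≼ y) ∧ (y ≺ z)) (h y)) +ℤ_) (∑-δ z h) ⟨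
      ∑ (allFin m) (λ y → when ((x ≼ y) ∧ (y ≺ z)) (h y)) +ℤ ∑ (allFin m) (λ y → when (z ==F y) (h y))
        ≡⟨ ∑-+ (allFin m) _ _ ⟨
      ∑ (allFin m) (λ y → when ((x ≼ y) ∧ (y ≺ z)) (h y) +ℤ when (z ==F y) (h y))
        ≡⟨ ∑-cong (allFin m) split ⟩
      ∑ (allFin m) (λ y → when ((x ≼ y) ∧ (y ≼ z)) (decNum x y *ℤ sgn (rank y ∸ rank x)))
        ≡⟨ ∑-walks-allGoodFree (suc (proj₁ d>0)) x z sgn x≼z (proj₂ d>0) ⟨
      ∑ (walks (suc (proj₁ d>0)) x z) (λ w → when (allGoodFree w) (sgn (exc w)))
        ≡⟨ ∑-walks-sgn-free (proj₁ d>0) x z ⟩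
      + 0 ∎

-- The extended ab-index

∑-upTo-suc : ∀ k (f : ℕ → ℤ) → ∑ (upTo (suc k)) f ≡ f 0 +ℤ ∑ (upTo k) (f ∘ suc)
∑-upTo-suc k f = cong (f 0 +ℤ_)
  (trans (cong (λ xs → ∑ xs f) (sym (map-upTo suc k))) (∑-map suc (upTo k) f))

∑-listsUpTo : ∀ m k (f : List (Fin m) → ℤ) →
  ∑ (listsUpTo m k) f ≡ ∑ (upTo (suc k)) (λ j → ∑ (listsOfLen m j) f)
∑-listsUpTo m k f = ∑-concatMap (listsOfLen m) (upTo (suc k)) f

∑-listsUpTo-suc : ∀ m k (f : List (Fin m) → ℤ) →
  ∑ (listsUpTo m (suc k)) f ≡ f [] +ℤ ∑ (allFin m) (λ x → ∑ (listsUpTo m k) (λ C → f (x ∷ C)))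
∑-listsUpTo-suc m k f = begin
  ∑ (listsUpTo m (suc k)) f
    ≡⟨ ∑-listsUpTo m (suc k) f ⟩
  ∑ (upTo (suc (suc k))) (λ j → ∑ (listsOfLen m j) f)
    ≡⟨ ∑-upTo-suc (suc k) (λ j → ∑ (listsOfLen m j) f) ⟩
  (f [] +ℤ + 0) +ℤ ∑ (upTo (suc k)) (λ j → ∑ (listsOfLen m (suc j)) f)
    ≡⟨ cong₂ _+ℤ_ (ℤₚ.+-identityʳ (f [])) (∑-cong (upTo (suc k)) (λ j → ∑-listsOfLen-suc m j f)) ⟩
  f [] +ℤ ∑ (upTo (suc k)) (λ j → ∑ (allFin m) (λ x → ∑ (listsOfLen m j) (λ C → f (x ∷ C))))
    ≡⟨ cong (f [] +ℤ_) (∑-swap (upTo (suc k)) (allFin m) (λ j x → ∑ (listsOfLen m j) (λ C → f (x ∷ C)))) ⟩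
  f [] +ℤ ∑ (allFin m) (λ x → ∑ (upTo (suc k)) (λ j → ∑ (listsOfLen m j) (λ C → f (x ∷ C))))
    ≡⟨ cong (f [] +ℤ_) (∑-cong (allFin m) (λ x → ∑-listsUpTo m k (λ C → f (x ∷ C)))) ⟨
  f [] +ℤ ∑ (allFin m) (λ x → ∑ (listsUpTo m k) (λ C → f (x ∷ C))) ∎

-- A polynomial Σ pᵢ yⁱ is used through the linear functional F ↦ Σ pᵢ F(i), under
-- which multiplication of polynomials becomes iteration.
eval : List ℕ → (ℕ → ℤ) → ℤ
eval [] F = + 0
eval (a ∷ p) F = + a *ℤ F 0 +ℤ eval p (F ∘ suc)

eval-cong : ∀ p {F G} → (∀ i → F i ≡ G i) → eval p F ≡ eval p G
eval-cong [] e = refl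
eval-cong (a ∷ p) e = cong₂ _+ℤ_ (cong (+ a *ℤ_) (e 0)) (eval-cong p (e ∘ suc))

eval-zero : ∀ p → eval p (λ _ → + 0) ≡ + 0
eval-zero [] = refl
eval-zero (a ∷ p) = cong₂ _+ℤ_ (ℤₚ.*-zeroʳ (+ a)) (eval-zero p)

eval-+ : ∀ p F G → eval p (λ i → F i +ℤ G i) ≡ eval p F +ℤ eval p G
eval-+ [] F G = refl
eval-+ (a ∷ p) F G = trans (cong (+ a *ℤ (F 0 +ℤ G 0) +ℤ_) (eval-+ p (F ∘ suc) (G ∘ suc)))
  (solve 5 (λ a x y u v → a :* (x :+ y) :+ (u :+ v) := (a :* x :+ u) :+ (a :* y :+ v)) refl
    (+ a) (F 0) (G 0) (eval p (F ∘ suc)) (eval p (G ∘ suc)))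
  where open +-*-Solver

eval-∑ : ∀ {A : Set} p (xs : List A) (F : A → ℕ → ℤ) →
  ∑ xs (λ x → eval p (F x)) ≡ eval p (λ i → ∑ xs (λ x → F x i))
eval-∑ p [] F = sym (eval-zero p)
eval-∑ p (x ∷ xs) F = trans (cong (eval p (F x) +ℤ_) (eval-∑ p xs F)) (sym (eval-+ p (F x) _))

eval-when : ∀ p b F → eval p (λ i → when b (F i)) ≡ when b (eval p F)
eval-when p true F = refl
eval-when p false F = eval-zero p

eval-addP : ∀ p q F → eval (addP p q) F ≡ eval p F +ℤ eval q F
eval-addP [] q F = sym (ℤₚ.+-identityˡ _)
eval-addP (a ∷ p) [] F = sym (ℤₚ.+-identityʳ _)
eval-addP (a ∷ p) (b ∷ q) F = trans
  (cong₂ _+ℤ_ (cong (_*ℤ F 0) (ℤₚ.pos-+ a b)) (eval-addP p q (F ∘ suc)))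
  (solve 5 (λ a b x u v → (a :+ b) :* x :+ (u :+ v) := (a :* x :+ u) :+ (b :* x :+ v)) refl
    (+ a) (+ b) (F 0) (eval p (F ∘ suc)) (eval q (F ∘ suc)))
  where open +-*-Solver

eval-scale : ∀ a q F → eval (map (a *_) q) F ≡ + a *ℤ eval q F
eval-scale a [] F = sym (ℤₚ.*-zeroʳ (+ a))
eval-scale a (b ∷ q) F = trans
  (cong₂ _+ℤ_ (cong (_*ℤ F 0) (ℤₚ.pos-* a b)) (eval-scale a q (F ∘ suc)))
  (solve 4 (λ a b x u → (a :* b) :* x :+ a :* u := a :* (b :* x :+ u)) refl
    (+ a) (+ b) (F 0) (eval q (F ∘ suc)))
  where open +-*-Solver

eval-mulP : ∀ p q F → eval (mulP p q) F ≡ eval p (λ i → eval q (λ j → F (i + j)))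
eval-mulP [] q F = refl
eval-mulP (a ∷ p) q F = trans (eval-addP (map (a *_) q) (0 ∷ mulP p q) F)
  (cong₂ _+ℤ_ (eval-scale a q F) (trans (ℤₚ.+-identityˡ _) (eval-mulP p q (F ∘ suc))))

eval-monoP : ∀ k c F → eval (monoP k c) F ≡ + c *ℤ F k
eval-monoP zero c F = ℤₚ.+-identityʳ _
eval-monoP (suc k) c F = trans (ℤₚ.+-identityˡ _) (eval-monoP k c (F ∘ suc))

eval-foldr-addP : ∀ {A : Set} (g : A → List ℕ) xs F →
  eval (foldr addP [] (map g xs)) F ≡ ∑ xs (λ x → eval (g x) F)
eval-foldr-addP g [] F = refl
eval-foldr-addP g (x ∷ xs) F =
  trans (eval-addP (g x) _ F) (cong (eval (g x) F +ℤ_) (eval-foldr-addP g xs F))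

-- Taking a coefficient is evaluation against an indicator function, so the arithmetic of the
-- polynomials never has to leave `eval`.
eval-coeffP : ∀ ℓ p → eval p (λ i → when (i ≡ᵇ ℓ) (+ 1)) ≡ + coeffP ℓ p
eval-coeffP zero [] = refl
eval-coeffP (suc ℓ) [] = refl
eval-coeffP zero (a ∷ p) =
  trans (cong₂ _+ℤ_ (ℤₚ.*-identityʳ (+ a)) (eval-zero p)) (ℤₚ.+-identityʳ (+ a))
eval-coeffP (suc ℓ) (a ∷ p) =
  trans (cong₂ _+ℤ_ (ℤₚ.*-zeroʳ (+ a)) (eval-coeffP ℓ p)) (ℤₚ.+-identityˡ _)

-- Entry i of the list governs the vertex in front of edge i. The vertex of rank 0 has no earlier
-- edge; after the virtual edge `(false , 0)` it is bad exactly when the first bit is true, that is,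
-- when an interval opens at `bot`. The last vertex is not governed, in keeping with chains that
-- avoid `top`.
ok : Bool → ℕ → List Bool → Word → Bool
ok b l (s ∷ S) ((l′ , e) ∷ w) = (s ∨ good b l e l′) ∧ ok e l′ S w
ok b l _ _ = true

replicate-∷ʳ : ∀ j → List.replicate j false ++ false ∷ [] ≡ List.replicate (suc j) false
replicate-∷ʳ zero = refl
replicate-∷ʳ (suc j) = cong (false ∷_) (replicate-∷ʳ j)

ok-replicate : ∀ j b l w → length w ≡ j → ok b l (List.replicate j false) w ≡ allGood b l w
ok-replicate zero b l [] _ = refl
ok-replicate (suc j) b l ((l′ , e) ∷ w) p =
  cong (good b l e l′ ∧_) (ok-replicate j e l′ w (ℕₚ.suc-injective p))

ok-free : ∀ j w → length w ≡ suc j → ok false 0 (true ∷ List.replicate j false) w ≡ allGoodFree w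
ok-free j ((l′ , e) ∷ w) p = ok-replicate j e l′ w (ℕₚ.suc-injective p)

-- At a position of the set nothing is compared, so the edge in front of it may be replaced by the
-- virtual one. This is why the count of words multiplies over the intervals between consecutive
-- chain elements.
ok-++ : ∀ b l U S u w → length u ≡ length U →
  ok b l (U ++ true ∷ S) (u ++ w) ≡ ok b l U u ∧ ok false 0 (true ∷ S) w
ok-++ b l [] S [] [] p = refl
ok-++ b l [] S [] (_ ∷ w) p = refl
ok-++ b l (s ∷ U) S ((l′ , e) ∷ u) w p = trans
  (cong ((s ∨ good b l e l′) ∧_) (ok-++ e l′ U S u w (ℕₚ.suc-injective p)))
  (sym (Boolₚ.∧-assoc (s ∨ good b l e l′) _ _))

badIs : ∀ {k} → Bool → ℕ → Vec Bool k → Word → Bool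
badIs b l (t ∷ U) ((l′ , e) ∷ w) = eqBool t (not (good b l e l′)) ∧ badIs e l′ U w
badIs b l _ _ = true

-- The inclusion-exclusion factors over the positions. A good position may lie inside or outside `S`
-- and contributes b + (a - b) = a; a bad one must lie in `S` and contributes b.
∑-ok-wtCoeff : ∀ {k} b l (U : Vec Bool k) w → length w ≡ k →
  ∑ (allSubsets k) (λ S → when (ok b l (toList S) w) (wtCoeff S U)) ≡ when (badIs b l U w) (+ 1)
∑-ok-wtCoeff b l [] [] _ = refl
∑-ok-wtCoeff {suc k} b l (t ∷ U) ((l′ , e) ∷ w) p = begin
  ∑ (allSubsets (suc k)) (λ S → when (ok b l (toList S) ((l′ , e) ∷ w)) (wtCoeff S (t ∷ U)))
    ≡⟨ ∑-allSubsets-suc k _ ⟩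
  ∑ (allSubsets k) (λ S → when (ok′ S) (letterCoeff true t *ℤ wtCoeff S U)) +ℤ
  ∑ (allSubsets k) (λ S → when (g ∧ ok′ S) (letterCoeff false t *ℤ wtCoeff S U))
    ≡⟨ cong₂ _+ℤ_ (scale (letterCoeff true t))
         (trans (∑-cong (allSubsets k) (λ S → when-∧ g (ok′ S) _))
           (trans (∑-when (allSubsets k) g _) (cong (when g) (scale (letterCoeff false t))))) ⟩
  letterCoeff true t *ℤ when bad (+ 1) +ℤ when g (letterCoeff false t *ℤ when bad (+ 1))
    ≡⟨ combine t g bad ⟩
  when (eqBool t (not g) ∧ bad) (+ 1) ∎
  where
  g = good b l e l′
  bad = badIs e l′ U w
  ok′ : Vec Bool k → Bool
  ok′ S = ok e l′ (toList S) w
  scale : ∀ c → ∑ (allSubsets k) (λ S → when (ok′ S) (c *ℤ wtCoeff S U)) ≡ c *ℤ when bad (+ 1)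
  scale c = trans (∑-cong (allSubsets k) (λ S → sym (when-*ˡ (ok′ S) c _)))
    (trans (∑-*ˡ (allSubsets k) c _) (cong (c *ℤ_) (∑-ok-wtCoeff e l′ U w (ℕₚ.suc-injective p))))
  combine : ∀ t g bad →
    letterCoeff true t *ℤ when bad (+ 1) +ℤ when g (letterCoeff false t *ℤ when bad (+ 1)) ≡
    when (eqBool t (not g) ∧ bad) (+ 1)
  combine true true true = refl
  combine true true false = refl
  combine true false true = refl
  combine true false false = refl
  combine false true true = refl
  combine false true false = refl
  combine false false true = refl
  combine false false false = refl

allᵇ⇒All : ∀ {A : Set} {p : A → Bool} xs → T (allᵇ p xs) → All (T ∘ p) xs
allᵇ⇒All [] _ = []
allᵇ⇒All {p = p} (x ∷ xs) q = T-∧₁ q ∷ allᵇ⇒All xs (T-∧₂ {p x} q)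

All⇒allᵇ : ∀ {A : Set} {p : A → Bool} {xs} → All (T ∘ p) xs → T (allᵇ p xs)
All⇒allᵇ [] = tt
All⇒allᵇ (q ∷ qs) = T-∧ q (All⇒allᵇ qs)

≡ᵇ-refl : ∀ i → T (i ≡ᵇ i)
≡ᵇ-refl i = ℕₚ.≡⇒≡ᵇ i i refl

-- Poincaré polynomials and chains grouped by rank set

module Chains {m n : ℕ} (P : RLabeledPoset m n) where
  open RLabeledPoset P
  open Order _≼_
  open Walks P

  ∃-rank : ∀ {x y} us r → T (coversTo y x us) → r ≤ length us → ∃ λ z → rank z ≡ rank x + r
  ∃-rank {x} us zero c _ = x , sym (ℕₚ.+-identityʳ (rank x))
  ∃-rank {x} (u ∷ us) (suc r) c (s≤s p) with ∃-rank us r (T-∧₂ {x ⋖ u} c) p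
  ... | z , eq = z , trans eq (trans (cong (_+ r) (⋖⇒rank (T-∧₁ c))) (sym (ℕₚ.+-suc (rank x) r)))

  -- A maximal chain attains every rank from 0 to n, which gives n + 1 different elements. Hence `m`
  -- is enough fuel for the Möbius function and a large enough bound on the length of listed chains.
  n<m : n < m
  n<m with ∃-coversTo (bot-min top)
  ... | us , c , _ = Finₚ.injective⇒≤ {f = λ i → proj₁ (elem i)} (λ {i} {j} eq → Finₚ.toℕ-injective
      (trans (sym (proj₂ (elem i))) (trans (cong rank eq) (proj₂ (elem j)))))
    where
    len : length us ≡ n
    len = trans (sym (trans (coversTo⇒rank us c) (cong (_+ length us) rank-bot))) rank-top
    elem : (i : Fin (suc n)) → ∃ λ z → rank z ≡ toℕ i
    elem i with ∃-rank us (toℕ i) c (subst (toℕ i ≤_) (sym len) (Finₚ.toℕ≤pred[n] i))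
    ... | z , eq = z , trans eq (cong (_+ toℕ i) rank-bot)

  ∣μ∣-decNum : ∀ x z → T (x ≼ z) → + ∣ μ P x z ∣ ≡ decNum x z
  ∣μ∣-decNum x z p with decNum-nat x z
  ... | a , eq = trans (cong (λ i → + ∣ i ∣) (trans
      (mobF-decNum m x z p (ℕₚ.≤-<-trans (ℕₚ.m∸n≤m (rank z) (rank x)) (ℕₚ.≤-<-trans (rank≤n z) n<m)))
      (cong (sgn (rank z ∸ rank x) *ℤ_) eq)))
    (trans (cong +_ (∣sgn*∣ (rank z ∸ rank x) a)) (sym eq))

  eval-poinInt : ∀ k x y F → T (x ≼ y) → rank y ≡ rank x + k →
    eval (poinInt P x y) F ≡ ∑ (walks k x y) (λ w → when (allGoodFree w) (F (exc w)))
  eval-poinInt k x y F p r = begin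
    eval (poinInt P x y) F
      ≡⟨ eval-foldr-addP _ (filterᵇ (λ z → (x ≼ z) ∧ (z ≼ y)) (allFin m)) F ⟩
    ∑ (filterᵇ (λ z → (x ≼ z) ∧ (z ≼ y)) (allFin m))
      (λ z → eval (monoP (rank z ∸ rank x) ∣ μ P x z ∣) F)
      ≡⟨ ∑-filter _ (allFin m) _ ⟩
    ∑ (allFin m) (λ z → when ((x ≼ z) ∧ (z ≼ y)) (eval (monoP (rank z ∸ rank x) ∣ μ P x z ∣) F))
      ≡⟨ ∑-cong (allFin m) (λ z → when-cong ((x ≼ z) ∧ (z ≼ y)) (λ q →
           trans (eval-monoP (rank z ∸ rank x) ∣ μ P x z ∣ F)
             (cong (_*ℤ F (rank z ∸ rank x)) (∣μ∣-decNum x z (T-∧₁ q))))) ⟩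
    ∑ (allFin m) (λ z → when ((x ≼ z) ∧ (z ≼ y)) (decNum x z *ℤ F (rank z ∸ rank x)))
      ≡⟨ ∑-walks-allGoodFree k x y F p r ⟨
    ∑ (walks k x y) (λ w → when (allGoodFree w) (F (exc w))) ∎

  below : Fin m → List (Fin m) → Bool
  below x [] = true
  below x (y ∷ _) = x ≺ y

  -- S lists the ranks r, r+1, …, n-1.
  chains : ∀ {k} → ℕ → Vec Bool k → List (List (Fin m))
  chains r [] = [] ∷ []
  chains r (false ∷ S) = chains (suc r) S
  chains r (true ∷ S) =
    concatMap (λ x → map (x ∷_) (filterᵇ (below x) (chains (suc r) S)))
      (filterᵇ (λ x → rank x ≡ᵇ r) (allFin m))

  ∑-chains-true : ∀ {k} r (S : Vec Bool k) (f : List (Fin m) → ℤ) →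
    ∑ (chains r (true ∷ S)) f ≡
    ∑ (allFin m) (λ x → when (rank x ≡ᵇ r)
      (∑ (chains (suc r) S) (λ C → when (below x C) (f (x ∷ C)))))
  ∑-chains-true r S f = trans (∑-concatMap _ (filterᵇ (λ x → rank x ≡ᵇ r) (allFin m)) f)
    (trans (∑-filter (λ x → rank x ≡ᵇ r) (allFin m) _)
      (∑-cong (allFin m) (λ x → cong (when (rank x ≡ᵇ r))
        (trans (∑-map (x ∷_) (filterᵇ (below x) (chains (suc r) S)) f)
          (∑-filter (below x) (chains (suc r) S) _)))))

  -- One scan along `S` tests the chain condition and the rank set together. It follows the
  -- recursion of `chains`, which makes the sum over all lists collapse to a sum over the chains
  -- with rank set `S`.
  chainOn : ∀ {k} → ℕ → Vec Bool k → List (Fin m) → Bool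
  chainOn r [] [] = true
  chainOn r [] (_ ∷ _) = false
  chainOn r (false ∷ S) C = chainOn (suc r) S C
  chainOn r (true ∷ S) [] = false
  chainOn r (true ∷ S) (x ∷ C) = (rank x ≡ᵇ r) ∧ below x C ∧ chainOn (suc r) S C

  -- Each true entry of `S` uses up one list element, so under `k ≤ K` the length bound never runs
  -- out before `S` does.
  ∑-chainOn : ∀ {k K} r (S : Vec Bool k) → k ≤ K → (f : List (Fin m) → ℤ) →
    ∑ (listsUpTo m K) (λ C → when (chainOn r S C) (f C)) ≡ ∑ (chains r S) f
  ∑-chainOn {K = zero} r [] _ f = refl
  ∑-chainOn {K = suc K} r [] _ f = trans (∑-listsUpTo-suc m K (λ C → when (chainOn r [] C) (f C)))
    (cong (f [] +ℤ_) (∑-≡0 (allFin m) (λ x → ∑-zero (listsUpTo m K))))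
  ∑-chainOn r (false ∷ S) p f = ∑-chainOn (suc r) S (ℕₚ.<⇒≤ p) f
  ∑-chainOn {K = suc K} r (true ∷ S) (s≤s p) f = begin
    ∑ (listsUpTo m (suc K)) (λ C → when (chainOn r (true ∷ S) C) (f C))
      ≡⟨ trans (∑-listsUpTo-suc m K (λ C → when (chainOn r (true ∷ S) C) (f C))) (ℤₚ.+-identityˡ _) ⟩
    ∑ (allFin m) (λ x → ∑ (listsUpTo m K)
      (λ C → when ((rank x ≡ᵇ r) ∧ below x C ∧ chainOn (suc r) S C) (f (x ∷ C))))
      ≡⟨ ∑-cong (allFin m) (λ x → trans
           (∑-cong (listsUpTo m K) (λ C → trans (when-∧ (rank x ≡ᵇ r) _ _)
             (cong (when (rank x ≡ᵇ r)) (trans (when-∧ (below x C) _ _)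
               (when-comm (below x C) (chainOn (suc r) S C) _)))))
           (trans (∑-when (listsUpTo m K) (rank x ≡ᵇ r) _)
             (cong (when (rank x ≡ᵇ r)) (∑-chainOn (suc r) S p _)))) ⟩
    ∑ (allFin m) (λ x → when (rank x ≡ᵇ r)
      (∑ (chains (suc r) S) (λ C → when (below x C) (f (x ∷ C)))))
      ≡⟨ ∑-chains-true r S f ⟨
    ∑ (chains r (true ∷ S)) f ∎

  occurs : ℕ → List (Fin m) → Bool
  occurs r C = anyᵇ (λ c → rank c ≡ᵇ r) C

  rankVec : ∀ k → ℕ → List (Fin m) → Vec Bool k
  rankVec zero r C = []
  rankVec (suc k) r C = occurs r C ∷ rankVec k (suc r) C

  tabulate-occurs : ∀ k r C → tabulate {n = k} (λ i → occurs (r + toℕ i) C) ≡ rankVec k r C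
  tabulate-occurs zero r C = refl
  tabulate-occurs (suc k) r C = cong₂ _∷_ (cong (λ j → occurs j C) (ℕₚ.+-identityʳ r))
    (trans (tabulate-cong (λ i → cong (λ j → occurs j C) (ℕₚ.+-suc r (toℕ i))))
      (tabulate-occurs k (suc r) C))

  rankSet-rankVec : ∀ C → rankSet P C ≡ rankVec n 0 C
  rankSet-rankVec = tabulate-occurs n 0

  ¬occurs : ∀ r C → All (λ c → r < rank c) C → occurs r C ≡ false
  ¬occurs r [] [] = refl
  ¬occurs r (c ∷ C) (p ∷ ps) =
    cong₂ _∨_ (T-false (λ q → ℕₚ.<-irrefl (sym (ℕₚ.≡ᵇ⇒≡ (rank c) r q)) p)) (¬occurs r C ps)

  ¬occurs⇒< : ∀ r C → occurs r C ≡ false → All (λ c → r ≤ rank c) C → All (λ c → r < rank c) C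
  ¬occurs⇒< r [] _ [] = []
  ¬occurs⇒< r (c ∷ C) eq (p ∷ ps) with rank c ≡ᵇ r in q
  ... | false = ℕₚ.≤∧≢⇒< p (λ { refl → subst T q (≡ᵇ-refl (rank c)) }) ∷ ¬occurs⇒< r C eq ps

  rankVec-∷ : ∀ k r x C → rank x < r → rankVec k r (x ∷ C) ≡ rankVec k r C
  rankVec-∷ zero r x C p = refl
  rankVec-∷ (suc k) r x C p = cong₂ _∷_
    (cong (_∨ occurs r C) (T-false (λ q → ℕₚ.<-irrefl (ℕₚ.≡ᵇ⇒≡ (rank x) r q) p)))
    (rankVec-∷ k (suc r) x C (ℕₚ.m<n⇒m<1+n p))

  strictlyInc-∷ : ∀ x C → strictlyInc P (x ∷ C) ≡ below x C ∧ strictlyInc P C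
  strictlyInc-∷ x [] = refl
  strictlyInc-∷ x (y ∷ C) = refl

  strictlyInc⇒rank< : ∀ x C → T (strictlyInc P (x ∷ C)) → All (λ c → rank x < rank c) C
  strictlyInc⇒rank< x [] _ = []
  strictlyInc⇒rank< x (y ∷ C) p =
    ≺⇒rank< (T-∧₁ p) ∷ All.map (ℕₚ.<-trans (≺⇒rank< (T-∧₁ p))) (strictlyInc⇒rank< y C (T-∧₂ {x ≺ y} p))

  chainOn⇒rank≥ : ∀ {k} r (S : Vec Bool k) C → T (chainOn r S C) → All (λ c → r ≤ rank c) C
  chainOn⇒rank≥ r [] [] _ = []
  chainOn⇒rank≥ r (false ∷ S) C p = All.map ℕₚ.<⇒≤ (chainOn⇒rank≥ (suc r) S C p)
  chainOn⇒rank≥ r (true ∷ S) (x ∷ C) p =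
    ℕₚ.≤-reflexive (sym (ℕₚ.≡ᵇ⇒≡ (rank x) r (T-∧₁ p))) ∷
    All.map ℕₚ.<⇒≤ (chainOn⇒rank≥ (suc r) S C (T-∧₂ {below x C} (T-∧₂ {rank x ≡ᵇ r} p)))

  chainOn⇒isChain : ∀ {k} r (S : Vec Bool k) C → r + k ≡ n → T (chainOn r S C) →
    T (strictlyInc P C) × All (λ c → T (not (c ==F top))) C
  chainOn⇒isChain r [] [] _ _ = tt , []
  chainOn⇒isChain {suc k} r (false ∷ S) C e p =
    chainOn⇒isChain (suc r) S C (trans (sym (ℕₚ.+-suc r k)) e) p
  chainOn⇒isChain {suc k} r (true ∷ S) (x ∷ C) e p
    with chainOn⇒isChain (suc r) S C (trans (sym (ℕₚ.+-suc r k)) e) (T-∧₂ {below x C} (T-∧₂ {rank x ≡ᵇ r} p))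
  ... | inc , nt = subst T (sym (strictlyInc-∷ x C)) (T-∧ (T-∧₁ (T-∧₂ {rank x ≡ᵇ r} p)) inc) ,
                   T-not (λ q → m≢m+1+n r k
                     (trans (sym (ℕₚ.≡ᵇ⇒≡ (rank x) r (T-∧₁ p)))
                       (trans (cong rank (==F⇒≡ q)) (trans rank-top (sym e))))) ∷ nt

  chainOn⇒rankVec : ∀ {k} r (S : Vec Bool k) C → T (chainOn r S C) → rankVec k r C ≡ S
  chainOn⇒rankVec r [] C _ = refl
  chainOn⇒rankVec r (false ∷ S) C p =
    cong₂ _∷_ (¬occurs r C (chainOn⇒rank≥ (suc r) S C p)) (chainOn⇒rankVec (suc r) S C p)
  chainOn⇒rankVec {suc k} r (true ∷ S) (x ∷ C) p = cong₂ _∷_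
    (cong (_∨ occurs r C) (T-true (T-∧₁ {rank x ≡ᵇ r} p)))
    (trans (rankVec-∷ k (suc r) x C (s≤s (ℕₚ.≤-reflexive (ℕₚ.≡ᵇ⇒≡ (rank x) r (T-∧₁ p)))))
      (chainOn⇒rankVec (suc r) S C (T-∧₂ {below x C} (T-∧₂ {rank x ≡ᵇ r} p))))

  rankVec⇒chainOn : ∀ {k} r (S : Vec Bool k) C → r + k ≡ n → T (strictlyInc P C) →
    All (λ c → T (not (c ==F top))) C → All (λ c → r ≤ rank c) C → rankVec k r C ≡ S → T (chainOn r S C)
  rankVec⇒chainOn r [] [] e inc nt ge eq = tt
  -- An entry left over once all ranks below n are scanned has rank at least n. It is then `top`,
  -- which the hypothesis on `C` excludes.
  rankVec⇒chainOn r [] (x ∷ C) e inc (nt ∷ _) (ge ∷ _) eq = not-T nt (≡⇒==F (≼∧rank≡⇒≡ (top-max x)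
    (ℕₚ.≤-antisym (≼⇒rank≤ (top-max x))
      (subst (_≤ rank x) (trans (sym (ℕₚ.+-identityʳ r)) (trans e (sym rank-top))) ge))))
  rankVec⇒chainOn {suc k} r (false ∷ S) C e inc nt ge eq =
    rankVec⇒chainOn (suc r) S C (trans (sym (ℕₚ.+-suc r k)) e) inc nt
      (¬occurs⇒< r C (cong Vec.head eq) ge) (cong Vec.tail eq)

  rankVec⇒chainOn {suc k} r (true ∷ S) [] e inc nt ge ()
  rankVec⇒chainOn {suc k} r (true ∷ S) (x ∷ C) e inc (_ ∷ nt) (ge ∷ _) eq =
    T-∧ (ℕₚ.≡⇒≡ᵇ (rank x) r rx) (T-∧ (T-∧₁ inc′)
      (rankVec⇒chainOn (suc r) S C (trans (sym (ℕₚ.+-suc r k)) e) (T-∧₂ {below x C} inc′) nt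
        (subst (λ i → All (λ c → i < rank c) C) rx gt)
        (trans (sym (rankVec-∷ k (suc r) x C (s≤s (ℕₚ.≤-reflexive rx)))) (cong Vec.tail eq))))
    where

    inc′ = subst T (strictlyInc-∷ x C) inc
    gt = strictlyInc⇒rank< x C inc
    absurd : ∀ {b} → b ≡ true → b ≡ false → ⊥
    absurd refl ()
    -- The rank `r` occurs in the list. If the first entry were above `r`, so would be all later
    -- ones.
    rx : rank x ≡ r
    rx with ℕₚ.m≤n⇒m<n∨m≡n ge
    ... | inj₂ r≡ = sym r≡
    ... | inj₁ r< = ⊥-elim (absurd (cong Vec.head eq)
                      (¬occurs r (x ∷ C) (r< ∷ All.map (ℕₚ.<-trans r<) gt)))

  isChain-chainOn : ∀ (S : Vec Bool n) C → isChain P C ∧ eqVecB (rankSet P C) S ≡ chainOn 0 S C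
  isChain-chainOn S C = T-ext
    (λ q → rankVec⇒chainOn 0 S C refl (T-∧₁ (T-∧₁ q))
      (allᵇ⇒All C (T-∧₂ {strictlyInc P C} (T-∧₁ {isChain P C} q))) (All.universal (λ _ → z≤n) C)
      (trans (sym (rankSet-rankVec C)) (eqVecB⇒≡ (T-∧₂ {isChain P C} q))))
    (λ q → let inc , nt = chainOn⇒isChain 0 S C refl q in
      T-∧ {isChain P C} (T-∧ inc (All⇒allᵇ nt))
        (subst (λ R → T (eqVecB R S)) (sym (trans (rankSet-rankVec C) (chainOn⇒rankVec 0 S C q)))
          (eqVecB-refl S)))

  -- The scan of `S` stands at rank `p`, the last chosen chain element is `x`, and `U` holds the `j`
  -- ranks skipped since. Once the next element `c` is chosen, [x, c] is complete: its Poincaré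
  -- polynomial becomes the good words on it, and the position of `c` starts afresh. `p`, `q` and
  -- `U` are variables tied by equations so that each recursive call can supply them in its own
  -- form.
  ∑-chains-from : ∀ {k} (S : Vec Bool k) j x p q U F → p ≡ rank x + suc j → q ≡ suc j + k →
    rank x + q ≡ n → U ≡ List.replicate j false →
    ∑ (chains p S) (λ C → when (below x C) (eval (poinChain P (x ∷ C)) F)) ≡
    ∑ (walks q x top) (λ w → when (ok false 0 (true ∷ U ++ toList S) w) (F (exc w)))
  ∑-chains-from [] j x p q U F refl refl e refl = begin
    eval (mulP (poinInt P x top) (1 ∷ [])) F +ℤ + 0
      ≡⟨ trans (ℤₚ.+-identityʳ _) (eval-mulP (poinInt P x top) (1 ∷ []) F) ⟩
    eval (poinInt P x top) (λ i → + 1 *ℤ F (i + 0) +ℤ + 0)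
      ≡⟨ eval-cong (poinInt P x top) (λ i → trans (ℤₚ.+-identityʳ _)
           (trans (ℤₚ.*-identityˡ _) (cong F (ℕₚ.+-identityʳ i)))) ⟩
    eval (poinInt P x top) F
      ≡⟨ eval-poinInt (suc j + 0) x top F (top-max x) (trans rank-top (sym e)) ⟩
    ∑ (walks (suc j + 0) x top) (λ w → when (allGoodFree w) (F (exc w)))
      ≡⟨ ∑-walks-cong (suc j + 0) x top (λ w len → cong (λ b → when b (F (exc w)))
           (trans (cong (λ V → ok false 0 (true ∷ V) w) (++-identityʳ (List.replicate j false)))
             (ok-free j w (trans len (ℕₚ.+-identityʳ (suc j)))))) ⟨
    _ ∎
  ∑-chains-from {suc k} (false ∷ S) j x p q U F refl refl e refl = trans
    (∑-chains-from S (suc j) x (suc p) q (U ++ false ∷ []) F (sym (ℕₚ.+-suc (rank x) (suc j)))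
      (ℕₚ.+-suc (suc j) k) e (replicate-∷ʳ j))
    (∑-walks-cong q x top (λ w _ → cong (λ V → when (ok false 0 (true ∷ V) w) (F (exc w)))
      (++-assoc U (false ∷ []) (toList S))))
  ∑-chains-from {suc k} (true ∷ S) j x p q U F refl refl e refl = begin
    ∑ (chains p (true ∷ S)) (λ C → when (below x C) (eval (poinChain P (x ∷ C)) F))
      ≡⟨ ∑-chains-true p S _ ⟩
    ∑ (allFin m) (λ c → when (rank c ≡ᵇ p) (∑ (chains (suc p) S)
      (λ C → when (below c C) (when (x ≺ c) (eval (poinChain P (x ∷ c ∷ C)) F)))))
      ≡⟨ ∑-cong (allFin m) at ⟩
    ∑ (allFin m) (λ c → ∑ (walks (suc j) x c) (λ u → ∑ (walks (q ∸ suc j) c top) (λ w →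
      when (ok false 0 (true ∷ U ++ true ∷ toList S) (u ++ w)) (F (exc (u ++ w))))))
      ≡⟨ ∑-walks-split (ℕₚ.m≤m+n (suc j) (suc k)) x top _ ⟨
    _ ∎
    where
    H : ℕ → Word → ℤ
    H i w = when (ok false 0 (true ∷ toList S) w) (F (i + exc w))
    at : ∀ c →
      when (rank c ≡ᵇ p) (∑ (chains (suc p) S)
        (λ C → when (below c C) (when (x ≺ c) (eval (poinChain P (x ∷ c ∷ C)) F)))) ≡
      ∑ (walks (suc j) x c) (λ u → ∑ (walks (q ∸ suc j) c top) (λ w →
        when (ok false 0 (true ∷ U ++ true ∷ toList S) (u ++ w)) (F (exc (u ++ w)))))
    at c with rank c ≡ᵇ p in rc
    ... | false = sym (∑-walks-empty (suc j) x c _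
                    (λ _ r → subst T rc (ℕₚ.≡⇒≡ᵇ (rank c) p r)))
    ... | true with x ≺ c in x≺c
    ... | false = trans (∑-≡0 (chains (suc p) S) (λ C → when-zero (below c C)))
                    (sym (∑-walks-empty (suc j) x c _ (λ x≼c r →
                      subst T x≺c (≼∧≢⇒≺ x≼c (λ { refl → m≢m+1+n (rank x) j r })))))
    ... | true = begin
      ∑ (chains (suc p) S) (λ C → when (below c C) (eval (poinChain P (x ∷ c ∷ C)) F))
        ≡⟨ ∑-cong (chains (suc p) S) (λ C → trans
             (cong (when (below c C)) (eval-mulP (poinInt P x c) (poinChain P (c ∷ C)) F))
             (sym (eval-when (poinInt P x c) (below c C) _))) ⟩
      ∑ (chains (suc p) S) (λ C → eval (poinInt P x c) (λ i →
        when (below c C) (eval (poinChain P (c ∷ C)) (λ h → F (i + h)))))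
        ≡⟨ eval-∑ (poinInt P x c) (chains (suc p) S) _ ⟩
      eval (poinInt P x c) (λ i → ∑ (chains (suc p) S) (λ C →
        when (below c C) (eval (poinChain P (c ∷ C)) (λ h → F (i + h)))))
        -- The `i` true bits below `c` are carried along by shifting the test function, which is why
        -- the induction is over all `F`.
        ≡⟨ eval-cong (poinInt P x c) (λ i → ∑-chains-from S 0 c (suc p) (suc k) [] (λ h → F (i + h))
             (trans (cong suc (sym rank-c)) (ℕₚ.+-comm 1 (rank c))) refl rank-c+k refl) ⟩
      eval (poinInt P x c) (λ i → ∑ (walks (suc k) c top) (H i))
        ≡⟨ eval-poinInt (suc j) x c _ (≺⇒≼ (true-T x≺c)) rank-c ⟩
      ∑ (walks (suc j) x c) (λ u → when (allGoodFree u) (∑ (walks (suc k) c top) (H (exc u))))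
        ≡⟨ ∑-walks-cong (suc j) x c (λ u len → trans (sym (∑-when (walks (suc k) c top) (allGoodFree u) _))
             (∑-cong (walks (suc k) c top) (λ w → join u w len))) ⟩
      ∑ (walks (suc j) x c) (λ u → ∑ (walks (suc k) c top) (λ w →
        when (ok false 0 (true ∷ U ++ true ∷ toList S) (u ++ w)) (F (exc (u ++ w)))))
        ≡⟨ cong (λ i → ∑ (walks (suc j) x c) (λ u → ∑ (walks i c top) (λ w →
             when (ok false 0 (true ∷ U ++ true ∷ toList S) (u ++ w)) (F (exc (u ++ w))))))
             (ℕₚ.m+n∸m≡n (suc j) (suc k)) ⟨
      _ ∎
      where
      rank-c : rank c ≡ p
      rank-c = ℕₚ.≡ᵇ⇒≡ (rank c) p (true-T rc)
      rank-c+k : rank c + suc k ≡ n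
      rank-c+k = trans (cong (_+ suc k) rank-c) (trans (ℕₚ.+-assoc (rank x) (suc j) (suc k)) e)
      join : ∀ u w → length u ≡ suc j → when (allGoodFree u) (H (exc u) w) ≡
        when (ok false 0 (true ∷ U ++ true ∷ toList S) (u ++ w)) (F (exc (u ++ w)))
      join u w len = trans (sym (when-∧ (allGoodFree u) _ _)) (cong₂ (λ b i → when b (F i))
        (trans (cong (_∧ ok false 0 (true ∷ toList S) w) (sym (ok-free j u len)))
          (sym (ok-++ false 0 (true ∷ U) (toList S) u w (trans len (cong suc (sym (length-replicate j)))))))
        (sym (exc-++ u w)))

  -- Below the first chain element there is no Poincaré factor. On the side of words no interval can
  -- be open there, so the bits are false and the labels increase, and `∑-walks-inc` gives the
  -- matching factor 1. The same applies to the empty chain.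
  ∑-chains : ∀ {k} (S : Vec Bool k) p U F → p + k ≡ n → U ≡ List.replicate p false →
    ∑ (chains p S) (λ C → eval (poinChain P C) F) ≡
    ∑ (walks n bot top) (λ w → when (ok false 0 (U ++ toList S) w) (F (exc w)))
  ∑-chains [] p U F refl refl = begin
    (+ 1 *ℤ F 0 +ℤ + 0) +ℤ + 0
      ≡⟨ trans (ℤₚ.+-identityʳ _) (trans (ℤₚ.+-identityʳ _) (ℤₚ.*-identityˡ (F 0))) ⟩
    F 0
      ≡⟨ ∑-walks-inc (p + 0) bot top (F 0) (bot-min top)
           (trans rank-top (cong (_+ (p + 0)) (sym rank-bot))) ⟨
    ∑ (walks (p + 0) bot top) (λ w → when (isInc w) (F 0))
      ≡⟨ ∑-walks-cong (p + 0) bot top (λ w len → trans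
           (cong (λ b → when b (F (exc w))) (trans
             (cong (λ V → ok false 0 V w) (++-identityʳ U)) (ok-replicate p false 0 w (trans len (ℕₚ.+-identityʳ p)))))
           (when-cong (isInc w) (λ q → cong F (exc-allGood 0 w q)))) ⟨
    _ ∎
  ∑-chains {suc k} (false ∷ S) p U F e refl = trans
    (∑-chains S (suc p) (U ++ false ∷ []) F (trans (sym (ℕₚ.+-suc p k)) e) (replicate-∷ʳ p))
    (∑-walks-cong n bot top (λ w _ → cong (λ V → when (ok false 0 V w) (F (exc w)))
      (++-assoc U (false ∷ []) (toList S))))
  ∑-chains {suc k} (true ∷ S) p U F e refl = begin
    ∑ (chains p (true ∷ S)) (λ C → eval (poinChain P C) F)
      ≡⟨ ∑-chains-true p S _ ⟩
    ∑ (allFin m) (λ c → when (rank c ≡ᵇ p)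
      (∑ (chains (suc p) S) (λ C → when (below c C) (eval (poinChain P (c ∷ C)) F))))
      ≡⟨ ∑-cong (allFin m) at ⟩
    ∑ (allFin m) (λ c → ∑ (walks p bot c) (λ u → ∑ (walks (n ∸ p) c top) (λ w →
      when (ok false 0 (U ++ true ∷ toList S) (u ++ w)) (F (exc (u ++ w))))))
      ≡⟨ ∑-walks-split (subst (p ≤_) e (ℕₚ.m≤m+n p (suc k))) bot top _ ⟨
    _ ∎
    where
    at : ∀ c →
      when (rank c ≡ᵇ p)
        (∑ (chains (suc p) S) (λ C → when (below c C) (eval (poinChain P (c ∷ C)) F))) ≡
      ∑ (walks p bot c) (λ u → ∑ (walks (n ∸ p) c top) (λ w →
        when (ok false 0 (U ++ true ∷ toList S) (u ++ w)) (F (exc (u ++ w)))))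
    at c with rank c ≡ᵇ p in rc
    ... | false = sym (∑-walks-empty p bot c _ (λ _ r → subst T rc
                    (ℕₚ.≡⇒≡ᵇ (rank c) p (trans r (cong (_+ p) rank-bot)))))
    ... | true = begin
      ∑ (chains (suc p) S) (λ C → when (below c C) (eval (poinChain P (c ∷ C)) F))
        ≡⟨ ∑-chains-from S 0 c (suc p) (suc k) [] F
             (trans (cong suc (sym rank-c)) (ℕₚ.+-comm 1 (rank c))) refl
             (trans (cong (_+ suc k) rank-c) e) refl ⟩
      Y
        ≡⟨ ∑-walks-inc p bot c Y (bot-min c) (trans rank-c (cong (_+ p) (sym rank-bot))) ⟨
      ∑ (walks p bot c) (λ u → when (isInc u) Y)
        ≡⟨ ∑-walks-cong p bot c (λ u len → trans (sym (∑-when (walks (suc k) c top) (isInc u) _))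
             (∑-cong (walks (suc k) c top) (λ w → join u w len))) ⟩
      ∑ (walks p bot c) (λ u → ∑ (walks (suc k) c top) (λ w →
        when (ok false 0 (U ++ true ∷ toList S) (u ++ w)) (F (exc (u ++ w)))))
        ≡⟨ cong (λ i → ∑ (walks p bot c) (λ u → ∑ (walks i c top) (λ w →
             when (ok false 0 (U ++ true ∷ toList S) (u ++ w)) (F (exc (u ++ w))))))
             (trans (cong (_∸ p) (sym e)) (ℕₚ.m+n∸m≡n p (suc k))) ⟨
      _ ∎
      where
      Y = ∑ (walks (suc k) c top) (λ w → when (ok false 0 (true ∷ toList S) w) (F (exc w)))
      rank-c : rank c ≡ p
      rank-c = ℕₚ.≡ᵇ⇒≡ (rank c) p (true-T rc)
      join : ∀ u w → length u ≡ p →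
        when (isInc u) (when (ok false 0 (true ∷ toList S) w) (F (exc w))) ≡
        when (ok false 0 (U ++ true ∷ toList S) (u ++ w)) (F (exc (u ++ w)))
      join u w len = begin
        when (isInc u) (when (ok false 0 (true ∷ toList S) w) (F (exc w)))
          ≡⟨ when-cong (isInc u) (λ q → cong (λ i → when (ok false 0 (true ∷ toList S) w) (F i))
               (trans (cong (_+ exc w) (sym (exc-allGood 0 u q))) (sym (exc-++ u w)))) ⟩
        when (isInc u) (when (ok false 0 (true ∷ toList S) w) (F (exc (u ++ w))))
          ≡⟨ when-∧ (isInc u) _ _ ⟨
        when (isInc u ∧ ok false 0 (true ∷ toList S) w) (F (exc (u ++ w)))
          ≡⟨ cong (λ b → when b (F (exc (u ++ w)))) (trans
               (cong (_∧ ok false 0 (true ∷ toList S) w) (sym (ok-replicate p false 0 u len)))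
               (sym (ok-++ false 0 U (toList S) u w (trans len (sym (length-replicate p)))))) ⟩
        _ ∎

  -- Each chain is charged to its rank set `S`, on which alone its weight depends. After the sums
  -- are exchanged, a fixed word sees only the alternating sum over `S`, which `∑-ok-wtCoeff`
  -- evaluates.
  exPsiCoeff-walks : ∀ ℓ (U : Vec Bool n) →
    exPsiCoeff P ℓ U ≡
    ∑ (walks n bot top) (λ w → when (badIs false 0 U w) (when (exc w ≡ᵇ ℓ) (+ 1)))
  exPsiCoeff-walks ℓ U = begin
    exPsiCoeff P ℓ U
      ≡⟨ sumℤ-map (λ C → when (isChain P C) (+ coeffP ℓ (poinChain P C) *ℤ wtCoeff (rankSet P C) U)) (listsUpTo m m) ⟩
    ∑ (listsUpTo m m) (λ C → when (isChain P C) (+ coeffP ℓ (poinChain P C) *ℤ wtCoeff (rankSet P C) U))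
      ≡⟨ ∑-cong (listsUpTo m m) bySubset ⟩
    ∑ (listsUpTo m m) (λ C → ∑ (allSubsets n) (λ S → when (chainOn 0 S C) (wtCoeff S U *ℤ eval (poinChain P C) δ)))
      ≡⟨ ∑-swap (listsUpTo m m) (allSubsets n) _ ⟩
    ∑ (allSubsets n) (λ S → ∑ (listsUpTo m m) (λ C → when (chainOn 0 S C) (wtCoeff S U *ℤ eval (poinChain P C) δ)))
      ≡⟨ ∑-cong (allSubsets n) (λ S → trans (∑-chainOn 0 S (ℕₚ.<⇒≤ n<m) _)
           (trans (∑-*ˡ (chains 0 S) (wtCoeff S U) _)
             (cong (wtCoeff S U *ℤ_) (∑-chains S 0 [] δ refl refl)))) ⟩
    ∑ (allSubsets n) (λ S → wtCoeff S U *ℤ ∑ (walks n bot top) (λ w → when (ok false 0 (toList S) w) (δ (exc w))))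
      ≡⟨ ∑-cong (allSubsets n) (λ S → trans (sym (∑-*ˡ (walks n bot top) (wtCoeff S U) _))
           (∑-cong (walks n bot top) (λ w → trans (when-*ˡ (ok false 0 (toList S) w) (wtCoeff S U) _)
             (sym (when-*ʳ (ok false 0 (toList S) w) (wtCoeff S U) _))))) ⟩
    ∑ (allSubsets n) (λ S → ∑ (walks n bot top) (λ w →
      when (ok false 0 (toList S) w) (wtCoeff S U) *ℤ δ (exc w)))
      ≡⟨ ∑-swap (allSubsets n) (walks n bot top) _ ⟩
    ∑ (walks n bot top) (λ w → ∑ (allSubsets n) (λ S →
      when (ok false 0 (toList S) w) (wtCoeff S U) *ℤ δ (exc w)))
      ≡⟨ ∑-walks-cong n bot top (λ w len → trans (∑-*ʳ (allSubsets n) (δ (exc w)) _)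
           (trans (cong (_*ℤ δ (exc w)) (∑-ok-wtCoeff false 0 U w len))
             (trans (when-*ʳ (badIs false 0 U w) (+ 1) _)
               (cong (when (badIs false 0 U w)) (ℤₚ.*-identityˡ (δ (exc w))))))) ⟩
    ∑ (walks n bot top) (λ w → when (badIs false 0 U w) (δ (exc w))) ∎
    where
    δ : ℕ → ℤ
    δ i = when (i ≡ᵇ ℓ) (+ 1)
    bySubset : ∀ C →
      when (isChain P C) (+ coeffP ℓ (poinChain P C) *ℤ wtCoeff (rankSet P C) U) ≡
      ∑ (allSubsets n) (λ S → when (chainOn 0 S C) (wtCoeff S U *ℤ eval (poinChain P C) δ))
    bySubset C = begin
      when (isChain P C) (+ coeffP ℓ (poinChain P C) *ℤ wtCoeff (rankSet P C) U)
        ≡⟨ ∑-allSubsets-δ (rankSet P C) (λ S → when (isChain P C) (+ coeffP ℓ (poinChain P C) *ℤ wtCoeff S U)) ⟨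
      ∑ (allSubsets n) (λ S → when (eqVecB (rankSet P C) S)
        (when (isChain P C) (+ coeffP ℓ (poinChain P C) *ℤ wtCoeff S U)))
        ≡⟨ ∑-cong (allSubsets n) (λ S → trans (when-comm (eqVecB (rankSet P C) S) (isChain P C) _)
             (trans (sym (when-∧ (isChain P C) _ _))
               (cong₂ when (isChain-chainOn S C) (trans (ℤₚ.*-comm (+ coeffP ℓ (poinChain P C)) _)
                 (cong (wtCoeff S U *ℤ_) (sym (eval-coeffP ℓ (poinChain P C)))))))) ⟩
      _ ∎

-- The triples (C, D, M)

-- x occurs s + b - e times in D, where s tells whether x ∈ C and b, e are the bits of
-- the edges before and after x: C is ahead of D by one element while some interval
-- [C_i, D_i] is open.  The case s + b < e is excluded by feok.
copies : ∀ {A : Set} → Bool → Bool → Bool → A → List A → List A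
copies true true true x ds = x ∷ ds
copies true true false x ds = x ∷ x ∷ ds
copies true false true x ds = ds
copies true false false x ds = x ∷ ds
copies false true true x ds = ds
copies false true false x ds = x ∷ ds
copies false false e x ds = ds

-- This is the label-free part of `ok`: an interval may open only at a position in `S`.
feok : ∀ {k} → Bool → Vec Bool k → Vec Bool k → Set
feok b [] [] = ⊤
feok b (s ∷ S) (e ∷ E) = T (s ∨ b ∨ not e) × feok e S E

_⊑_ : ∀ {k} → Vec Bool k → Vec Bool k → Set
S ⊑ U = ∀ i → T (not (lookup S i) ∨ lookup U i)

⊑-antisym : ∀ {k} (S U : Vec Bool k) → S ⊑ U → U ⊑ S → S ≡ U
⊑-antisym [] [] p q = refl
⊑-antisym (s ∷ S) (u ∷ U) p q =
  cong₂ _∷_ (bit s u (p zero) (q zero)) (⊑-antisym S U (p ∘ suc) (q ∘ suc))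
  where
  bit : ∀ s u → T (not s ∨ u) → T (not u ∨ s) → s ≡ u
  bit true true _ _ = refl
  bit false false _ _ = refl

feok-mono : ∀ {k} b (S U E : Vec Bool k) → S ⊑ U → feok b S E → feok b U E
feok-mono b [] [] [] p q = tt
feok-mono b (s ∷ S) (u ∷ U) (e ∷ E) p (q , qs) =
  bit s u (b ∨ not e) (p zero) q , feok-mono e S U E (p ∘ suc) qs
  where
  bit : ∀ s u a → T (not s ∨ u) → T (s ∨ a) → T (u ∨ a)
  bit s true a _ _ = tt
  bit false false a _ q = q

diff : ∀ {k} → Vec Bool k → Vec Bool k → Vec Bool k
diff [] [] = []
diff (s ∷ S) (u ∷ U) = (u ∧ not s) ∷ diff S U

lookup-diff : ∀ {k} (S U : Vec Bool k) i → lookup U i ∧ not (lookup S i) ≡ lookup (diff S U) i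
lookup-diff (s ∷ S) (u ∷ U) zero = refl
lookup-diff (s ∷ S) (u ∷ U) (suc i) = lookup-diff S U i

filterᵇ-map : ∀ {A B : Set} p (f : A → B) xs → filterᵇ p (map f xs) ≡ map f (filterᵇ (p ∘ f) xs)
filterᵇ-map p f [] = refl
filterᵇ-map p f (x ∷ xs) with p (f x)
... | true = cong (f x ∷_) (filterᵇ-map p f xs)
... | false = filterᵇ-map p f xs

filterᵇ-allFin-suc : ∀ {A : Set} {k} p (f : Fin (suc k) → A) →
  map f (filterᵇ p (allFin (suc k))) ≡
  (if p zero then f zero ∷ [] else []) ++ map (f ∘ suc) (filterᵇ (p ∘ suc) (allFin k))
filterᵇ-allFin-suc {k = k} p f = trans (head-first (p zero)) (cong ((if p zero then f zero ∷ [] else []) ++_) tail)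
  where
  head-first : ∀ b → map f (if b then zero ∷ filterᵇ p (List.tabulate suc) else filterᵇ p (List.tabulate suc)) ≡
    (if b then f zero ∷ [] else []) ++ map f (filterᵇ p (List.tabulate suc))
  head-first true = refl
  head-first false = refl
  tail : map f (filterᵇ p (List.tabulate suc)) ≡ map (f ∘ suc) (filterᵇ (p ∘ suc) (allFin k))
  tail = begin
    map f (filterᵇ p (List.tabulate suc))          ≡⟨ cong (map f ∘ filterᵇ p) (map-tabulate id suc) ⟨
    map f (filterᵇ p (map suc (allFin k)))         ≡⟨ cong (map f) (filterᵇ-map p suc (allFin k)) ⟩
    map f (map suc (filterᵇ (p ∘ suc) (allFin k))) ≡⟨ map-∘ (filterᵇ (p ∘ suc) (allFin k)) ⟨
    map (f ∘ suc) (filterᵇ (p ∘ suc) (allFin k))   ∎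

anyᵇ⇒ : ∀ {A : Set} {p : A → Bool} xs → T (anyᵇ p xs) → ∃ λ x → x ∈ xs × T (p x)
anyᵇ⇒ {p = p} (x ∷ xs) q with p x in eq
... | true = x , here refl , true-T eq
... | false with anyᵇ⇒ xs q
... | y , y∈ , r = y , there y∈ , r

⇒anyᵇ : ∀ {A : Set} {p : A → Bool} {x xs} → x ∈ xs → T (p x) → T (anyᵇ p xs)
⇒anyᵇ {p = p} {x} (here refl) q rewrite T-true q = tt
⇒anyᵇ {p = p} {xs = y ∷ _} (there x∈) q with p y
... | true = tt
... | false = ⇒anyᵇ x∈ q

concatMap-∈ : ∀ {A B : Set} (f : A → List B) {x xs y} → x ∈ xs → y ∈ f x → y ∈ concatMap f xs
concatMap-∈ f x∈ y∈ = ∈-concatMap⁺ f (Any.map (λ { refl → y∈ }) x∈)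

∈-listsOfLen : ∀ {m} (C : List (Fin m)) → C ∈ listsOfLen m (length C)
∈-listsOfLen [] = here refl
∈-listsOfLen (x ∷ C) = concatMap-∈ _ (∈-allFin x) (∈-map⁺ (x ∷_) (∈-listsOfLen C))

∈-allVecs : ∀ {m k} (v : Vec (Fin m) k) → v ∈ allVecs m k
∈-allVecs [] = here refl
∈-allVecs (x ∷ v) = concatMap-∈ _ (∈-allFin x) (∈-map⁺ (x ∷_) (∈-allVecs v))

∈-allSubsets : ∀ {k} (S : Vec Bool k) → S ∈ allSubsets k
∈-allSubsets [] = here refl
∈-allSubsets (true ∷ S) = concatMap-∈
  (λ b → map (b ∷_) (allSubsets _)) {xs = true ∷ false ∷ []} (here refl) (∈-map⁺ (true ∷_) (∈-allSubsets S))
∈-allSubsets (false ∷ S) = concatMap-∈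
  (λ b → map (b ∷_) (allSubsets _)) {xs = true ∷ false ∷ []} (there (here refl)) (∈-map⁺ (false ∷_) (∈-allSubsets S))

∑-upTo : ∀ k (f : ℕ → ℤ) → ∑ (upTo k) f ≡ ∑ (allFin k) (f ∘ toℕ)
∑-upTo zero f = refl
∑-upTo (suc k) f = trans (∑-upTo-suc k f)
  (trans (cong (f 0 +ℤ_) (∑-upTo k (f ∘ suc))) (sym (∑-allFin-suc k (f ∘ toℕ))))

-- The test is on `not b` so that `segOK P M (not b)` unfolds to `run b` of the labels on the
-- segment.
run : Bool → List ℕ → Bool
run b R = if not b then weakInc R else strictDec R

run-snoc : ∀ b R l l′ → run b ((R ++ l ∷ []) ++ l′ ∷ []) ≡ run b (R ++ l ∷ []) ∧ good b l b l′
run-snoc true [] l l′ = Boolₚ.∧-identityʳ _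
run-snoc true (a ∷ []) l l′ =
  trans (cong ((l <ᵇ a) ∧_) (run-snoc true [] l l′)) (sym (Boolₚ.∧-assoc (l <ᵇ a) true _))
run-snoc true (a ∷ a′ ∷ R) l l′ =
  trans (cong ((a′ <ᵇ a) ∧_) (run-snoc true (a′ ∷ R) l l′)) (sym (Boolₚ.∧-assoc (a′ <ᵇ a) _ _))
run-snoc false [] l l′ = Boolₚ.∧-identityʳ _
run-snoc false (a ∷ []) l l′ =
  trans (cong ((a ≤ᵇ l) ∧_) (run-snoc false [] l l′)) (sym (Boolₚ.∧-assoc (a ≤ᵇ l) true _))
run-snoc false (a ∷ a′ ∷ R) l l′ =
  trans (cong ((a ≤ᵇ a′) ∧_) (run-snoc false (a′ ∷ R) l l′)) (sym (Boolₚ.∧-assoc (a ≤ᵇ a′) _ _))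

-- The triple of a word and the action of φ on it

module Triples {m n : ℕ} (P : RLabeledPoset m n) where
  open RLabeledPoset P
  open Order _≼_
  open Walks P
  open Chains P

  Sat : ∀ {k} → Fin m → Vec (Fin m) k → Set
  Sat x v = T (coversTo top x (toList v))

  genC : ∀ {k} → Fin m → Vec (Fin m) k → Vec Bool k → List (Fin m)
  genC x [] [] = []
  genC x (z ∷ v) (true ∷ S) = x ∷ genC z v S
  genC x (z ∷ v) (false ∷ S) = genC z v S

  -- An interval still open at the end of the walk closes there, so `top` can occur in D although it
  -- never occurs in C.
  genD : ∀ {k} → Bool → Fin m → Vec (Fin m) k → Vec Bool k → Vec Bool k → List (Fin m)
  genD b x [] [] [] = if b then x ∷ [] else []
  genD b x (z ∷ v) (s ∷ S) (e ∷ E) = copies s b e x (genD e z v S E)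

  All-copies : ∀ {Q : Fin m → Set} s b e {x ds} → Q x → All Q ds → All Q (copies s b e x ds)
  All-copies true true true q qs = q ∷ qs
  All-copies true true false q qs = q ∷ q ∷ qs
  All-copies true false true q qs = qs
  All-copies true false false q qs = q ∷ qs
  All-copies false true true q qs = qs
  All-copies false true false q qs = q ∷ qs
  All-copies false false e q qs = qs

  head⋖ : ∀ {k} {x z} {v : Vec (Fin m) k} → Sat x (z ∷ v) → T (x ⋖ z)
  head⋖ = T-∧₁

  tailSat : ∀ {k} {x z} {v : Vec (Fin m) k} → Sat x (z ∷ v) → Sat z v
  tailSat {x = x} {z} c = T-∧₂ {x ⋖ z} c

  head-rank : ∀ {k} {x z} {v : Vec (Fin m) k} → Sat x (z ∷ v) → rank z ≡ suc (rank x)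
  head-rank {v = v} c = ⋖⇒rank (head⋖ {v = v} c)

  genC-≽ : ∀ {k} x (v : Vec (Fin m) k) S → Sat x v → All (λ c → T (x ≼ c)) (genC x v S)
  genC-≽ x [] [] c = []
  genC-≽ x (z ∷ v) (true ∷ S) c = ≼-refl x ∷
    All.map (≼-trans _ _ _ (⋖⇒≼ (head⋖ {v = v} c))) (genC-≽ z v S (tailSat {v = v} c))
  genC-≽ x (z ∷ v) (false ∷ S) c =
    All.map (≼-trans _ _ _ (⋖⇒≼ (head⋖ {v = v} c))) (genC-≽ z v S (tailSat {v = v} c))

  genD-≽ : ∀ {k} b x (v : Vec (Fin m) k) S E → Sat x v → All (λ c → T (x ≼ c)) (genD b x v S E)
  genD-≽ true x [] [] [] c = ≼-refl x ∷ []
  genD-≽ false x [] [] [] c = []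
  genD-≽ b x (z ∷ v) (s ∷ S) (e ∷ E) c = All-copies s b e (≼-refl x)
    (All.map (≼-trans _ _ _ (⋖⇒≼ (head⋖ {v = v} c))) (genD-≽ e z v S E (tailSat {v = v} c)))

  ≽⇒rank> : ∀ {k} {x z} (v : Vec (Fin m) k) {cs} → Sat x (z ∷ v) →
    All (λ c → T (z ≼ c)) cs → All (λ c → rank x < rank c) cs
  ≽⇒rank> v c = All.map (λ {c′} p → subst (_≤ rank c′) (head-rank {v = v} c) (≼⇒rank≤ p))

  genC-∈ : ∀ {k} x (v : Vec (Fin m) k) S → All (_∈ x ∷ toList v) (genC x v S)
  genC-∈ x [] [] = []
  genC-∈ x (z ∷ v) (true ∷ S) = here refl ∷ All.map there (genC-∈ z v S)
  genC-∈ x (z ∷ v) (false ∷ S) = All.map there (genC-∈ z v S)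

  genD-∈ : ∀ {k} b x (v : Vec (Fin m) k) S E → All (_∈ x ∷ toList v) (genD b x v S E)
  genD-∈ true x [] [] [] = here refl ∷ []
  genD-∈ false x [] [] [] = []
  genD-∈ b x (z ∷ v) (s ∷ S) (e ∷ E) = All-copies s b e (here refl) (All.map there (genD-∈ e z v S E))

  insAll : List (Fin m) → List (Fin m) → List (Fin m)
  insAll = foldr (insR P)

  insR-front : ∀ x cs → All (λ c → T (x ≼ c)) cs → insR P x cs ≡ x ∷ cs
  insR-front x [] _ = refl
  insR-front x (c ∷ cs) (p ∷ _) rewrite T-true (ℕₚ.≤⇒≤ᵇ (≼⇒rank≤ p)) = refl

  insAll-∷ : ∀ x cs new → All (λ c → rank x < rank c) new → insAll (x ∷ cs) new ≡ x ∷ insAll cs new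
  insAll-∷ x cs [] _ = refl
  insAll-∷ x cs (y ∷ new) (p ∷ ps)
    rewrite insAll-∷ x cs new ps | T-false (λ q → ℕₚ.<⇒≱ p (ℕₚ.≤ᵇ⇒≤ (rank y) (rank x) q)) = refl

  insAll-copies : ∀ s b e x ds new → All (λ c → rank x < rank c) new →
    insAll (copies s b e x ds) new ≡ copies s b e x (insAll ds new)
  insAll-copies true true true x ds new p = insAll-∷ x ds new p
  insAll-copies true true false x ds new p =
    trans (insAll-∷ x (x ∷ ds) new p) (cong (x ∷_) (insAll-∷ x ds new p))
  insAll-copies true false true x ds new p = refl
  insAll-copies true false false x ds new p = insAll-∷ x ds new p
  insAll-copies false true true x ds new p = refl
  insAll-copies false true false x ds new p = insAll-∷ x ds new p
  insAll-copies false false e x ds new p = refl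

  insAll-genC : ∀ {k} x (v : Vec (Fin m) k) S U → Sat x v → S ⊑ U →
    insAll (genC x v S) (genC x v (diff S U)) ≡ genC x v U
  insAll-genC x [] [] [] c p = refl
  insAll-genC x (z ∷ v) (true ∷ S) (true ∷ U) c p =
    trans (insAll-∷ x (genC z v S) _ (≽⇒rank> v c (genC-≽ z v (diff S U) (tailSat {v = v} c))))
      (cong (x ∷_) (insAll-genC z v S U (tailSat {v = v} c) (p ∘ suc)))
  insAll-genC x (z ∷ v) (true ∷ S) (false ∷ U) c p = ⊥-elim (p zero)
  insAll-genC x (z ∷ v) (false ∷ S) (true ∷ U) c p =
    trans (cong (insR P x) (insAll-genC z v S U (tailSat {v = v} c) (p ∘ suc)))
      (insR-front x (genC z v U) (genC-≽ x (z ∷ v) (false ∷ U) c))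
  insAll-genC x (z ∷ v) (false ∷ S) (false ∷ U) c p = insAll-genC z v S U (tailSat {v = v} c) (p ∘ suc)

  -- Adding a vertex to the set raises its multiplicity s + b - e in D by one, which is exactly the
  -- copy that φ inserts. This would fail for s = b = false and e = true, where `copies` truncates a
  -- negative number to 0; `feok` for the smaller set excludes that case.
  insAll-genD : ∀ {k} b x (v : Vec (Fin m) k) S U E → Sat x v → S ⊑ U → feok b S E →
    insAll (genD b x v S E) (genC x v (diff S U)) ≡ genD b x v U E
  insAll-genD b x [] [] [] [] c p f = refl
  insAll-genD b x (z ∷ v) (true ∷ S) (true ∷ U) (e ∷ E) c p (_ , f) =
    trans (insAll-copies true b e x _ _ (≽⇒rank> v c (genC-≽ z v (diff S U) (tailSat {v = v} c))))
      (cong (copies true b e x) (insAll-genD e z v S U E (tailSat {v = v} c) (p ∘ suc) f))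
  insAll-genD b x (z ∷ v) (true ∷ S) (false ∷ U) (e ∷ E) c p f = ⊥-elim (p zero)
  insAll-genD b x (z ∷ v) (false ∷ S) (false ∷ U) (e ∷ E) c p (_ , f) =
    trans (insAll-copies false b e x _ _ (≽⇒rank> v c (genC-≽ z v (diff S U) (tailSat {v = v} c))))
      (cong (copies false b e x) (insAll-genD e z v S U E (tailSat {v = v} c) (p ∘ suc) f))
  insAll-genD b x (z ∷ v) (false ∷ S) (true ∷ U) (e ∷ E) c p (g , f) =
    trans (cong (insR P x) (trans
      (insAll-copies false b e x _ _ (≽⇒rank> v c (genC-≽ z v (diff S U) (tailSat {v = v} c))))
      (cong (copies false b e x) (insAll-genD e z v S U E (tailSat {v = v} c) (p ∘ suc) f))))
    (trans (insR-front x (copies false b e x (genD e z v U E)) (genD-≽ b x (z ∷ v) (false ∷ U) (e ∷ E) c))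
      (more b e g))
    where
    more : ∀ b e → T (b ∨ not e) → x ∷ copies false b e x (genD e z v U E) ≡ copies true b e x (genD e z v U E)
    more true true _ = refl
    more true false _ = refl
    more false false _ = refl

  filterᵇ-genC : ∀ {k} (p : Fin k → Bool) x (v : Vec (Fin m) k) D → (∀ i → p i ≡ lookup D i) →
    map (λ r → lookup (x ∷ v) (inject₁ r)) (filterᵇ p (allFin k)) ≡ genC x v D
  filterᵇ-genC p x [] [] e = refl
  filterᵇ-genC p x (z ∷ v) (d ∷ D) e = trans (filterᵇ-allFin-suc p _) (cons d (e zero))
    where
    cons : ∀ d → p zero ≡ d → (if p zero then x ∷ [] else []) ++
      map (λ r → lookup (z ∷ v) (inject₁ r)) (filterᵇ (p ∘ suc) (allFin _)) ≡ genC x (z ∷ v) (d ∷ D)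
    cons true q rewrite q = cong (x ∷_) (filterᵇ-genC (p ∘ suc) z v D (e ∘ suc))
    cons false q rewrite q = filterᵇ-genC (p ∘ suc) z v D (e ∘ suc)

  gen : Vec Bool n → Vec (Fin m) n → Vec Bool n → Triple P
  gen S v E = genC bot v S , genD false bot v S E , bot ∷ v

  φ-gen : ∀ S U v E → Sat bot v → S ⊑ U → feok false S E → φ P S U (gen S v E) ≡ gen U v E
  φ-gen S U v E c p f
    rewrite filterᵇ-genC (λ r → lookup U r ∧ not (lookup S r)) bot v (diff S U) (lookup-diff S U) =
    cong₂ (λ C D → C , D , bot ∷ v) (insAll-genC bot v S U c p) (insAll-genD false bot v S U E c p f)

  -- Recovering the word from a triple

  Sat⇒rank< : ∀ {k} x (v : Vec (Fin m) k) → Sat x v → All (λ c → rank x < rank c) (toList v)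
  Sat⇒rank< x [] c = []
  Sat⇒rank< x (z ∷ v) c = subst (rank x <_) (sym (head-rank {v = v} c)) ℕₚ.≤-refl ∷
    All.map (ℕₚ.<-trans (subst (rank x <_) (sym (head-rank {v = v} c)) ℕₚ.≤-refl))
      (Sat⇒rank< z v (tailSat {v = v} c))

  ∈-tail : ∀ {x : Fin m} {c : Fin m} {cs} → rank x < rank c → c ∈ x ∷ cs → c ∈ cs
  ∈-tail p (here refl) = ⊥-elim (ℕₚ.<-irrefl refl p)
  ∈-tail p (there c∈) = c∈

  All-∈-tail : ∀ {x : Fin m} {xs} {cs} → All (λ c → rank x < rank c) cs → All (_∈ x ∷ xs) cs → All (_∈ xs) cs
  All-∈-tail [] [] = []
  All-∈-tail (p ∷ ps) (q ∷ qs) = ∈-tail p q ∷ All-∈-tail ps qs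

  ∈-head : ∀ {k} {x c} (v : Vec (Fin m) k) → Sat x v → rank c ≤ rank x → c ∈ x ∷ toList v → c ≡ x
  ∈-head v s p (here eq) = eq
  ∈-head {x = x} v s p (there c∈) = ⊥-elim (ℕₚ.<⇒≱ (All.lookup (Sat⇒rank< x v s) c∈) p)

  parseC : ∀ {k} r (S : Vec Bool k) C x v → Sat x v → rank x ≡ r → T (chainOn r S C) →
    All (_∈ x ∷ toList v) C → C ≡ genC x v S
  parseC r [] [] x [] s e p q = refl
  parseC r (false ∷ S) C x (z ∷ v) s refl p q =
    parseC (suc r) S C z v (tailSat {v = v} s) (head-rank {v = v} s) p
      (All-∈-tail (chainOn⇒rank≥ (suc r) S C p) q)
  parseC r (true ∷ S) (y ∷ C) x (z ∷ v) s refl p (q ∷ qs) =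
    cong₂ _∷_ (∈-head (z ∷ v) s (ℕₚ.≤-reflexive (ℕₚ.≡ᵇ⇒≡ (rank y) (rank x) (T-∧₁ p))) q)
      (parseC (suc r) S C z v (tailSat {v = v} s) (head-rank {v = v} s) p′
        (All-∈-tail (chainOn⇒rank≥ (suc r) S C p′) qs))
    where p′ = T-∧₂ {below y C} (T-∧₂ {rank y ≡ᵇ rank x} p)

  interlaces-≽ : ∀ z cs ds → T (interlaces P cs ds) →
    All (λ c → T (z ≼ c)) cs → All (λ d → T (z ≼ d)) ds
  interlaces-≽ z [] [] p q = []
  interlaces-≽ z (c ∷ cs) (d ∷ ds) p (q ∷ qs) =
    ≼-trans _ _ _ q (T-∧₁ p) ∷ interlaces-≽ z cs ds (T-∧₂ {nextLe P d cs} (T-∧₂ {c ≼ d} p)) qs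

  interlaces-tail : ∀ c cs d ds → T (interlaces P (c ∷ cs) (d ∷ ds)) → T (interlaces P cs ds)
  interlaces-tail c cs d ds p = T-∧₂ {nextLe P d cs} (T-∧₂ {c ≼ d} p)

  ∈-tail-genC : ∀ {k} {x z} (v : Vec (Fin m) k) S ds → Sat x (z ∷ v) → T (interlaces P (genC z v S) ds) →
    All (_∈ x ∷ z ∷ toList v) ds → All (_∈ z ∷ toList v) ds
  ∈-tail-genC {z = z} v S ds s p q = All-∈-tail
    (≽⇒rank> v s (interlaces-≽ z (genC z v S) ds p (genC-≽ z v S (tailSat {v = v} s)))) q

  ∈-≢ : ∀ {x d : Fin m} {xs} → ¬ d ≡ x → d ∈ x ∷ xs → d ∈ xs
  ∈-≢ p (here eq) = ⊥-elim (p eq)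
  ∈-≢ p (there d∈) = d∈

  -- The bits are found while walking up M, in three states: no interval is open; the interval that
  -- began at `y` is open; `x` itself is in C and begins one. Later entries of D lie higher, so
  -- comparing the next entry with the current vertex decides whether the open interval ends there.
  parseD-false : ∀ {k} x (v : Vec (Fin m) k) S ds → Sat x v → T (interlaces P (genC x v S) ds) →
    All (_∈ x ∷ toList v) ds → ∃ λ E → feok false S E × ds ≡ genD false x v S E
  parseD-true : ∀ {k} y x (v : Vec (Fin m) k) S ds → Sat x v → T (interlaces P (y ∷ genC x v S) ds) →
    All (_∈ x ∷ toList v) ds → ∃ λ E → feok true S E × ds ≡ genD true x v S E
  parseD-open : ∀ {k} x z (v : Vec (Fin m) k) S ds → Sat x (z ∷ v) → T (interlaces P (x ∷ genC z v S) ds) →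
    All (_∈ x ∷ z ∷ toList v) ds →
    ∃₂ λ e E → feok e S E × ds ≡ copies true false e x (genD e z v S E)

  parseD-false x [] [] [] s p q = [] , tt , refl
  parseD-false x (z ∷ v) (false ∷ S) ds s p q
    with parseD-false z v S ds (tailSat {v = v} s) p (∈-tail-genC v S ds s p q)
  ... | E , f , eq = false ∷ E , (tt , f) , eq
  parseD-false x (z ∷ v) (true ∷ S) ds s p q with parseD-open x z v S ds s p q
  ... | e , E , f , eq = e ∷ E , (tt , f) , eq

  parseD-true y x [] [] (d ∷ []) s p (here refl ∷ []) = [] , tt , refl
  parseD-true y x [] [] (d ∷ d′ ∷ ds) s p q = ⊥-elim (T-∧₂ {y ≼ d} p)
  parseD-true y x (z ∷ v) (false ∷ S) (d ∷ ds) s p (q ∷ qs)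
    with d ≟ x | ∈-tail-genC v S ds s (interlaces-tail y (genC z v S) d ds p) qs
  ... | yes refl | qs′
    with parseD-false z v S ds (tailSat {v = v} s) (interlaces-tail y (genC z v S) d ds p) qs′
  ...   | E , f , eq = false ∷ E , (tt , f) , cong (x ∷_) eq
  parseD-true y x (z ∷ v) (false ∷ S) (d ∷ ds) s p (q ∷ qs)
      | no d≢x | qs′
    with parseD-true y z v S (d ∷ ds) (tailSat {v = v} s) p (∈-≢ d≢x q ∷ qs′)
  ...   | E , f , eq = true ∷ E , (tt , f) , eq
  parseD-true y x (z ∷ v) (true ∷ S) (d ∷ ds) s p (q ∷ qs)
    -- Interlacing forces the open interval to end at or below the next chain element `x`, and its
    -- end lies on M at or above `x`. Hence it ends at `x`, where the next one begins.
    with ∈-head (z ∷ v) s (≼⇒rank≤ (T-∧₁ {d ≼ x} (T-∧₂ {y ≼ d} p))) q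
       | parseD-open x z v S ds s (interlaces-tail y (x ∷ genC z v S) d ds p) qs
  ... | refl | true , E , f , eq = true ∷ E , (tt , f) , cong (x ∷_) eq
  ... | refl | false , E , f , eq = false ∷ E , (tt , f) , cong (x ∷_) eq

  parseD-open x z v S (d ∷ ds) s p (q ∷ qs)
    with d ≟ x | ∈-tail-genC v S ds s (interlaces-tail x (genC z v S) d ds p) qs
  ... | yes refl | qs′
    with parseD-false z v S ds (tailSat {v = v} s) (interlaces-tail x (genC z v S) d ds p) qs′
  ...   | E , f , eq = false , E , f , cong (x ∷_) eq
  parseD-open x z v S (d ∷ ds) s p (q ∷ qs)
      | no d≢x | qs′
    with parseD-true x z v S (d ∷ ds) (tailSat {v = v} s) p (∈-≢ d≢x q ∷ qs′)
  ...   | E , f , eq = true , E , f , eq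

  -- All entries from later vertices have larger rank, so the multiplicity t + b - e of `x` can be
  -- read off and determines e. Under `feok` this difference is never truncated.
  genD-injective : ∀ {k} b x (v : Vec (Fin m) k) S E E′ → Sat x v → feok b S E → feok b S E′ →
    genD b x v S E ≡ genD b x v S E′ → E ≡ E′
  genD-injective b x [] [] [] [] s f f′ eq = refl
  genD-injective b x (z ∷ v) (t ∷ S) (e ∷ E) (e′ ∷ E′) s (g , f) (g′ , f′) eq =
    cut t b e e′ g g′ f f′ eq (gt e E) (gt e′ E′)
    where
    gt : ∀ e E → All (λ c → rank x < rank c) (genD e z v S E)
    gt e E = ≽⇒rank> v s (genD-≽ e z v S E (tailSat {v = v} s))
    absurd : ∀ {A : Set} {ds ds′} → ds ≡ x ∷ ds′ → All (λ c → rank x < rank c) ds → A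
    absurd refl (p ∷ _) = ⊥-elim (ℕₚ.<-irrefl refl p)
    tl : ∀ {ds ds′ : List (Fin m)} → x ∷ ds ≡ x ∷ ds′ → ds ≡ ds′
    tl refl = refl
    same : ∀ e → feok e S E → feok e S E′ → genD e z v S E ≡ genD e z v S E′ → e ∷ E ≡ e ∷ E′
    same e f f′ q = cong (e ∷_) (genD-injective e z v S E E′ (tailSat {v = v} s) f f′ q)
    cut : ∀ t b e e′ → T (t ∨ b ∨ not e) → T (t ∨ b ∨ not e′) → feok e S E → feok e′ S E′ →
      copies t b e x (genD e z v S E) ≡ copies t b e′ x (genD e′ z v S E′) →
      All (λ c → rank x < rank c) (genD e z v S E) → All (λ c → rank x < rank c) (genD e′ z v S E′) →
      e ∷ E ≡ e′ ∷ E′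
    cut true true true true _ _ f f′ q _ _ = same true f f′ (tl q)
    cut true true true false _ _ f f′ q r _ = absurd (tl q) r
    cut true true false true _ _ f f′ q _ r = absurd (sym (tl q)) r
    cut true true false false _ _ f f′ q _ _ = same false f f′ (tl (tl q))
    cut true false true true _ _ f f′ q _ _ = same true f f′ q
    cut true false true false _ _ f f′ q r _ = absurd q r
    cut true false false true _ _ f f′ q _ r = absurd (sym q) r
    cut true false false false _ _ f f′ q _ _ = same false f f′ (tl q)
    cut false true true true _ _ f f′ q _ _ = same true f f′ q
    cut false true true false _ _ f f′ q r _ = absurd q r
    cut false true false true _ _ f f′ q _ r = absurd (sym q) r
    cut false true false false _ _ f f′ q _ _ = same false f f′ (tl q)
    cut false false false false _ _ f f′ q _ _ = same false f f′ q

  -- Rank, interlacing and label conditions for the triple of a word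

  chainOn-genC : ∀ {k} r (S : Vec Bool k) x v → Sat x v → rank x ≡ r → T (chainOn r S (genC x v S))
  chainOn-genC r [] x [] s e = tt
  chainOn-genC r (false ∷ S) x (z ∷ v) s refl =
    chainOn-genC (suc r) S z v (tailSat {v = v} s) (head-rank {v = v} s)
  chainOn-genC r (true ∷ S) x (z ∷ v) s refl =
    T-∧ (≡ᵇ-refl (rank x)) (T-∧ (blw (genC z v S) (genC-≽ z v S (tailSat {v = v} s)))
      (chainOn-genC (suc r) S z v (tailSat {v = v} s) (head-rank {v = v} s)))
    where
    blw : ∀ cs → All (λ c → T (z ≼ c)) cs → T (below x cs)
    blw [] _ = tt
    blw (c ∷ cs) (p ∷ _) = ≼∧≢⇒≺ (≼-trans _ _ _ (⋖⇒≼ (head⋖ {v = v} s)) p)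
      (λ { refl → ℕₚ.<⇒≱ (≺⇒rank< (T-∧₁ (head⋖ {v = v} s))) (≼⇒rank≤ p) })

  nextLe-≽ : ∀ x cs → All (λ c → T (x ≼ c)) cs → T (nextLe P x cs)
  nextLe-≽ x [] _ = tt
  nextLe-≽ x (c ∷ cs) (p ∷ _) = p

  interlaces-∷ : ∀ {k} {y x z} (v : Vec (Fin m) k) S ds → Sat x (z ∷ v) → T (y ≼ x) →
    T (interlaces P (genC z v S) ds) → T (interlaces P (y ∷ genC z v S) (x ∷ ds))
  interlaces-∷ {x = x} {z} v S ds s y≼x p = T-∧ y≼x
    (T-∧ (nextLe-≽ x (genC z v S) (genC-≽ x (z ∷ v) (false ∷ S) s)) p)

  interlaces-gen-false : ∀ {k} x (v : Vec (Fin m) k) S E → Sat x v → feok false S E →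
    T (interlaces P (genC x v S) (genD false x v S E))
  interlaces-gen-true : ∀ {k} y x (v : Vec (Fin m) k) S E → Sat x v → feok true S E → T (y ≼ x) →
    T (interlaces P (y ∷ genC x v S) (genD true x v S E))

  interlaces-gen-false x [] [] [] s f = tt
  interlaces-gen-false x (z ∷ v) (true ∷ S) (true ∷ E) s (_ , f) =
    interlaces-gen-true x z v S E (tailSat {v = v} s) f (⋖⇒≼ (head⋖ {v = v} s))
  interlaces-gen-false x (z ∷ v) (true ∷ S) (false ∷ E) s (_ , f) =
    interlaces-∷ v S _ s (≼-refl x) (interlaces-gen-false z v S E (tailSat {v = v} s) f)
  interlaces-gen-false x (z ∷ v) (false ∷ S) (false ∷ E) s (_ , f) =
    interlaces-gen-false z v S E (tailSat {v = v} s) f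

  interlaces-gen-true y x [] [] [] s f y≼x = T-∧ y≼x tt
  interlaces-gen-true y x (z ∷ v) (true ∷ S) (true ∷ E) s (_ , f) y≼x =
    T-∧ y≼x (T-∧ (≼-refl x) (interlaces-gen-true x z v S E (tailSat {v = v} s) f (⋖⇒≼ (head⋖ {v = v} s))))
  interlaces-gen-true y x (z ∷ v) (true ∷ S) (false ∷ E) s (_ , f) y≼x =
    T-∧ y≼x (T-∧ (≼-refl x)
      (interlaces-∷ v S _ s (≼-refl x) (interlaces-gen-false z v S E (tailSat {v = v} s) f)))
  interlaces-gen-true y x (z ∷ v) (false ∷ S) (true ∷ E) s (_ , f) y≼x =
    interlaces-gen-true y z v S E (tailSat {v = v} s) f (≼-trans _ _ _ y≼x (⋖⇒≼ (head⋖ {v = v} s)))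
  interlaces-gen-true y x (z ∷ v) (false ∷ S) (false ∷ E) s (_ , f) y≼x =
    interlaces-∷ v S _ s y≼x (interlaces-gen-false z v S E (tailSat {v = v} s) f)

  rankSum : List (Fin m) → ℕ
  rankSum cs = sumℕ (map rank cs)

  -- Every edge inside an interval accounts for one unit of rank. An interval already open at `x`
  -- has its end in this part of D but its start in an earlier part of C; it contributes its edges
  -- above `x` together with `rank x`, whence the last summand.
  rankSum-gen : ∀ {k} b x (v : Vec (Fin m) k) S E → Sat x v → feok b S E →
    rankSum (genD b x v S E) ≡ exc (steps x v E) + rankSum (genC x v S) + (if b then rank x else 0)
  rankSum-gen true x [] [] [] s f = ℕₚ.+-identityʳ (rank x)
  rankSum-gen false x [] [] [] s f = refl
  rankSum-gen b x (z ∷ v) (t ∷ S) (e ∷ E) s (g , f) =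
    cut t b e g (rankSum-gen e z v S E (tailSat {v = v} s) f)
    where
    open Data.Nat.Solver.+-*-Solver
    r = rank x
    j = exc (steps z v E)
    c = rankSum (genC z v S)
    cut : ∀ t b e → T (t ∨ b ∨ not e) →
      rankSum (genD e z v S E) ≡ j + c + (if e then rank z else 0) →
      rankSum (copies t b e x (genD e z v S E)) ≡
      exc (steps x (z ∷ v) (e ∷ E)) + rankSum (genC x (z ∷ v) (t ∷ S)) + (if b then rank x else 0)
    cut true true true _ eq rewrite eq | head-rank {v = v} s =
      solve 3 (λ r j c → r :+ (j :+ c :+ (con 1 :+ r)) := con 1 :+ j :+ (r :+ c) :+ r) refl r j c
    cut true true false _ eq rewrite eq =
      solve 3 (λ r j c → r :+ (r :+ (j :+ c :+ con 0)) := j :+ (r :+ c) :+ r) refl r j c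
    cut true false true _ eq rewrite eq | head-rank {v = v} s =
      solve 3 (λ r j c → j :+ c :+ (con 1 :+ r) := con 1 :+ j :+ (r :+ c) :+ con 0) refl r j c
    cut true false false _ eq rewrite eq =
      solve 3 (λ r j c → r :+ (j :+ c :+ con 0) := j :+ (r :+ c) :+ con 0) refl r j c
    cut false true true _ eq rewrite eq | head-rank {v = v} s =
      solve 3 (λ r j c → j :+ c :+ (con 1 :+ r) := con 1 :+ j :+ c :+ r) refl r j c
    cut false true false _ eq rewrite eq =
      solve 3 (λ r j c → r :+ (j :+ c :+ con 0) := j :+ c :+ r) refl r j c
    cut false false false _ eq = eq

  -- While an interval is open, the next entry of the merged list is its end, so D comes first.
  alternate : Bool → List (Fin m) → List (Fin m) → List (Fin m)
  alternate false C D = interleave P C D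
  alternate true C [] = []
  alternate true C (d ∷ D) = d ∷ interleave P C D

  -- `interleave` stops as soon as D is empty. With an interval open D still contains its end, so
  -- the merge goes on.
  interleave-alternate : ∀ {k} y cs x (v : Vec (Fin m) k) S E →
    interleave P (y ∷ cs) (genD true x v S E) ≡ y ∷ alternate true cs (genD true x v S E)
  interleave-alternate y cs x v S E with genD true x v S E | nonempty x v S E
    where
    nonempty : ∀ {k} x (v : Vec (Fin m) k) S E → ∃₂ λ d D → genD true x v S E ≡ d ∷ D
    nonempty x [] [] [] = x , [] , refl
    nonempty x (z ∷ v) (true ∷ S) (true ∷ E) = _ , _ , refl
    nonempty x (z ∷ v) (true ∷ S) (false ∷ E) = _ , _ , refl
    nonempty x (z ∷ v) (false ∷ S) (true ∷ E) = nonempty z v S E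
    nonempty x (z ∷ v) (false ∷ S) (false ∷ E) = _ , _ , refl
  ... | _ | _ , _ , refl = refl

  module _ (M : Vec (Fin m) (suc n)) where

    L : List ℕ
    L = labelsOf lab (toList M)

    segOK-run : ∀ b x y R rest → rank y ≡ rank x + length R → drop (rank x) L ≡ R ++ rest →
      segOK P M (not b) x y ≡ run b R
    segOK-run b x y R rest e d = cong (run b) (begin
      take (rank y ∸ rank x) (drop (rank x) L) ≡⟨ cong₂ take (trans (cong (_∸ rank x) e) (ℕₚ.m+n∸m≡n (rank x) _)) d ⟩
      take (length R) (R ++ rest)              ≡⟨ take-length-++ R rest refl ⟩
      R ∎)

    segOK-refl : ∀ b x → segOK P M b x x ≡ true
    segOK-refl b x rewrite ℕₚ.n∸n≡0 (rank x) with b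
    ... | true = refl
    ... | false = refl

    -- R lists the labels on the current segment, from its start y up to x.
    segsOK-gen : ∀ {k} b y R l x (v : Vec (Fin m) k) S E → Sat x v → feok b S E →
      rank x ≡ rank y + length R → drop (rank y) L ≡ R ++ labelsOf lab (x ∷ toList v) →
      (∀ l′ → run b (R ++ l′ ∷ []) ≡ run b R ∧ good b l b l′) →
      segsOK P M (not b) (y ∷ alternate b (genC x v S) (genD b x v S E) ++ top ∷ []) ≡
      run b R ∧ ok b l (toList S) (steps x v E)
    segsOK-gen false y R l x [] [] [] s f e d h with ==F⇒≡ {x = x} {top} s
    ... | refl = cong (_∧ true) (segOK-run false y x R [] e d)
    segsOK-gen true y R l x [] [] [] s f e d h with ==F⇒≡ {x = x} {top} s
    ... | refl = cong₂ _∧_ (segOK-run true y x R [] e d) (cong (_∧ true) (segOK-refl true x))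
    segsOK-gen b y R l x (z ∷ v) (t ∷ S) (e ∷ E) s (g , f) rx d h = cut t b e g f h
      where
      lx = lab x z
      rest = labelsOf lab (z ∷ toList v)
      C′ = genC z v S
      D′ : Bool → List (Fin m)
      D′ e = genD e z v S E
      ok′ : Bool → Bool
      ok′ e = ok e lx (toList S) (steps z v E)
      s′ : Sat z v
      s′ = tailSat {v = v} s
      close : ∀ b → segOK P M (not b) y x ≡ run b R
      close b = segOK-run b y x R _ rx d
      run-one : ∀ e l → run e (l ∷ []) ≡ true
      run-one true l = refl
      run-one false l = refl
      run-two : ∀ e l′ → run e (lx ∷ l′ ∷ []) ≡ run e (lx ∷ []) ∧ good e lx e l′
      run-two e l′ = run-snoc e [] lx l′
      d-x : drop (rank x) L ≡ lx ∷ rest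
      d-x = begin
        drop (rank x) L                  ≡⟨ cong (λ i → drop i L) rx ⟩
        drop (rank y + length R) L       ≡⟨ drop-drop (rank y) (length R) L ⟨
        drop (length R) (drop (rank y) L) ≡⟨ cong (drop (length R)) d ⟩
        drop (length R) (R ++ lx ∷ rest) ≡⟨ drop-length-++ R (lx ∷ rest) refl ⟩
        lx ∷ rest ∎
      -- The new segment starts with the single label `lx`. One label passes both tests, so nothing
      -- is compared across `x`.
      restart : ∀ e → feok e S E →
        segsOK P M (not e) (x ∷ alternate e C′ (D′ e) ++ top ∷ []) ≡ ok′ e
      restart e f = trans (segsOK-gen e x (lx ∷ []) lx z v S E s′ f
        (trans (head-rank {v = v} s) (ℕₚ.+-comm 1 (rank x))) d-x (run-two e))
        (cong (_∧ ok′ e) (run-one e lx))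
      continue : ∀ b → feok b S E → (∀ l′ → run b (R ++ l′ ∷ []) ≡ run b R ∧ good b l b l′) →
        segsOK P M (not b) (y ∷ alternate b C′ (D′ b) ++ top ∷ []) ≡
        run b R ∧ (good b l b lx ∧ ok′ b)
      continue b f h = trans (segsOK-gen b y (R ++ lx ∷ []) lx z v S E s′ f
        (trans (head-rank {v = v} s) (trans (cong suc rx) (trans (sym (ℕₚ.+-suc (rank y) (length R)))
          (cong (λ i → rank y + i) (trans (ℕₚ.+-comm 1 (length R)) (sym (length-++ R)))))))
        (trans d (sym (++-assoc R (lx ∷ []) rest))) (run-snoc b R lx))
        (trans (cong (_∧ ok′ b) (h lx)) (Boolₚ.∧-assoc (run b R) _ _))
      cut : ∀ t b e → T (t ∨ b ∨ not e) → feok e S E →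
        (∀ l′ → run b (R ++ l′ ∷ []) ≡ run b R ∧ good b l b l′) →
        segsOK P M (not b) (y ∷ alternate b (genC x (z ∷ v) (t ∷ S)) (copies t b e x (D′ e)) ++ top ∷ []) ≡
        run b R ∧ ((t ∨ good b l e lx) ∧ ok′ e)
      cut false true true _ f h = continue true f h
      cut false false false _ f h = continue false f h
      cut false true false _ f h = cong₂ _∧_ (close true) (restart false f)
      -- One interval ends at `x` and the next begins there; the increasing segment between them is
      -- [x, x], without labels.
      cut true true true _ f h
        rewrite interleave-alternate x C′ z v S E =
        cong₂ _∧_ (close true) (cong₂ _∧_ (segOK-refl true x) (restart true f))
      -- Here `x` occurs twice in D: as the end of the earlier interval and as the end of the
      -- degenerate interval [x, x].
      cut true true false _ f h =
        cong₂ _∧_ (close true) (cong₂ _∧_ (segOK-refl true x) (cong₂ _∧_ (segOK-refl false x) (restart false f)))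
      cut true false true _ f h
        rewrite interleave-alternate x C′ z v S E =
        cong₂ _∧_ (close false) (restart true f)
      cut true false false _ f h =
        cong₂ _∧_ (close false) (cong₂ _∧_ (segOK-refl false x) (restart false f))

  -- At `bot` the current segment is empty. The virtual last label 0 is at most every label, so
  -- appending the first label is consistent with `good`.
  segsOK-ok : ∀ v S E → Sat bot v → feok false S E →
    segsOK P (bot ∷ v) true (bot ∷ (interleave P (genC bot v S) (genD false bot v S E) ++ top ∷ [])) ≡
    ok false 0 (toList S) (steps bot v E)
  segsOK-ok v S E s f = segsOK-gen (bot ∷ v) false bot [] 0 bot v S E s f
    (sym (ℕₚ.+-identityʳ (rank bot))) (cong (λ i → drop i (labelsOf lab (bot ∷ toList v))) rank-bot)
    (λ l′ → refl)

  ok⇒feok : ∀ {k} b l x (v : Vec (Fin m) k) S E → T (ok b l (toList S) (steps x v E)) → feok b S E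
  ok⇒feok b l x [] [] [] p = tt
  ok⇒feok b l x (z ∷ v) (s ∷ S) (e ∷ E) p =
    bit s b e (T-∧₁ p) , ok⇒feok e (lab x z) z v S E (T-∧₂ {s ∨ good b l e (lab x z)} p)
    where
    bit : ∀ s b e → T (s ∨ good b l e (lab x z)) → T (s ∨ b ∨ not e)
    bit true b e _ = tt
    bit false true e _ = tt
    bit false false false _ = tt

  -- By `ok-badVec` and `ok⇒badVec⊑` this is the least set for which the word is admissible.
  badVec : ∀ {k} → Bool → ℕ → Fin m → Vec (Fin m) k → Vec Bool k → Vec Bool k
  badVec b l x [] [] = []
  badVec b l x (z ∷ v) (e ∷ E) = not (good b l e (lab x z)) ∷ badVec e (lab x z) z v E

  badIs-badVec : ∀ {k} b l x (v : Vec (Fin m) k) U E →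
    badIs b l U (steps x v E) ≡ eqVecB U (badVec b l x v E)
  badIs-badVec b l x [] [] [] = refl
  badIs-badVec b l x (z ∷ v) (u ∷ U) (e ∷ E) =
    cong (eqBool u (not (good b l e (lab x z))) ∧_) (badIs-badVec e (lab x z) z v U E)

  ok-badVec : ∀ {k} b l x (v : Vec (Fin m) k) E → T (ok b l (toList (badVec b l x v E)) (steps x v E))
  ok-badVec b l x [] [] = tt
  ok-badVec b l x (z ∷ v) (e ∷ E) = T-∧ (em (good b l e (lab x z))) (ok-badVec e (lab x z) z v E)
    where
    em : ∀ a → T (not a ∨ a)
    em true = tt
    em false = tt

  ok⇒badVec⊑ : ∀ {k} b l x (v : Vec (Fin m) k) S E → T (ok b l (toList S) (steps x v E)) →
    badVec b l x v E ⊑ S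
  ok⇒badVec⊑ b l x (z ∷ v) (s ∷ S) (e ∷ E) p zero =
    bit s (good b l e (lab x z)) (T-∧₁ p)
    where
    bit : ∀ s a → T (s ∨ a) → T (not (not a) ∨ s)
    bit s true _ = tt
    bit true false _ = tt
  ok⇒badVec⊑ b l x (z ∷ v) (s ∷ S) (e ∷ E) p (suc i) =
    ok⇒badVec⊑ e (lab x z) z v S E (T-∧₂ {s ∨ good b l e (lab x z)} p) i

  -- The sets A and B in terms of words

  inA-gen : ∀ ℓ S v E → Sat bot v → T (ok false 0 (toList S) (steps bot v E)) →
    exc (steps bot v E) ≡ ℓ → T (inA P ℓ S (gen S v E))
  inA-gen ℓ S v E s p e =
    T-∧ {isChain P C} (T-∧₁ {isChain P C} chain)
      (T-∧ {rankSetIs P C S} (T-∧ ranks (T-∧₂ {isChain P C} chain))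
        (T-∧ {interlaces P C D} (interlaces-gen-false bot v S E s f)
          (T-∧ {irankIs P C D ℓ} irank
            (T-∧ {isMaxChain P (bot ∷ v)} (T-∧ (==F-refl bot) s)
              (T-∧ {allᵇ (λ x → anyᵇ (x ==F_) (bot ∷ toList v)) (C ++ D)} on-M
                (subst T (sym (segsOK-ok v S E s f)) p))))))
    where
    C = genC bot v S
    D = genD false bot v S E
    f = ok⇒feok false 0 bot v S E p
    chain : T (isChain P C ∧ eqVecB (rankSet P C) S)
    chain = subst T (sym (isChain-chainOn S C)) (chainOn-genC 0 S bot v s rank-bot)
    ranks : T (allᵇ (λ c → rank c <ᵇ n) C)
    ranks = All⇒allᵇ (All.map
      (λ {c} q → ℕₚ.<⇒<ᵇ (subst (rank c <_) rank-top (≺⇒rank< (T-∧ (top-max c) q))))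
      (allᵇ⇒All C (T-∧₂ {strictlyInc P C} (T-∧₁ {isChain P C} chain))))
    irank : T (irankIs P C D ℓ)
    irank = ℕₚ.≡⇒≡ᵇ (rankSum D) _ (trans (rankSum-gen false bot v S E s f)
      (trans (ℕₚ.+-identityʳ _) (cong (_+ rankSum C) e)))
    on-M : T (allᵇ (λ x → anyᵇ (x ==F_) (bot ∷ toList v)) (C ++ D))
    on-M = All⇒allᵇ (All.map (λ {x} q → ⇒anyᵇ {p = x ==F_} q (==F-refl x))
      (Allₚ.++⁺ (genC-∈ bot v S) (genD-∈ false bot v S E)))

  -- C is located on M by rank. Interlacing then yields the bits together with `feok`, after which
  -- `segsOK-ok` and `rankSum-gen` turn the remaining conditions into conditions on the word.
  inA-parse : ∀ ℓ S t → T (inA P ℓ S t) → ∃₂ λ v E →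
    Sat bot v × T (ok false 0 (toList S) (steps bot v E)) × exc (steps bot v E) ≡ ℓ × t ≡ gen S v E
  inA-parse ℓ S (C , D , y ∷ v) a
    with T-∧₂ {isChain P C} a
  ... | a₁ with T-∧₂ {rankSetIs P C S} a₁
  ... | a₂ with T-∧₂ {interlaces P C D} a₂
  ... | a₃ with T-∧₂ {irankIs P C D ℓ} a₃
  ... | a₄ with T-∧₂ {isMaxChain P (y ∷ v)} a₄
  ... | a₅ with ==F⇒≡ {x = bot} {y} (T-∧₁ (T-∧₁ a₄))
  ... | refl = go (parseC 0 S C bot v s rank-bot chain (Allₚ.++⁻ˡ C mem))
    where
    s : Sat bot v
    s = T-∧₂ {bot ==F bot} (T-∧₁ {isMaxChain P (bot ∷ v)} a₄)
    chain : T (chainOn 0 S C)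
    chain = subst T (isChain-chainOn S C)
      (T-∧ {isChain P C} (T-∧₁ a) (T-∧₂ {allᵇ (λ c → rank c <ᵇ n) C} (T-∧₁ {rankSetIs P C S} a₁)))
    mem : All (_∈ bot ∷ toList v) (C ++ D)
    mem = All.map (λ {x} q → let z , z∈ , e = anyᵇ⇒ {p = x ==F_} (bot ∷ toList v) q in
                      subst (_∈ bot ∷ toList v) (sym (==F⇒≡ {x = x} {z} e)) z∈)
            (allᵇ⇒All (C ++ D) (T-∧₁ a₅))
    go : C ≡ genC bot v S → ∃₂ λ v′ E → Sat bot v′ × T (ok false 0 (toList S) (steps bot v′ E)) ×
      exc (steps bot v′ E) ≡ ℓ × (C , D , bot ∷ v) ≡ gen S v′ E
    go refl with parseD-false bot v S D s (T-∧₁ a₂) (Allₚ.++⁻ʳ C mem)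
    ... | E , f , refl = v , E , s ,
      subst T (segsOK-ok v S E s f) (T-∧₂ {allᵇ (λ x → anyᵇ (x ==F_) (bot ∷ toList v)) (C ++ D)} a₅) ,
      ℕₚ.+-cancelʳ-≡ (rankSum C) (exc (steps bot v E)) ℓ (trans (sym (ℕₚ.+-identityʳ _))
        (trans (sym (rankSum-gen false bot v S E s f)) (ℕₚ.≡ᵇ⇒≡ (rankSum D) _ (T-∧₁ a₃)))) ,
      refl

  length-genC : ∀ {k} x (v : Vec (Fin m) k) S → length (genC x v S) ≤ k
  length-genC x [] [] = z≤n
  length-genC x (z ∷ v) (true ∷ S) = s≤s (length-genC z v S)
  length-genC x (z ∷ v) (false ∷ S) = ℕₚ.m≤n⇒m≤1+n (length-genC z v S)

  interlaces-length : ∀ C D → T (interlaces P C D) → length D ≡ length C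
  interlaces-length [] [] _ = refl
  interlaces-length (c ∷ C) (d ∷ D) p = cong suc (interlaces-length C D (interlaces-tail c C d D p))

  ∈-triples : ∀ C D M → length D ≡ length C → length C ≤ m → (C , D , M) ∈ triples P
  ∈-triples C D M e p = concatMap-∈ _ (∈-upTo⁺ (s≤s p)) (concatMap-∈ _ (∈-listsOfLen C)
    (concatMap-∈ _ (subst (λ k → D ∈ listsOfLen m k) e (∈-listsOfLen D))
      (∈-map⁺ (λ M → C , D , M) (∈-allVecs M))))

  -- `numB` counts occurrences in a list, so each relevant triple must be known to occur there
  -- exactly once.
  ∑-triples-δ : ∀ C D M → length D ≡ length C → length C ≤ m →
    ∑ (triples P) (λ t → when (eqTriple P (C , D , M) t) (+ 1)) ≡ + 1
  ∑-triples-δ C D M e p = begin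
    ∑ (triples P) (λ t → when (eqTriple P (C , D , M) t) (+ 1))
      ≡⟨ ∑-concatMap block (upTo (suc m)) eq ⟩
    ∑ (upTo (suc m)) (λ k → ∑ (block k) eq)
      ≡⟨ ∑-cong (upTo (suc m)) (λ k → trans (∑-concatMap (row k) (listsOfLen m k) eq)
           (∑-cong (listsOfLen m k) (λ C′ → trans
             (∑-concatMap (λ D′ → map (λ M′ → C′ , D′ , M′) (allVecs m (suc n))) (listsOfLen m k) eq)
             (trans (∑-cong (listsOfLen m k) (λ D′ → trans (∑-map _ (allVecs m (suc n)) eq)
               (inner C′ D′))) (∑-when (listsOfLen m k) (eqListF C C′) _))))) ⟩
    ∑ (upTo (suc m)) (λ k → ∑ (listsOfLen m k) (λ C′ → when (eqListF C C′)
      (∑ (listsOfLen m k) (λ D′ → when (eqListF D D′) (+ 1)))))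
      ≡⟨ ∑-upTo (suc m) layer ⟩
    ∑ (allFin (suc m)) (λ i → layer (toℕ i))
      ≡⟨ ∑-cong (allFin (suc m)) only ⟩
    ∑ (allFin (suc m)) (λ i → when (i₀ ==F i) (layer (toℕ i)))
      ≡⟨ ∑-δ i₀ (layer ∘ toℕ) ⟩
    layer (toℕ i₀)
      ≡⟨ cong layer (Finₚ.toℕ-fromℕ< (s≤s p)) ⟩
    layer (length C)
      ≡⟨ ∑-listsOfLen-δ C _ ⟩
    ∑ (listsOfLen m (length C)) (λ D′ → when (eqListF D D′) (+ 1))
      ≡⟨ cong (λ k → ∑ (listsOfLen m k) (λ D′ → when (eqListF D D′) (+ 1))) e ⟨
    ∑ (listsOfLen m (length D)) (λ D′ → when (eqListF D D′) (+ 1))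
      ≡⟨ ∑-listsOfLen-δ D (λ _ → + 1) ⟩
    + 1 ∎
    where
    row : ℕ → List (Fin m) → List (Triple P)
    row k C′ = concatMap (λ D′ → map (λ M′ → C′ , D′ , M′) (allVecs m (suc n))) (listsOfLen m k)
    block : ℕ → List (Triple P)
    block k = concatMap (row k) (listsOfLen m k)
    eq : Triple P → ℤ
    eq t = when (eqTriple P (C , D , M) t) (+ 1)
    layer : ℕ → ℤ
    layer k = ∑ (listsOfLen m k) (λ C′ → when (eqListF C C′)
      (∑ (listsOfLen m k) (λ D′ → when (eqListF D D′) (+ 1))))
    i₀ : Fin (suc m)
    i₀ = fromℕ< (s≤s p)
    only : ∀ i → layer (toℕ i) ≡ when (i₀ ==F i) (layer (toℕ i))
    only i with i₀ ≟ i
    ... | yes _ = refl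
    ... | no i₀≢i = ∑-listsOfLen-δ′ (toℕ i) C _
            (λ q → i₀≢i (Finₚ.toℕ-injective (trans (Finₚ.toℕ-fromℕ< (s≤s p)) q)))
    inner : ∀ C′ D′ → ∑ (allVecs m (suc n)) (λ M′ → eq (C′ , D′ , M′)) ≡
      when (eqListF C C′) (when (eqListF D D′) (+ 1))
    inner C′ D′ = trans (∑-cong (allVecs m (suc n)) (λ M′ → trans (when-∧ (eqListF C C′) _ _)
        (cong (when (eqListF C C′)) (when-∧ (eqListF D D′) _ _))))
      (trans (∑-when (allVecs m (suc n)) (eqListF C C′) _)
        (cong (when (eqListF C C′)) (trans (∑-when (allVecs m (suc n)) (eqListF D D′) _)
          (cong (when (eqListF D D′)) (∑-allVecs-δ M (λ _ → + 1))))))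

  eqTriple⇒≡ : ∀ t t′ → T (eqTriple P t t′) → t ≡ t′
  eqTriple⇒≡ (C , D , M) (C′ , D′ , M′) p
    with eqListF⇒≡ {xs = C} {C′} (T-∧₁ p)
       | eqListF⇒≡ {xs = D} {D′} (T-∧₁ (T-∧₂ {eqListF C C′} p))
       | eqVecF⇒≡ {xs = M} {M′} (T-∧₂ {eqListF D D′} (T-∧₂ {eqListF C C′} p))
  ... | refl | refl | refl = refl

  eqTriple-refl : ∀ t → T (eqTriple P t t)
  eqTriple-refl (C , D , M) = T-∧ (eqListF-refl C) (T-∧ (eqListF-refl D) (eqVecF-refl M))

  gen-injective : ∀ S {v v′ E E′} → Sat bot v → feok false S E → feok false S E′ →
    gen S v E ≡ gen S v′ E′ → v ≡ v′ × E ≡ E′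
  gen-injective S {v} {v′} {E} {E′} s f f′ eq with cong (Vec.tail ∘ proj₂ ∘ proj₂) eq
  ... | refl = refl , genD-injective false bot v S E E′ s f f′ (cong (proj₁ ∘ proj₂) eq)

  properSubset⇒⊑ : ∀ S U → T (properSubset P S U) → S ⊑ U
  properSubset⇒⊑ S U p i = All.lookup (allᵇ⇒All (allFin n) (T-∧₁ p)) (∈-allFin i)

  ⊑⇒properSubset : ∀ S U → S ⊑ U → ¬ S ≡ U → T (properSubset P S U)
  ⊑⇒properSubset S U p q =
    T-∧ (All⇒allᵇ (All.universal p (allFin n))) (T-not (q ∘ eqVecB⇒≡))

  encodes : ℕ → Vec Bool n → Vec (Fin m) n → Vec Bool n → Bool
  encodes ℓ U v E =
    coversTo top bot (toList v) ∧ badIs false 0 U (steps bot v E) ∧ (exc (steps bot v E) ≡ᵇ ℓ)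

  module _ (ℓ : ℕ) (U : Vec Bool n) (v : Vec (Fin m) n) (E : Vec Bool n) (enc : T (encodes ℓ U v E)) where

    private
      bad = badVec false 0 bot v E

    encodes-Sat : Sat bot v
    encodes-Sat = T-∧₁ enc

    encodes-badVec : U ≡ bad
    encodes-badVec = eqVecB⇒≡ (subst T (badIs-badVec false 0 bot v U E)
      (T-∧₁ (T-∧₂ {coversTo top bot (toList v)} enc)))

    encodes-exc : exc (steps bot v E) ≡ ℓ
    encodes-exc = ℕₚ.≡ᵇ⇒≡ _ ℓ
      (T-∧₂ {badIs false 0 U (steps bot v E)} (T-∧₂ {coversTo top bot (toList v)} enc))

    encodes-ok : T (ok false 0 (toList U) (steps bot v E))
    encodes-ok = subst (λ S → T (ok false 0 (toList S) (steps bot v E))) (sym encodes-badVec)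
      (ok-badVec false 0 bot v E)

    encodes-feok : feok false U E
    encodes-feok = ok⇒feok false 0 bot v U E encodes-ok

    -- A preimage under φ from a proper subset S carries the same word, because φ keeps the word and
    -- `gen U` is injective. Then S contains the bad positions of this word, but these already make
    -- up all of `U`.
    encodes⇒inB : T (inB P ℓ U (gen U v E))
    encodes⇒inB = T-∧ (inA-gen ℓ U v E encodes-Sat encodes-ok encodes-exc) (T-not ¬inImage)
      where
      ¬inImage : ¬ T (inImage P ℓ U (gen U v E))
      ¬inImage p with anyᵇ⇒ (allSubsets n) p
      ... | S , _ , q with anyᵇ⇒ (triples P) (T-∧₂ {properSubset P S U} q)
      ... | t , _ , r with inA-parse ℓ S t (T-∧₁ r)
      ... | v′ , E′ , s′ , o′ , _ , refl
        with gen-injective U s′ (feok-mono false S U E′ S⊑U f′) encodes-feok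
               (trans (sym (φ-gen S U v′ E′ s′ S⊑U f′))
                 (eqTriple⇒≡ (φ P S U (gen S v′ E′)) (gen U v E) (T-∧₂ {inA P ℓ S (gen S v′ E′)} r)))
        where
        S⊑U = properSubset⇒⊑ S U (T-∧₁ q)
        f′ = ok⇒feok false 0 bot v′ S E′ o′
      ... | refl , refl = not-T (T-∧₂ {allᵇ (λ i → not (lookup S i) ∨ lookup U i) (allFin n)} (T-∧₁ q))
        (subst (λ V → T (eqVecB S V)) S≡U (eqVecB-refl S))
        where
        S≡U : S ≡ U
        S≡U = ⊑-antisym S U (properSubset⇒⊑ S U (T-∧₁ q))
          (subst (_⊑ S) (sym encodes-badVec) (ok⇒badVec⊑ false 0 bot v S E o′))

    encodes-∑-triples : ∑ (triples P) (λ t → when (eqTriple P (gen U v E) t) (+ 1)) ≡ + 1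
    encodes-∑-triples = ∑-triples-δ (genC bot v U) (genD false bot v U E) (bot ∷ v)
      (interlaces-length (genC bot v U) _ (interlaces-gen-false bot v U E encodes-Sat encodes-feok))
      (ℕₚ.≤-trans (length-genC bot v U) (ℕₚ.<⇒≤ n<m))

  -- If the bad positions formed a proper subset of `U`, the same word with that subset in place of
  -- `U` would give a preimage under φ.
  inB⇒encodes : ∀ ℓ U t → T (inB P ℓ U t) → ∃₂ λ v E → T (encodes ℓ U v E) × t ≡ gen U v E
  inB⇒encodes ℓ U t b with inA-parse ℓ U t (T-∧₁ b)
  ... | v , E , s , o , e , refl = v , E ,
      T-∧ s (T-∧ (subst T (sym (badIs-badVec false 0 bot v U E)) U≡bad) (ℕₚ.≡⇒≡ᵇ _ ℓ e)) , refl
    where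
    bad = badVec false 0 bot v E
    bad⊑U = ok⇒badVec⊑ false 0 bot v U E o
    bad-ok = ok-badVec false 0 bot v E
    bad-feok = ok⇒feok false 0 bot v bad E bad-ok
    -- `inImage` searches a finite list, so the preimage has to be found in it; `n<m` bounds its
    -- length.
    mem : gen bad v E ∈ triples P
    mem = ∈-triples _ _ _
      (interlaces-length (genC bot v bad) _ (interlaces-gen-false bot v bad E s bad-feok))
      (ℕₚ.≤-trans (length-genC bot v bad) (ℕₚ.<⇒≤ n<m))
    image : ¬ bad ≡ U → T (inImage P ℓ U (gen U v E))
    image p = ⇒anyᵇ (∈-allSubsets bad) (T-∧ (⊑⇒properSubset bad U bad⊑U p)
      (⇒anyᵇ mem (T-∧ {inA P ℓ bad (gen bad v E)} (inA-gen ℓ bad v E s bad-ok e)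
        (subst (λ t → T (eqTriple P t (gen U v E))) (sym (φ-gen bad U v E s bad⊑U bad-feok))
          (eqTriple-refl (gen U v E))))))
    U≡bad : T (eqVecB U bad)
    U≡bad with eqVecB U bad in q
    ... | true = tt
    ... | false = ⊥-elim (not-T (T-∧₂ {inA P ℓ U (gen U v E)} b)
                    (image (λ r → subst T (trans (cong (λ V → eqVecB V bad) r) q) (eqVecB-refl bad))))

  -- At most one word encodes a given triple, by injectivity of `gen U`, and one does exactly when
  -- the triple is in B. Written as a sum over words, membership in B lets the count be exchanged
  -- with the sum over triples, where each word then contributes 1.
  when-inB : ∀ ℓ U t → when (inB P ℓ U t) (+ 1) ≡
    ∑ (allVecs m n) (λ v → ∑ (allSubsets n) (λ E →
      when (encodes ℓ U v E) (when (eqTriple P (gen U v E) t) (+ 1))))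
  when-inB ℓ U t with inB P ℓ U t in b
  ... | false = sym (∑-≡0 (allVecs m n) (λ v → ∑-≡0 (allSubsets n) (λ E →
        trans (when-cong (encodes ℓ U v E) (λ enc → when-¬T {eqTriple P (gen U v E) t} (+ 1) (λ q →
          subst T (trans (cong (inB P ℓ U) (eqTriple⇒≡ (gen U v E) t q)) b) (encodes⇒inB ℓ U v E enc))))
          (when-zero (encodes ℓ U v E)))))
  ... | true with inB⇒encodes ℓ U t (true-T b)
  ... | v₀ , E₀ , enc₀ , refl = sym (begin
    ∑ (allVecs m n) (λ v → ∑ (allSubsets n) (λ E →
      when (encodes ℓ U v E) (when (eqTriple P (gen U v E) (gen U v₀ E₀)) (+ 1))))
      ≡⟨ ∑-cong (allVecs m n) (λ v → trans (∑-cong (allSubsets n) (λ E →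
           trans (sym (when-∧ (encodes ℓ U v E) _ (+ 1)))
             (trans (cong (λ a → when a (+ 1)) (char v E)) (when-∧ (eqVecF v₀ v) _ (+ 1)))))
           (∑-when (allSubsets n) (eqVecF v₀ v) _)) ⟩
    ∑ (allVecs m n) (λ v → when (eqVecF v₀ v) (∑ (allSubsets n) (λ E → when (eqVecB E₀ E) (+ 1))))
      ≡⟨ ∑-allVecs-δ v₀ _ ⟩
    ∑ (allSubsets n) (λ E → when (eqVecB E₀ E) (+ 1))
      ≡⟨ ∑-allSubsets-δ E₀ (λ _ → + 1) ⟩
    + 1 ∎)
    where
    char : ∀ v E → encodes ℓ U v E ∧ eqTriple P (gen U v E) (gen U v₀ E₀) ≡ eqVecF v₀ v ∧ eqVecB E₀ E
    char v E = T-ext to from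
      where
      to : T (encodes ℓ U v E ∧ eqTriple P (gen U v E) (gen U v₀ E₀)) → T (eqVecF v₀ v ∧ eqVecB E₀ E)
      to p with gen-injective U (encodes-Sat ℓ U v E enc) (encodes-feok ℓ U v E enc)
                  (encodes-feok ℓ U v₀ E₀ enc₀)
                  (eqTriple⇒≡ (gen U v E) (gen U v₀ E₀) (T-∧₂ {encodes ℓ U v E} p))
        where enc = T-∧₁ {encodes ℓ U v E} p
      ... | refl , refl = T-∧ (eqVecF-refl v₀) (eqVecB-refl E₀)
      from : T (eqVecF v₀ v ∧ eqVecB E₀ E) → T (encodes ℓ U v E ∧ eqTriple P (gen U v E) (gen U v₀ E₀))
      from p with eqVecF⇒≡ {xs = v₀} {v} (T-∧₁ p) | eqVecB⇒≡ {xs = E₀} {E} (T-∧₂ {eqVecF v₀ v} p)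
      ... | refl | refl = T-∧ {encodes ℓ U v E} enc₀ (eqTriple-refl (gen U v E))

  numB-walks : ∀ ℓ U →
    + numB P ℓ U ≡ ∑ (walks n bot top) (λ w → when (badIs false 0 U w) (when (exc w ≡ᵇ ℓ) (+ 1)))
  numB-walks ℓ U = begin
    + numB P ℓ U
      ≡⟨ count-∑ (inB P ℓ U) (triples P) ⟩
    ∑ (triples P) (λ t → when (inB P ℓ U t) (+ 1))
      ≡⟨ ∑-cong (triples P) (when-inB ℓ U) ⟩
    ∑ (triples P) (λ t → ∑ (allVecs m n) (λ v → ∑ (allSubsets n) (λ E → h v E t)))
      ≡⟨ ∑-swap (triples P) (allVecs m n) _ ⟩
    ∑ (allVecs m n) (λ v → ∑ (triples P) (λ t → ∑ (allSubsets n) (λ E → h v E t)))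
      ≡⟨ ∑-cong (allVecs m n) (λ v → ∑-swap (triples P) (allSubsets n) _) ⟩
    ∑ (allVecs m n) (λ v → ∑ (allSubsets n) (λ E → ∑ (triples P) (h v E)))
      ≡⟨ ∑-cong (allVecs m n) (λ v → ∑-cong (allSubsets n) (λ E → trans
           (∑-when (triples P) (encodes ℓ U v E) _)
           (trans (when-cong (encodes ℓ U v E) (encodes-∑-triples ℓ U v E))
             (trans (when-∧ (coversTo top bot (toList v)) _ (+ 1))
               (cong (when (coversTo top bot (toList v))) (when-∧ (badIs false 0 U (steps bot v E)) _ (+ 1))))))) ⟩
    ∑ (allVecs m n) (λ v → ∑ (allSubsets n) (λ E → when (coversTo top bot (toList v))
      (when (badIs false 0 U (steps bot v E)) (when (exc (steps bot v E) ≡ᵇ ℓ) (+ 1)))))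
      ≡⟨ ∑-walks-vecs n bot top (λ w → when (badIs false 0 U w) (when (exc w ≡ᵇ ℓ) (+ 1))) ⟨
    ∑ (walks n bot top) (λ w → when (badIs false 0 U w) (when (exc w ≡ᵇ ℓ) (+ 1))) ∎
    where
    h : Vec (Fin m) n → Vec Bool n → Triple P → ℤ
    h v E t = when (encodes ℓ U v E) (when (eqTriple P (gen U v E) t) (+ 1))

theorem3p6 : ∀ {m n : ℕ} (P : RLabeledPoset m n) (T : Subset n) (ℓ : ℕ) →
    exPsiCoeff P ℓ T ≡ + numB P ℓ T
theorem3p6 P T ℓ = trans (Chains.exPsiCoeff-walks P ℓ T) (sym (Triples.numB-walks P ℓ T))
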